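{- Let $\epsilon>0$. There exists $t_0(\epsilon)$ such that for every integer $t>t_0(\epsilon)$ there exists $n_0(t)$ (depending also on $\epsilon$) such that $t$-IMOLS$(n;m)$ exist for all integers $n,m\ge n_0(t)$ satisfying $n>(1+\epsilon)(t+1)m$.
   Context: An incomplete latin square of side $n$ with a hole of size $m$ is an $n\times n$ array $L=(L_{ij})_{i,j\in[n]}$ with symbols from $[n]=\{1,\dots,n\}$ together with a hole $M\subseteq[n]$, $|M|=m$, such that: $L_{ij}$ is empty if $\{i,j\}\subseteq M$; $L_{ij}$ contains exactly one symbol if $\{i,j\}\not\subseteq M$; every row and every column contains each symbol at most once; and symbols in $M$ do not appear in rows or columns indexed by $M$. Two incomplete latin squares with the common hole $M$ are orthogonal if, when superimposed, every ordered pair of symbols not in $M\times M$ occurs exactly once among the nonblank cells. $t$-IMOLS$(n;m)$ denotes a set of $t$ pairwise orthogonal incomplete latin squares of side $n$ with a common hole of size $m$. -}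

module Defs where

open import Data.Nat using (ℕ)
open import Data.Fin using (Fin)
open import Data.Fin.Subset using (Subset; _∈_; _∉_; ∣_∣)
open import Data.Maybe using (Maybe; just; nothing)
open import Data.Product using (_×_; Σ; ∃; ∃-syntax; _,_)
open import Relation.Nullary using (¬_)
open import Relation.Binary.PropositionalEquality using (_≡_; _≢_)
open import Data.Integer using (+_)
open import Data.Rational using (ℚ; _/_)

ℕtoℚ : ℕ → ℚ
ℕtoℚ k = + k / 1

-- An n×n partial array with symbols from [n] ≅ Fin n; nothing = empty cell.
Array : ℕ → Set
Array n = Fin n → Fin n → Maybe (Fin n)

record IsIncompleteLatinSquare {n : ℕ} (M : Subset n) (L : Array n) : Set where
  field
    hole-empty  : ∀ i j → i ∈ M → j ∈ M → L i j ≡ nothing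
    filled      : ∀ i j → ¬ (i ∈ M × j ∈ M) → ∃[ s ] (L i j ≡ just s)
    row-latin   : ∀ i j k s → L i j ≡ just s → L i k ≡ just s → j ≡ k
    col-latin   : ∀ i j k s → L i k ≡ just s → L j k ≡ just s → i ≡ j
    row-hole    : ∀ i j s → i ∈ M → L i j ≡ just s → s ∉ M
    col-hole    : ∀ i j s → j ∈ M → L i j ≡ just s → s ∉ M

Orthogonal : {n : ℕ} (M : Subset n) (L₁ L₂ : Array n) → Set
Orthogonal {n} M L₁ L₂ =
  ∀ (a b : Fin n) → ¬ (a ∈ M × b ∈ M) →
    Σ (Fin n × Fin n) λ { (i , j) →
      (L₁ i j ≡ just a × L₂ i j ≡ just b) ×
      (∀ i' j' → L₁ i' j' ≡ just a → L₂ i' j' ≡ just b → (i' ≡ i × j' ≡ j)) }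

IMOLS : ℕ → ℕ → ℕ → Set
IMOLS t n m =
  Σ (Subset n) λ M → ∣ M ∣ ≡ m ×
  Σ (Fin t → Array n) λ L →
    (∀ k → IsIncompleteLatinSquare M (L k)) ×
    (∀ k l → k ≢ l → Orthogonal M (L k) (L l))

{-# OPTIONS --safe #-}
-- t-IMOLS(n;m) amount to an orthogonal array with k = t + 2 columns on n points
-- that covers all pairs except those inside the hole.
--
-- Let q = e f + 1 be a large prime with e a large power of two, let H be the
-- group of e-th powers modulo q, and put v = ⌊ e / k ⌋.  Multiplying suitable
-- base columns by H and translating them gives an array on q + v f points with a
-- hole of size v f, so that q / (v f) is about k.  The base columns need elements
-- whose differences lie in prescribed cosets of H; they exist because every set
-- of k elements has a translate inside H, which is Brauer's theorem (derived
-- from Hales–Jewett) applied to the colouring by cosets.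
--
-- Wilson's product construction on transversal designs inflates two coprime such
-- q to arrays with S and with S + 1 points outside a hole of one common size W,
-- S ≤ (k + 3) W, and applied to these reaches all n and m with n - m ≥ (k + 4) m.
-- For t large compared with 1 / ε this follows from n > (1 + ε)(t + 1) m.
-- The transversal designs come from moduli without small prime factors and from
-- powers d ^ b with b large, on which a linear shift register provides the maps.
module Submission where

-- With `e = 2 ^ (s + 1)`, primes `p` such that `e` divides `p - 1` come from the factors of
-- `x ^ (2 ^ s) + 1`, and `x` modulo such an odd prime is a root of unity of order `e` from which
-- the index of `H` is read off. Both `e` and `k` are fixed before the prime, so the characteristic
-- that Brauer's theorem demands is known when the prime is chosen.
--
-- The second half is shaped by the orders `n` between multiples. Reaching them takes a transversal
-- design with one truncated group. Its blocks have two sizes, which is why two consecutive point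
-- numbers must share one hole size. A prime alone fixes its hole; multiplying two primes up along a
-- Bézout relation `1 + p T = p′ T′` makes the holes agree.
--
-- Each stage gives away one multiple of the hole: the prime stage ends at the factor `k + 2`, and
-- the next two add 1 each. With the hole itself and `k = t + 2` the total is `t + 7`, six more than
-- `t + 1`, and this excess of `6 m` is what `ε (t + 1) m` has to pay for.

-- Orthogonal arrays over a prescribed relation of covered pairs

module OrthogonalArrays where

  open import Data.Nat.Base using (ℕ; zero; suc)
  open import Data.Nat.Properties using (1+n≰n)
  open import Data.Fin.Base using (Fin; zero; suc; punchOut)
  open import Data.Fin.Properties using (any?; punchOut-injective; injective⇒≤; *↔×; suc-injective) renaming (_≟_ to _≟F_)
  open import Data.Product using (Σ; ∃; _×_; _,_; proj₁; proj₂)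
  open import Data.Product.Function.NonDependent.Propositional using (_×-↔_)
  open import Data.Sum using (_⊎_; inj₁; inj₂)
  open import Data.Unit using (⊤; tt)
  open import Data.Empty using (⊥; ⊥-elim)
  open import Function.Base using (_∘_)
  open import Function.Bundles using (_↔_; Inverse)
  open import Function.Construct.Composition using (_↔-∘_)
  open import Function.Construct.Symmetry using (↔-sym)
  open import Relation.Nullary using (¬_; yes; no)
  open import Relation.Nullary.Decidable using (map′)
  open import Relation.Binary.Definitions using (DecidableEquality)
  open import Relation.Binary.PropositionalEquality

  -- `E` consists of the ordered pairs that any two columns must show exactly once. `unique`
  -- compares entries rather than blocks, so `Block` may carry proofs, such as the inequality in
  -- `idempotent`, whose equality is then never in question.
  record OA (k : ℕ) {A : Set} (E : A → A → Set) : Set₁ where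
    field
      Block  : Set
      entry  : Block → Fin k → A
      sound  : ∀ β {r s} → r ≢ s → E (entry β r) (entry β s)
      find   : ∀ {r s} → r ≢ s → ∀ {a b} → E a b →
               Σ Block λ β → entry β r ≡ a × entry β s ≡ b
      unique : ∀ {r s} → r ≢ s → ∀ β β′ → entry β r ≡ entry β′ r →
               entry β s ≡ entry β′ s → ∀ j → entry β j ≡ entry β′ j

  Full : (A : Set) → A → A → Set
  Full A _ _ = ⊤

  -- The pairs to be covered when the points of W form a hole and every point
  -- of S is a hole of size one.
  Holey : (S W : Set) → S ⊎ W → S ⊎ W → Set
  Holey S W (inj₁ a) (inj₁ b) = a ≢ b
  Holey S W (inj₁ a) (inj₂ w) = ⊤
  Holey S W (inj₂ w) (inj₁ b) = ⊤
  Holey S W (inj₂ w) (inj₂ x) = ⊥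

  open OA

  respects : ∀ {k} {A : Set} {E E′ : A → A → Set} →
             (∀ {a b} → E a b → E′ a b) → (∀ {a b} → E′ a b → E a b) → OA k E → OA k E′
  respects to from O = record
    { Block = Block O ; entry = entry O
    ; sound = λ β r≢s → to (sound O β r≢s)
    ; find = λ r≢s e → find O r≢s (from e)
    ; unique = unique O }

  restrict : ∀ {k l} {A : Set} {E : A → A → Set} (g : Fin l → Fin k) →
             (∀ {r s} → g r ≡ g s → r ≡ s) → OA k E → OA l E
  restrict g g-inj O = record
    { Block = Block O ; entry = λ β r → entry O β (g r)
    ; sound = λ β r≢s → sound O β (r≢s ∘ g-inj)
    ; find = λ r≢s e → find O (r≢s ∘ g-inj) e
    ; unique = λ r≢s β β′ p q j → unique O (r≢s ∘ g-inj) β β′ p q (g j) }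

  Image : {A B : Set} (f : A → B) (E : A → A → Set) → B → B → Set
  Image {A} f E b b′ = Σ A λ a → Σ A λ a′ → E a a′ × f a ≡ b × f a′ ≡ b′

  image : ∀ {k} {A B : Set} {E : A → A → Set} (f : A → B) →
          (∀ {a a′} → f a ≡ f a′ → a ≡ a′) → OA k E → OA k (Image f E)
  image f f-inj O = record
    { Block = Block O ; entry = λ β r → f (entry O β r)
    ; sound = λ β r≢s → _ , _ , sound O β r≢s , refl , refl
    ; find = λ { r≢s (a , a′ , e , refl , refl) →
        let β , p , q = find O r≢s e in β , cong f p , cong f q }
    ; unique = λ r≢s β β′ p q j → cong f (unique O r≢s β β′ (f-inj p) (f-inj q) j) }

  -- Two blocks that agree in two columns show a common pair there, and disjointness assigns that
  -- pair to a single index.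
  ⋃ : ∀ {k} {A I : Set} {E : I → A → A → Set} →
      (∀ {i j a b} → E i a b → E j a b → i ≡ j) →
      (∀ i → OA k (E i)) → OA k (λ a b → Σ I λ i → E i a b)
  ⋃ {k} {A} {I} {E} disjoint O = record
    { Block = Σ I λ i → Block (O i)
    ; entry = λ { (i , β) → entry (O i) β }
    ; sound = λ { (i , β) r≢s → i , sound (O i) β r≢s }
    ; find = λ { r≢s (i , e) → let β , p = find (O i) r≢s e in (i , β) , p }
    ; unique = uniq }
    where
    uniq : ∀ {r s} → r ≢ s → (β β′ : Σ I λ i → Block (O i)) →
           entry (O (proj₁ β)) (proj₂ β) r ≡ entry (O (proj₁ β′)) (proj₂ β′) r →
           entry (O (proj₁ β)) (proj₂ β) s ≡ entry (O (proj₁ β′)) (proj₂ β′) s →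
           ∀ j → entry (O (proj₁ β)) (proj₂ β) j ≡ entry (O (proj₁ β′)) (proj₂ β′) j
    uniq r≢s (i , β) (i′ , β′) p q
      with disjoint (sound (O i) β r≢s)
                    (subst₂ (E i′) (sym p) (sym q) (sound (O i′) β′ r≢s))
    ... | refl = unique (O i) r≢s β β′ p q

  union : ∀ {k} {A : Set} {E₁ E₂ : A → A → Set} →
          (∀ {a b} → E₁ a b → E₂ a b → ⊥) → OA k E₁ → OA k E₂ →
          OA k (λ a b → E₁ a b ⊎ E₂ a b)
  union {E₁ = E₁} {E₂} disjoint O₁ O₂ = record
    { Block = Block O₁ ⊎ Block O₂
    ; entry = ent
    ; sound = λ { (inj₁ β) r≢s → inj₁ (sound O₁ β r≢s) ; (inj₂ β) r≢s → inj₂ (sound O₂ β r≢s) }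
    ; find = λ { r≢s (inj₁ e) → let β , p = find O₁ r≢s e in inj₁ β , p
               ; r≢s (inj₂ e) → let β , p = find O₂ r≢s e in inj₂ β , p }
    ; unique = uniq }
    where
    ent : Block O₁ ⊎ Block O₂ → Fin _ → _
    ent (inj₁ β) = entry O₁ β
    ent (inj₂ β) = entry O₂ β
    uniq : ∀ {r s} → r ≢ s → (β β′ : Block O₁ ⊎ Block O₂) → ent β r ≡ ent β′ r →
           ent β s ≡ ent β′ s → ∀ j → ent β j ≡ ent β′ j
    uniq r≢s (inj₁ β) (inj₁ β′) p q = unique O₁ r≢s β β′ p q
    uniq r≢s (inj₂ β) (inj₂ β′) p q = unique O₂ r≢s β β′ p q
    uniq r≢s (inj₁ β) (inj₂ β′) p q =
      ⊥-elim (disjoint (sound O₁ β r≢s) (subst₂ E₂ (sym p) (sym q) (sound O₂ β′ r≢s)))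
    uniq r≢s (inj₂ β) (inj₁ β′) p q =
      ⊥-elim (disjoint (sound O₁ β′ r≢s) (subst₂ E₂ p q (sound O₂ β r≢s)))

  diagonal : ∀ {k} {A : Set} → OA k {A} _≡_
  diagonal {A = A} = record
    { Block = A ; entry = λ a _ → a
    ; sound = λ _ _ → refl
    ; find = λ { _ {a} refl → a , refl , refl }
    ; unique = λ _ _ _ p _ _ → p }

  -- This is MacNeish's direct product.
  product : ∀ {k} {A B : Set} → OA k (Full A) → OA k (Full B) → OA k (Full (A × B))
  product O P = record
    { Block = Block O × Block P
    ; entry = λ { (β , γ) r → entry O β r , entry P γ r }
    ; sound = λ _ _ → tt
    ; find = λ { r≢s {a , b} {a′ , b′} _ →
        let β , p , q = find O r≢s {a} {a′} tt
            γ , u , v = find P r≢s {b} {b′} tt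
        in (β , γ) , cong₂ _,_ p u , cong₂ _,_ q v }
    ; unique = λ { r≢s (β , γ) (β′ , γ′) p q j →
        cong₂ _,_ (unique O r≢s β β′ (cong proj₁ p) (cong proj₁ q) j)
                  (unique P r≢s γ γ′ (cong proj₂ p) (cong proj₂ q) j) } }

  module _ {A B : Set} (f : A ↔ B) where
    open Inverse f

    to-injective : ∀ {x y} → to x ≡ to y → x ≡ y
    to-injective {x} {y} p = trans (sym (strictlyInverseʳ x)) (trans (cong from p) (strictlyInverseʳ y))

    from-injective : ∀ {x y} → from x ≡ from y → x ≡ y
    from-injective {x} {y} p = trans (sym (strictlyInverseˡ x)) (trans (cong to p) (strictlyInverseˡ y))

    transport-Full : ∀ {k} → OA k (Full A) → OA k (Full B)
    transport-Full O = respects (λ _ → tt)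
      (λ {a} {b} _ → from a , from b , tt , strictlyInverseˡ a , strictlyInverseˡ b)
      (image to to-injective O)

    transport-≢ : ∀ {k} → OA k {A} _≢_ → OA k {B} _≢_
    transport-≢ O = respects
      (λ { (a , a′ , a≢a′ , refl , refl) → a≢a′ ∘ to-injective })
      (λ {a} {b} a≢b → from a , from b , a≢b ∘ from-injective , strictlyInverseˡ a , strictlyInverseˡ b)
      (image to to-injective O)

  transport-Holey : ∀ {k} {S S′ W W′ : Set} → S ↔ S′ → W ↔ W′ →
                    OA k (Holey S W) → OA k (Holey S′ W′)
  transport-Holey {S = S} {S′} {W} {W′} f g O = respects into back (image h h-inj O)
    where
    module f = Inverse f
    module g = Inverse g
    h : S ⊎ W → S′ ⊎ W′
    h (inj₁ s) = inj₁ (f.to s)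
    h (inj₂ w) = inj₂ (g.to w)
    h-inj : ∀ {a a′} → h a ≡ h a′ → a ≡ a′
    h-inj {inj₁ s} {inj₁ s′} p = cong inj₁ (to-injective f (inj₁-inj p))
      where inj₁-inj : ∀ {x y} → inj₁ x ≡ inj₁ y → x ≡ y
            inj₁-inj refl = refl
    h-inj {inj₂ s} {inj₂ s′} p = cong inj₂ (to-injective g (inj₂-inj p))
      where inj₂-inj : ∀ {x y} → inj₂ x ≡ inj₂ y → x ≡ y
            inj₂-inj refl = refl
    into : ∀ {a b} → Image h (Holey S W) a b → Holey S′ W′ a b
    into (inj₁ s , inj₁ s′ , e , refl , refl) = e ∘ to-injective f
    into (inj₁ s , inj₂ s′ , e , refl , refl) = tt
    into (inj₂ s , inj₁ s′ , e , refl , refl) = tt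
    back : ∀ {a b} → Holey S′ W′ a b → Image h (Holey S W) a b
    back {inj₁ s} {inj₁ s′} e = inj₁ (f.from s) , inj₁ (f.from s′) , e ∘ from-injective f ,
      cong inj₁ (f.strictlyInverseˡ s) , cong inj₁ (f.strictlyInverseˡ s′)
    back {inj₁ s} {inj₂ s′} e = inj₁ (f.from s) , inj₂ (g.from s′) , tt ,
      cong inj₁ (f.strictlyInverseˡ s) , cong inj₂ (g.strictlyInverseˡ s′)
    back {inj₂ s} {inj₁ s′} e = inj₂ (g.from s) , inj₁ (f.from s′) , tt ,
      cong inj₂ (g.strictlyInverseˡ s) , cong inj₁ (f.strictlyInverseˡ s′)

  -- The blocks through a fixed point of the extra column form a parallel class,
  -- which becomes the diagonal after relabelling each column.
  idempotent : ∀ {k} {A : Set} (∞ : A) → OA (suc (suc k)) (Full A) → OA (suc k) {A} _≢_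
  idempotent {k} {A} ∞ O = record
    { Block = Σ (Block O) λ β → entry O β zero ≢ ∞
    ; entry = λ { (β , _) j → σ j (entry O β (suc j)) }
    ; sound = snd
    ; find = fnd
    ; unique = uni }
    where
    0≢ : ∀ {n} {j : Fin n} → Fin.zero ≢ suc j
    0≢ ()
    thru : (j : Fin (suc k)) (y : A) → Σ (Block O) λ β → entry O β zero ≡ ∞ × entry O β (suc j) ≡ y
    thru j y = find O 0≢ {∞} {y} tt
    -- A symbol of column `suc j` is renamed after the entry that its block of the parallel class
    -- has in column `suc zero`, so every block of the class becomes constant.
    σ : Fin (suc k) → A → A
    σ j y = entry O (proj₁ (thru j y)) (suc zero)
    same : ∀ i j {y z} → σ i y ≡ σ j z → ∀ l →
           entry O (proj₁ (thru i y)) l ≡ entry O (proj₁ (thru j z)) l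
    same i j {y} {z} p = unique O {zero} {suc zero} 0≢ _ _
      (trans (proj₁ (proj₂ (thru i y))) (sym (proj₁ (proj₂ (thru j z))))) p
    σ-inj : ∀ j {y z} → σ j y ≡ σ j z → y ≡ z
    σ-inj j {y} {z} p = trans (sym (proj₂ (proj₂ (thru j y)))) (trans (same j j p (suc j)) (proj₂ (proj₂ (thru j z))))
    ρ : Fin (suc k) → A → A
    ρ j a = entry O (proj₁ (thru zero a)) (suc j)
    σρ : ∀ j a → σ j (ρ j a) ≡ a
    σρ j a = trans
      (unique O {zero} {suc j} 0≢ (proj₁ (thru j (ρ j a))) (proj₁ (thru zero a))
        (trans (proj₁ (proj₂ (thru j (ρ j a)))) (sym (proj₁ (proj₂ (thru zero a)))))
        (proj₂ (proj₂ (thru j (ρ j a)))) (suc zero))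
      (proj₂ (proj₂ (thru zero a)))
    snd : ∀ (β : Σ (Block O) λ β → entry O β zero ≢ ∞) {r s} → r ≢ s →
          σ r (entry O (proj₁ β) (suc r)) ≢ σ s (entry O (proj₁ β) (suc s))
    snd (β , β≢) {r} {s} r≢s p = β≢ (trans (β≡ zero) (proj₁ (proj₂ T)))
      where
      -- If two renamed entries agree, the class blocks through them coincide, and this block meets
      -- `β` in two columns; hence `β` itself passes through `∞`.
      T = thru r (entry O β (suc r))
      β≡ : ∀ j → entry O β j ≡ entry O (proj₁ T) j
      β≡ = unique O (r≢s ∘ suc-injective) β (proj₁ T) (sym (proj₂ (proj₂ T)))
        (trans (sym (proj₂ (proj₂ (thru s (entry O β (suc s)))))) (sym (same r s p (suc s))))
    fnd : ∀ {r s} → r ≢ s → ∀ {a b} → a ≢ b → Σ (Σ (Block O) λ β → entry O β zero ≢ ∞) λ β →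
          σ r (entry O (proj₁ β) (suc r)) ≡ a × σ s (entry O (proj₁ β) (suc s)) ≡ b
    fnd {r} {s} r≢s {a} {b} a≢b with find O (r≢s ∘ suc-injective) {ρ r a} {ρ s b} tt
    ... | β , p , q = (β , β≢) , trans (cong (σ r) p) (σρ r a) , trans (cong (σ s) q) (σρ s b)
      where
      on : ∀ j c → entry O β zero ≡ ∞ → entry O β (suc j) ≡ ρ j c → entry O β (suc zero) ≡ c
      on j c z e = trans (unique O {zero} {suc j} 0≢ β (proj₁ (thru zero c))
        (trans z (sym (proj₁ (proj₂ (thru zero c))))) e (suc zero)) (proj₂ (proj₂ (thru zero c)))
      β≢ : entry O β zero ≢ ∞
      β≢ z = a≢b (trans (sym (on r a z p)) (on s b z q))
    uni : ∀ {r s} → r ≢ s → (β β′ : Σ (Block O) λ β → entry O β zero ≢ ∞) →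
          σ r (entry O (proj₁ β) (suc r)) ≡ σ r (entry O (proj₁ β′) (suc r)) →
          σ s (entry O (proj₁ β) (suc s)) ≡ σ s (entry O (proj₁ β′) (suc s)) →
          ∀ j → σ j (entry O (proj₁ β) (suc j)) ≡ σ j (entry O (proj₁ β′) (suc j))
    uni {r} {s} r≢s (β , _) (β′ , _) p q j =
      cong (σ j) (unique O (r≢s ∘ suc-injective) β β′ (σ-inj r p) (σ-inj s q) (suc j))

  module _ {n : ℕ} where
    injective⇒surjective : {f : Fin n → Fin n} → (∀ {x y} → f x ≡ f y → x ≡ y) →
                           ∀ y → ∃ λ x → f x ≡ y
    injective⇒surjective {f} f-inj y with any? (λ x → f x ≟F y)
    ... | yes p = p
    ... | no ¬p = ⊥-elim (clash n f f-inj y ¬p)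
      where
      clash : ∀ n (f : Fin n → Fin n) → (∀ {x y} → f x ≡ f y → x ≡ y) →
              ∀ y → ¬ (∃ λ x → f x ≡ y) → ⊥
      clash (suc n) f f-inj y ¬p = 1+n≰n (injective⇒≤ {f = λ x → punchOut {i = y} (λ e → ¬p (x , sym e))}
        λ {x} {x′} e → f-inj (punchOut-injective (λ e → ¬p (x , sym e)) (λ e → ¬p (x′ , sym e)) e))

  module _ {n : ℕ} {A : Set} (A↔ : A ↔ Fin n) where
    open Inverse A↔

    finite-injective⇒surjective : {f : A → A} → (∀ {x y} → f x ≡ f y → x ≡ y) →
                                  ∀ y → ∃ λ x → f x ≡ y
    finite-injective⇒surjective {f} f-inj y =
      let x , p = injective⇒surjective {f = to ∘ f ∘ from}
                    (from-injective A↔ ∘ f-inj ∘ to-injective A↔) (to y)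
      in from x , to-injective A↔ p

    finite-≟ : DecidableEquality A
    finite-≟ x y = map′ (to-injective A↔) (cong to) (to x ≟F to y)

  -- By counting: an injective map from A × A to itself is onto.
  fromUnique : ∀ {n k} {A : Set} → A ↔ Fin n → (ent : A × A → Fin k → A) →
               (∀ {r s} → r ≢ s → ∀ β β′ → ent β r ≡ ent β′ r → ent β s ≡ ent β′ s → β ≡ β′) →
               OA k (Full A)
  fromUnique {A = A} A↔ ent uniq = record
    { Block = A × A ; entry = ent ; sound = λ _ _ → tt
    ; find = λ {r} {s} r≢s {a} {b} _ →
        let β , p = finite-injective⇒surjective (↔-sym *↔× ↔-∘ (A↔ ×-↔ A↔))
                      {f = λ β → ent β r , ent β s}
                      (λ e → uniq r≢s _ _ (cong proj₁ e) (cong proj₂ e)) (a , b)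
        in β , cong proj₁ p , cong proj₂ p
    ; unique = λ r≢s β β′ p q j → cong (λ γ → ent γ j) (uniq r≢s β β′ p q) }

  ≢⇒Full : ∀ {k} {A : Set} → DecidableEquality A → OA k {A} _≢_ → OA k (Full A)
  ≢⇒Full _≟_ O = respects (λ _ → tt) split (union (λ a≡b a≢b → a≢b a≡b) diagonal O)
    where
    split : ∀ {a b} → ⊤ → a ≡ b ⊎ a ≢ b
    split {a} {b} _ with a ≟ b
    ... | yes p = inj₁ p
    ... | no ¬p = inj₂ ¬p

-- The ring of integers modulo `n`

module ModularArithmetic where

  open import Data.Nat.Base
  open import Data.Nat.Properties
  open import Data.Nat.DivMod using (_%_; _mod_; m%n<n; %-distribˡ-+; %-distribˡ-*; m<n⇒m%n≡m; n%n≡0)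
  open import Data.Nat.Divisibility using (_∣_; m%n≡0⇒n∣m; n∣m⇒m%n≡0)
  open import Data.Nat.Coprimality using (Coprime; coprime-divisor)
  open import Data.Fin.Base using (Fin; toℕ)
  open import Data.Fin.Properties using (toℕ-fromℕ<; toℕ-injective; toℕ<n)
  open import Data.Product using (_,_)
  open import Algebra.Bundles using (CommutativeRing)
  open import Algebra.Structures using (IsCommutativeRing)
  open import Level using (0ℓ)
  open import Relation.Binary.PropositionalEquality

  module _ (n : ℕ) .{{_ : NonZero n}} where

    infixl 6 _⊕_
    infixl 7 _⊗_

    abstract
      residue : ℕ → Fin n
      residue a = a mod n

      _⊕_ _⊗_ : Fin n → Fin n → Fin n
      x ⊕ y = residue (toℕ x + toℕ y)
      x ⊗ y = residue (toℕ x * toℕ y)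

      ⊖_ : Fin n → Fin n
      ⊖ x = residue (n ∸ toℕ x)

      toℕ-residue : ∀ a → toℕ (residue a) ≡ a % n
      toℕ-residue a = toℕ-fromℕ< (m%n<n a n)

      residue-cong : ∀ {a b} → a % n ≡ b % n → residue a ≡ residue b
      residue-cong {a} {b} p = toℕ-injective (trans (toℕ-residue a) (trans p (sym (toℕ-residue b))))

      residue⁻¹ : ∀ {a b} → residue a ≡ residue b → a % n ≡ b % n
      residue⁻¹ {a} {b} p = trans (sym (toℕ-residue a)) (trans (cong toℕ p) (toℕ-residue b))

      residue-toℕ : ∀ x → residue (toℕ x) ≡ x
      residue-toℕ x = toℕ-injective (trans (toℕ-residue (toℕ x)) (m<n⇒m%n≡m (toℕ<n x)))

      residue-+ : ∀ a b → residue a ⊕ residue b ≡ residue (a + b)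
      residue-+ a b = residue-cong (trans (cong₂ (λ u v → (u + v) % n) (toℕ-residue a) (toℕ-residue b))
                                          (sym (%-distribˡ-+ a b n)))

      residue-* : ∀ a b → residue a ⊗ residue b ≡ residue (a * b)
      residue-* a b = residue-cong (trans (cong₂ (λ u v → (u * v) % n) (toℕ-residue a) (toℕ-residue b))
                                          (sym (%-distribˡ-* a b n)))

      private
        +ˡ : ∀ a y → residue a ⊕ y ≡ residue (a + toℕ y)
        +ˡ a y = trans (cong (residue a ⊕_) (sym (residue-toℕ y))) (residue-+ a (toℕ y))
        +ʳ : ∀ x b → x ⊕ residue b ≡ residue (toℕ x + b)
        +ʳ x b = trans (cong (_⊕ residue b) (sym (residue-toℕ x))) (residue-+ (toℕ x) b)
        *ˡ : ∀ a y → residue a ⊗ y ≡ residue (a * toℕ y)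
        *ˡ a y = trans (cong (residue a ⊗_) (sym (residue-toℕ y))) (residue-* a (toℕ y))
        *ʳ : ∀ x b → x ⊗ residue b ≡ residue (toℕ x * b)
        *ʳ x b = trans (cong (_⊗ residue b) (sym (residue-toℕ x))) (residue-* (toℕ x) b)

        ⊕-comm : ∀ x y → x ⊕ y ≡ y ⊕ x
        ⊕-comm x y = cong residue (+-comm (toℕ x) (toℕ y))
        ⊗-comm : ∀ x y → x ⊗ y ≡ y ⊗ x
        ⊗-comm x y = cong residue (*-comm (toℕ x) (toℕ y))
        ⊕-assoc : ∀ x y z → (x ⊕ y) ⊕ z ≡ x ⊕ (y ⊕ z)
        ⊕-assoc x y z = trans (+ˡ _ z) (trans (cong residue (+-assoc (toℕ x) (toℕ y) (toℕ z))) (sym (+ʳ x _)))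
        ⊗-assoc : ∀ x y z → (x ⊗ y) ⊗ z ≡ x ⊗ (y ⊗ z)
        ⊗-assoc x y z = trans (*ˡ _ z) (trans (cong residue (*-assoc (toℕ x) (toℕ y) (toℕ z))) (sym (*ʳ x _)))
        ⊕-identityˡ : ∀ x → residue 0 ⊕ x ≡ x
        ⊕-identityˡ x = trans (+ˡ 0 x) (residue-toℕ x)
        ⊗-identityˡ : ∀ x → residue 1 ⊗ x ≡ x
        ⊗-identityˡ x = trans (*ˡ 1 x) (trans (cong residue (*-identityˡ (toℕ x))) (residue-toℕ x))
        ⊖-inverseʳ : ∀ x → x ⊕ ⊖ x ≡ residue 0
        ⊖-inverseʳ x = trans (+ʳ x _) (residue-cong (trans (cong (_% n) (m+[n∸m]≡n (<⇒≤ (toℕ<n x))))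
          (trans (n%n≡0 n) (sym (m<n⇒m%n≡m (>-nonZero⁻¹ n))))))
        ⊗-distribˡ : ∀ x y z → x ⊗ (y ⊕ z) ≡ (x ⊗ y) ⊕ (x ⊗ z)
        ⊗-distribˡ x y z = trans (*ʳ x _) (trans (cong residue (*-distribˡ-+ (toℕ x) (toℕ y) (toℕ z)))
          (sym (residue-+ _ _)))

      ℤ/-isCommutativeRing : IsCommutativeRing _≡_ _⊕_ _⊗_ ⊖_ (residue 0) (residue 1)
      ℤ/-isCommutativeRing = record
        { isRing = record
          { +-isAbelianGroup = record
            { isGroup = record
              { isMonoid = record
                { isSemigroup = record
                  { isMagma = record { isEquivalence = isEquivalence ; ∙-cong = cong₂ _⊕_ }
                  ; assoc = ⊕-assoc }
                ; identity = ⊕-identityˡ , λ x → trans (⊕-comm x _) (⊕-identityˡ x) }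
              ; inverse = (λ x → trans (⊕-comm _ x) (⊖-inverseʳ x)) , ⊖-inverseʳ
              ; ⁻¹-cong = cong ⊖_ }
            ; comm = ⊕-comm }
          ; *-cong = cong₂ _⊗_
          ; *-assoc = ⊗-assoc
          ; *-identity = ⊗-identityˡ , λ x → trans (⊗-comm x _) (⊗-identityˡ x)
          ; distrib = ⊗-distribˡ , λ x y z → trans (⊗-comm (y ⊕ z) x) (trans (⊗-distribˡ x y z)
                                               (cong₂ _⊕_ (⊗-comm x y) (⊗-comm x z))) }
        ; *-comm = ⊗-comm }

    ℤ/ : CommutativeRing 0ℓ 0ℓ
    ℤ/ = record { isCommutativeRing = ℤ/-isCommutativeRing }

    residue≡0⇒∣ : ∀ {a} → residue a ≡ residue 0 → n ∣ a
    residue≡0⇒∣ {a} p = m%n≡0⇒n∣m a n (trans (residue⁻¹ p) (m<n⇒m%n≡m (>-nonZero⁻¹ n)))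

    ∣⇒residue≡0 : ∀ {a} → n ∣ a → residue a ≡ residue 0
    ∣⇒residue≡0 {a} p = residue-cong (trans (n∣m⇒m%n≡0 a n p) (sym (m<n⇒m%n≡m (>-nonZero⁻¹ n))))

    coprime-⊗-≡0 : ∀ {a x} → Coprime n a → residue a ⊗ x ≡ residue 0 → x ≡ residue 0
    coprime-⊗-≡0 {a} {x} c p = trans (sym (residue-toℕ x))
      (∣⇒residue≡0 (coprime-divisor c (residue≡0⇒∣ (trans (sym (*ˡ a x)) p))))

-- Transversal designs from endomorphisms of abelian groups

module AbelianArrays where

  open OrthogonalArrays
  open ModularArithmetic
  open import Data.Nat.Base
  open import Data.Nat.Properties
  open import Data.Nat.Divisibility using (_∣_; divides; m≤n⇒m!∣n!; ∣-trans; m∣m*n)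
  open import Data.Nat.Coprimality using (Coprime)
  open import Data.Fin.Base using (Fin; zero; suc; toℕ)
  open import Data.Fin.Properties using (toℕ-injective; toℕ<n; *↔×)
  open import Data.Vec.Base using (Vec; []; _∷_; _∷ʳ_; zipWith; map; replicate)
  open import Data.Vec.Properties using (zipWith-assoc; zipWith-comm; zipWith-identityˡ; zipWith-identityʳ; zipWith-inverseˡ; zipWith-inverseʳ)
  open import Data.Product using (_×_; _,_; proj₁; proj₂)
  open import Data.Product.Function.NonDependent.Propositional using (_×-↔_)
  open import Data.Empty using (⊥-elim)
  open import Algebra.Bundles using (AbelianGroup; CommutativeRing)
  open import Algebra.Structures using (IsAbelianGroup; IsCommutativeRing)
  import Algebra.Properties.Group as GroupProperties
  open import Level using (0ℓ)
  open import Function.Base using (_∘_)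
  open import Function.Bundles using (_↔_; mk↔ₛ′)
  open import Function.Construct.Composition using (_↔-∘_)
  open import Function.Construct.Symmetry using (↔-sym)
  open import Function.Construct.Identity using (↔-id)
  open import Relation.Binary.Definitions using (tri<; tri≈; tri>)
  open import Relation.Binary.PropositionalEquality

  module _ {A : Set} {_+ᴬ_ : A → A → A} {0ᴬ : A} { -ᴬ_ : A → A}
           (isAbelianGroup : IsAbelianGroup _≡_ _+ᴬ_ 0ᴬ -ᴬ_) where
    private
      G : AbelianGroup 0ℓ 0ℓ
      G = record { isAbelianGroup = isAbelianGroup }
      open GroupProperties (AbelianGroup.group G) using (∙-cancelʳ; ∙-cancelˡ)
      open IsAbelianGroup isAbelianGroup using (assoc; comm; identityʳ; inverseˡ)

    -- If the blocks of two pairs agree in columns `r` and `s`, subtraction gives `φ r z ≡ φ s z`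
    -- for the difference `z` of the first coordinates, so `z` vanishes. Existence then comes from
    -- counting.
    endomorphismOA : ∀ {n k} → A ↔ Fin n → (φ : Fin k → A → A) →
      (∀ r x y → φ r (x +ᴬ y) ≡ φ r x +ᴬ φ r y) →
      (∀ {r s} → r ≢ s → ∀ {x} → φ r x ≡ φ s x → x ≡ 0ᴬ) → OA k (Full A)
    endomorphismOA A↔ φ φ-+ φ-≢ = fromUnique A↔ (λ { (x , y) r → φ r x +ᴬ y }) uniq
      where
      uniq : ∀ {r s} → r ≢ s → ∀ β β′ →
             φ r (proj₁ β) +ᴬ proj₂ β ≡ φ r (proj₁ β′) +ᴬ proj₂ β′ →
             φ s (proj₁ β) +ᴬ proj₂ β ≡ φ s (proj₁ β′) +ᴬ proj₂ β′ → β ≡ β′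
      uniq {r} {s} r≢s (x , y) (x′ , y′) p q = cong₂ _,_ x≡x′ y≡y′
        where
        z = x +ᴬ (-ᴬ x′)
        z+x′ : z +ᴬ x′ ≡ x
        z+x′ = trans (assoc x _ x′) (trans (cong (x +ᴬ_) (inverseˡ x′)) (identityʳ x))
        shift : ∀ t → φ t x +ᴬ y ≡ φ t x′ +ᴬ y′ → φ t z +ᴬ y ≡ y′
        shift t e = ∙-cancelˡ (φ t x′) _ _ (trans (sym (assoc (φ t x′) (φ t z) y))
          (trans (cong (_+ᴬ y) (trans (comm _ _) (trans (sym (φ-+ t z x′)) (cong (φ t) z+x′)))) e))
        z≡0 : z ≡ 0ᴬ
        z≡0 = φ-≢ r≢s (∙-cancelʳ y _ _ (trans (shift r p) (sym (shift s q))))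
        x≡x′ : x ≡ x′
        x≡x′ = trans (sym z+x′) (trans (cong (_+ᴬ x′) z≡0) (IsAbelianGroup.identityˡ isAbelianGroup x′))
        y≡y′ : y ≡ y′
        y≡y′ = ∙-cancelˡ (φ r x) y y′ (trans p (cong (λ w → φ r w +ᴬ y′) (sym x≡x′)))

  -- Column `r` multiplies by `r`. Two columns differ by multiplication with some `d`, `1 ≤ d < k`,
  -- which is a unit modulo `n`.
  coprimeOA : ∀ n .{{_ : NonZero n}} k → (∀ {d} → 1 ≤ d → d < k → Coprime n d) → OA k (Full (Fin n))
  coprimeOA n k coprime = endomorphismOA +-isAbelianGroup (↔-id _) (λ r x → residue n (toℕ r) ⊗′ x)
    (λ r → IsCommutativeRing.distribˡ (ℤ/-isCommutativeRing n) (residue n (toℕ r))) sep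
    where
    open IsCommutativeRing (ℤ/-isCommutativeRing n) using (+-isAbelianGroup; distribʳ) renaming (+-identityˡ to ⊕-identityˡ)
    _⊗′_ = _⊗_ n
    _⊕′_ = _⊕_ n
    open GroupProperties (AbelianGroup.group (CommutativeRing.+-abelianGroup (ℤ/ n))) using (∙-cancelʳ)
    sep′ : ∀ {a b} → a < b → b < k → ∀ {x} → residue n a ⊗′ x ≡ residue n b ⊗′ x → x ≡ residue n 0
    sep′ {a} {b} a<b b<k {x} e = coprime-⊗-≡0 n {b ∸ a}
      (coprime (m<n⇒0<n∸m a<b) (≤-trans (s≤s (m∸n≤m b a)) b<k))
      (∙-cancelʳ (residue n a ⊗′ x) (residue n (b ∸ a) ⊗′ x) (residue n 0) (begin
        (residue n (b ∸ a) ⊗′ x) ⊕′ (residue n a ⊗′ x) ≡⟨ distribʳ x (residue n (b ∸ a)) (residue n a) ⟨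
        (residue n (b ∸ a) ⊕′ residue n a) ⊗′ x        ≡⟨ cong (_⊗′ x) (residue-+ n (b ∸ a) a) ⟩
        residue n (b ∸ a + a) ⊗′ x                     ≡⟨ cong (λ c → residue n c ⊗′ x) (m∸n+n≡m (<⇒≤ a<b)) ⟩
        residue n b ⊗′ x                               ≡⟨ e ⟨
        residue n a ⊗′ x                               ≡⟨ ⊕-identityˡ (residue n a ⊗′ x) ⟨
        residue n 0 ⊕′ (residue n a ⊗′ x)              ∎))
      where open ≡-Reasoning
    sep : ∀ {r s : Fin k} → r ≢ s → ∀ {x} → residue n (toℕ r) ⊗′ x ≡ residue n (toℕ s) ⊗′ x → x ≡ residue n 0
    sep {r} {s} r≢s e with <-cmp (toℕ r) (toℕ s)
    ... | tri< r<s _ _ = sep′ r<s (toℕ<n s) e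
    ... | tri≈ _ r≡s _ = ⊥-elim (r≢s (toℕ-injective r≡s))
    ... | tri> _ _ s<r = sep′ s<r (toℕ<n r) (sym e)

  Vec↔ : ∀ {d} b → Vec (Fin d) b ↔ Fin (d ^ b)
  Vec↔ zero = mk↔ₛ′ (λ _ → zero) (λ _ → []) (λ { zero → refl }) (λ { [] → refl })
  Vec↔ (suc b) = ↔-sym *↔× ↔-∘ ((↔-id _ ×-↔ Vec↔ b) ↔-∘
    mk↔ₛ′ (λ { (x ∷ xs) → x , xs }) (λ { (x , xs) → x ∷ xs }) (λ { (x , xs) → refl }) (λ { (x ∷ xs) → refl }))

  -- The shift register C (v₀ , … , v_L) = (v₁ , … , v_L , v₁ - v₀) satisfies
  -- C ^ (L + 1) = C - 1.  Hence C and 1 - C ^ L are invertible, and so is every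
  -- 1 - C ^ l with l dividing L.
  module ShiftRegister {A : Set} {_+ᴬ_ : A → A → A} {0ᴬ : A} { -ᴬ_ : A → A}
                       (isAbelianGroup : IsAbelianGroup _≡_ _+ᴬ_ 0ᴬ -ᴬ_) (m : ℕ) where
    open IsAbelianGroup isAbelianGroup using (assoc; comm; identityˡ; identityʳ; inverseˡ; inverseʳ)
    private
      G : AbelianGroup 0ℓ 0ℓ
      G = record { isAbelianGroup = isAbelianGroup }
      open GroupProperties (AbelianGroup.group G) using (∙-cancelʳ; ∙-cancelˡ)

    L : ℕ
    L = suc m

    V : Set
    V = Vec A (suc L)

    infixl 6 _+ⱽ_
    _+ⱽ_ : ∀ {b} → Vec A b → Vec A b → Vec A b
    _+ⱽ_ = zipWith _+ᴬ_

    Vec-isAbelianGroup : ∀ b → IsAbelianGroup _≡_ (_+ⱽ_ {b}) (replicate b 0ᴬ) (map -ᴬ_)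
    Vec-isAbelianGroup b = record
      { isGroup = record
        { isMonoid = record
          { isSemigroup = record
            { isMagma = record { isEquivalence = isEquivalence ; ∙-cong = cong₂ _ }
            ; assoc = zipWith-assoc assoc }
          ; identity = zipWith-identityˡ identityˡ , zipWith-identityʳ identityʳ }
        ; inverse = zipWith-inverseˡ inverseˡ , zipWith-inverseʳ inverseʳ
        ; ⁻¹-cong = cong _ }
      ; comm = zipWith-comm comm }

    C : V → V
    C (a ∷ a′ ∷ w) = (a′ ∷ w) ∷ʳ (a′ +ᴬ (-ᴬ a))

    C^ : ℕ → V → V
    C^ zero v = v
    C^ (suc i) v = C^ i (C v)

    ∷ʳ-+ : ∀ {b} (v w : Vec A b) x y → (v ∷ʳ x) +ⱽ (w ∷ʳ y) ≡ (v +ⱽ w) ∷ʳ (x +ᴬ y)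
    ∷ʳ-+ [] [] x y = refl
    ∷ʳ-+ (_ ∷ v) (_ ∷ w) x y = cong (_ ∷_) (∷ʳ-+ v w x y)

    C-+ : ∀ v w → C (v +ⱽ w) ≡ C v +ⱽ C w
    C-+ (a ∷ a′ ∷ v) (b ∷ b′ ∷ w) = trans (cong ((a′ +ᴬ b′ ∷ v +ⱽ w) ∷ʳ_) last) (sym (∷ʳ-+ (a′ ∷ v) (b′ ∷ w) _ _))
      where
      last : (a′ +ᴬ b′) +ᴬ (-ᴬ (a +ᴬ b)) ≡ (a′ +ᴬ (-ᴬ a)) +ᴬ (b′ +ᴬ (-ᴬ b))
      last = trans (cong ((a′ +ᴬ b′) +ᴬ_) (trans (GroupProperties.⁻¹-anti-homo-∙ (AbelianGroup.group G) a b) (comm _ _)))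
        (trans (assoc a′ b′ _) (trans (cong (a′ +ᴬ_) (trans (sym (assoc b′ _ _))
          (trans (cong (_+ᴬ (-ᴬ b)) (comm b′ (-ᴬ a))) (assoc _ _ _)))) (sym (assoc a′ _ _))))

    C^-+ : ∀ i v w → C^ i (v +ⱽ w) ≡ C^ i v +ⱽ C^ i w
    C^-+ zero v w = refl
    C^-+ (suc i) v w = trans (cong (C^ i) (C-+ v w)) (C^-+ i (C v) (C w))

    C^-comp : ∀ i j v → C^ (i + j) v ≡ C^ j (C^ i v)
    C^-comp zero j v = refl
    C^-comp (suc i) j v = C^-comp i j (C v)

    C-C^ : ∀ i v → C^ i (C v) ≡ C (C^ i v)
    C-C^ zero v = refl
    C-C^ (suc i) v = C-C^ i (C v)

    C^-comm : ∀ i j v → C^ i (C^ j v) ≡ C^ j (C^ i v)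
    C^-comm i zero v = refl
    C^-comm i (suc j) v = trans (C^-comm i j (C v)) (cong (C^ j) (C-C^ i v))

    nth : ∀ {b} → ℕ → Vec A b → A
    nth _ [] = 0ᴬ
    nth zero (x ∷ _) = x
    nth (suc i) (_ ∷ xs) = nth i xs

    nth-ext : ∀ {b} (v w : Vec A b) → (∀ {i} → i < b → nth i v ≡ nth i w) → v ≡ w
    nth-ext [] [] e = refl
    nth-ext (x ∷ v) (y ∷ w) e = cong₂ _∷_ (e {0} (s≤s z≤n)) (nth-ext v w (λ {i} i< → e {suc i} (s≤s i<)))

    nth-+ : ∀ {b} (v w : Vec A b) {i} → i < b → nth i (v +ⱽ w) ≡ nth i v +ᴬ nth i w
    nth-+ (x ∷ v) (y ∷ w) {zero} i< = refl
    nth-+ (x ∷ v) (y ∷ w) {suc i} (s≤s i<) = nth-+ v w i<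

    nth-∷ʳ-< : ∀ {b} (v : Vec A b) x {i} → i < b → nth i (v ∷ʳ x) ≡ nth i v
    nth-∷ʳ-< (y ∷ v) x {zero} i< = refl
    nth-∷ʳ-< (y ∷ v) x {suc i} (s≤s i<) = nth-∷ʳ-< v x i<

    nth-∷ʳ-last : ∀ {b} (v : Vec A b) x → nth b (v ∷ʳ x) ≡ x
    nth-∷ʳ-last [] x = refl
    nth-∷ʳ-last (y ∷ v) x = nth-∷ʳ-last v x

    nth-C : ∀ v {i} → i < L → nth i (C v) ≡ nth (suc i) v
    nth-C (a ∷ a′ ∷ w) i< = nth-∷ʳ-< (a′ ∷ w) _ i<

    nth-C^ : ∀ i v → i ≤ L → nth i v ≡ nth 0 (C^ i v)
    nth-C^ zero v _ = refl
    nth-C^ (suc i) v i<L = trans (sym (nth-C v i<L)) (nth-C^ i (C v) (<⇒≤ i<L))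

    nth-C-last : ∀ v → nth L (C v) +ᴬ nth 0 v ≡ nth 0 (C v)
    nth-C-last (a ∷ a′ ∷ w) = trans (cong (_+ᴬ a) (nth-∷ʳ-last (a′ ∷ w) _))
      (trans (assoc a′ _ a) (trans (cong (a′ +ᴬ_) (inverseˡ a)) (identityʳ a′)))

    -- Coordinate `i` of `v` is coordinate 0 of `C^ i v`, so the identity only has to be checked at
    -- coordinate 0 of shifted vectors, where it is the feedback rule `nth-C-last`.
    C^-recurrence : ∀ v → C^ (suc L) v +ⱽ v ≡ C v
    C^-recurrence v = nth-ext _ _ λ {i} i< → let i≤L = ≤-pred i< in begin
      nth i (C^ (suc L) v +ⱽ v)                    ≡⟨ nth-+ (C^ (suc L) v) v i< ⟩
      nth i (C^ (suc L) v) +ᴬ nth i v              ≡⟨ cong₂ _+ᴬ_ (nth-C^ i _ i≤L) (nth-C^ i v i≤L) ⟩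
      nth 0 (C^ i (C^ (suc L) v)) +ᴬ nth 0 (C^ i v) ≡⟨ cong (λ u → nth 0 u +ᴬ nth 0 (C^ i v)) (C^-comm i (suc L) v) ⟩
      nth 0 (C^ L (C (C^ i v))) +ᴬ nth 0 (C^ i v)  ≡⟨ cong (_+ᴬ nth 0 (C^ i v)) (sym (nth-C^ L (C (C^ i v)) ≤-refl)) ⟩
      nth L (C (C^ i v)) +ᴬ nth 0 (C^ i v)         ≡⟨ nth-C-last (C^ i v) ⟩
      nth 0 (C (C^ i v))                           ≡⟨ cong (nth 0) (sym (C-C^ i v)) ⟩
      nth 0 (C^ i (C v))                           ≡⟨ sym (nth-C^ i (C v) i≤L) ⟩
      nth i (C v)                                  ∎
      where open ≡-Reasoning

    private
      0ⱽ : V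
      0ⱽ = replicate (suc L) 0ᴬ
      Vᴳ : AbelianGroup 0ℓ 0ℓ
      Vᴳ = record { isAbelianGroup = Vec-isAbelianGroup (suc L) }
      module V = AbelianGroup Vᴳ
      module VP = GroupProperties V.group

    C-0 : C 0ⱽ ≡ 0ⱽ
    C-0 = VP.∙-cancelʳ (C 0ⱽ) _ _ (trans (sym (C-+ 0ⱽ 0ⱽ)) (trans (cong C (V.identityˡ 0ⱽ)) (sym (V.identityˡ (C 0ⱽ)))))

    C^-0 : ∀ i → C^ i 0ⱽ ≡ 0ⱽ
    C^-0 zero = refl
    C^-0 (suc i) = trans (cong (C^ i) C-0) (C^-0 i)

    C-ker : ∀ {v} → C v ≡ 0ⱽ → v ≡ 0ⱽ
    C-ker {v} p = trans (sym (V.identityˡ v)) (trans (cong (_+ⱽ v) (sym (trans (cong (C^ L) p) (C^-0 L))))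
                   (trans (C^-recurrence v) p))

    -- Applying `C` to the hypothesis turns `C^ (suc L) v` into `C v`, and the recurrence leaves
    -- `v ≡ 0ⱽ`.
    C^L-fixed : ∀ {v} → C^ L v ≡ v → v ≡ 0ⱽ
    C^L-fixed {v} p = VP.∙-cancelˡ (C^ (suc L) v) _ _ (trans (C^-recurrence v)
      (trans (trans (cong C (sym p)) (sym (C-C^ L v))) (sym (V.identityʳ _))))

    C-injective : ∀ {v w} → C v ≡ C w → v ≡ w
    C-injective {v} {w} p = VP.x∙y⁻¹≈ε⇒x≈y v w (C-ker (VP.∙-cancelʳ (C w) _ _
      (trans (sym (C-+ (v +ⱽ map -ᴬ_ w) w)) (trans (cong C (trans (V.assoc v _ w) (trans (cong (v +ⱽ_) (V.inverseˡ w)) (V.identityʳ v))))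
        (trans p (sym (V.identityˡ (C w))))))))

    C^-injective : ∀ i {v w} → C^ i v ≡ C^ i w → v ≡ w
    C^-injective zero p = p
    C^-injective (suc i) p = C-injective (C^-injective i p)

    C^-fixed-multiple : ∀ l q {v} → C^ l v ≡ v → C^ (q * l) v ≡ v
    C^-fixed-multiple l zero p = refl
    C^-fixed-multiple l (suc q) {v} p = trans (C^-comp l (q * l) v) (trans (cong (C^ (q * l)) p) (C^-fixed-multiple l q p))

    C^-fixed : ∀ {l} → l ∣ L → ∀ {v} → C^ l v ≡ v → v ≡ 0ⱽ
    C^-fixed {l} (divides q e) {v} p = C^L-fixed (trans (cong (λ i → C^ i v) e) (C^-fixed-multiple l q p))

    -- Column `r` applies `C` `r` times. If `C^ a` and `C^ b` agree at `v`, cancelling the injective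
    -- `C^ a` leaves `v` fixed by `C^ (b ∸ a)`, and `b ∸ a` divides `L`.
    shiftOA : ∀ {n k} → V ↔ Fin n → (∀ {l} → 1 ≤ l → l < k → l ∣ L) → OA k (Full V)
    shiftOA {k = k} V↔ small = endomorphismOA (Vec-isAbelianGroup (suc L)) V↔ (λ r → C^ (toℕ r)) (λ r → C^-+ (toℕ r)) sep
      where
      sep′ : ∀ {a b} → a < b → b < k → ∀ {v} → C^ a v ≡ C^ b v → v ≡ 0ⱽ
      sep′ {a} {b} a<b b<k {v} e = C^-fixed (small (m<n⇒0<n∸m a<b) (≤-trans (s≤s (m∸n≤m b a)) b<k))
        (C^-injective a (trans (sym (C^-comp (b ∸ a) a v)) (trans (cong (λ i → C^ i v) (m∸n+n≡m (<⇒≤ a<b))) (sym e))))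
      sep : ∀ {r s : Fin k} → r ≢ s → ∀ {v} → C^ (toℕ r) v ≡ C^ (toℕ s) v → v ≡ 0ⱽ
      sep {r} {s} r≢s e with <-cmp (toℕ r) (toℕ s)
      ... | tri< r<s _ _ = sep′ r<s (toℕ<n s) e
      ... | tri≈ _ r≡s _ = ⊥-elim (r≢s (toℕ-injective r≡s))
      ... | tri> _ _ s<r = sep′ s<r (toℕ<n r) (sym e)

  ∣! : ∀ {l k} → 1 ≤ l → l ≤ k → l ∣ k !
  ∣! {suc l} {k} _ l≤k = ∣-trans (m∣m*n (l !)) (m≤n⇒m!∣n! l≤k)

  -- Taking `L = k !` makes every difference of two column indices divide `L`; the vectors have
  -- `L + 1` coordinates, whence the exponent `suc (k !)`. Here `d` may have small prime factors,
  -- which `coprimeOA` excludes.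
  powerOA : ∀ k d .{{_ : NonZero d}} → OA k (Full (Fin (d ^ suc (k !))))
  powerOA k d with k ! in e | 1≤n! k
  ... | suc m | _ = transport-Full (Vec↔ (suc (suc m)))
    (ShiftRegister.shiftOA (IsCommutativeRing.+-isAbelianGroup (ℤ/-isCommutativeRing d)) m (Vec↔ (suc (suc m)))
      λ {l} 1≤l l<k → subst (l ∣_) e (∣! 1≤l (<⇒≤ l<k)))

-- Wilson's product construction with weights

module WilsonConstruction where

  open OrthogonalArrays
  open import Data.Nat.Base using (ℕ; suc; _≤_; z≤n; s≤s)
  open import Data.Fin.Base using (Fin; zero; suc)
  open import Data.Fin.Properties using () renaming (_≟_ to _≟F_; suc-injective to sucF-injective)
  open import Data.Product using (Σ; _×_; _,_; proj₁; proj₂)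
  open import Data.Sum using (_⊎_; inj₁; inj₂)
  open import Data.Unit using (tt)
  open import Function.Base using (_∘_)
  open import Relation.Nullary using (yes; no)
  open import Relation.Binary.PropositionalEquality

  -- Wilson's construction: a transversal design on s + 2 groups T in which the
  -- points of the first group get weights ω and become the hole, those of the
  -- second group get weights φ ≤ 1, and all others get weight one.
  module _ {k s : ℕ} {T : Set} (O : OA (suc (suc s)) (Full T)) (φ ω : T → ℕ) (φ≤1 : ∀ t → φ t ≤ 1)
           (ingredient : ∀ x y → OA k (Holey (Fin s ⊎ Fin (φ y)) (Fin (ω x))))
           (fillT : OA k {T} _≢_) (fillφ : OA k {Σ T (Fin ∘ φ)} _≢_) where
    private
      open OA O

      Point : Set
      Point = ((Fin s × T) ⊎ Σ T (Fin ∘ φ)) ⊎ Σ T (Fin ∘ ω)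

      group : Point → Fin (suc (suc s))
      group (inj₁ (inj₁ (i , _))) = suc (suc i)
      group (inj₁ (inj₂ _)) = suc zero
      group (inj₂ _) = zero

      value : Point → T
      value (inj₁ (inj₁ (_ , t))) = t
      value (inj₁ (inj₂ (t , _))) = t
      value (inj₂ (t , _)) = t

      0≢1 : _≢_ {A = Fin (suc (suc s))} zero (suc zero)
      0≢1 ()

      -- Blocks of the transversal design are addressed by their points in the first two groups,
      -- since these carry the weights that determine the ingredient.
      block : T → T → Block
      block x y = proj₁ (find 0≢1 {x} {y} tt)

      Ingredient : T → T → Set
      Ingredient x y = (Fin s ⊎ Fin (φ y)) ⊎ Fin (ω x)

      place : ∀ x y → Ingredient x y → Point
      place x y (inj₁ (inj₁ i)) = inj₁ (inj₁ (i , entry (block x y) (suc (suc i))))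
      place x y (inj₁ (inj₂ c)) = inj₁ (inj₂ (y , c))
      place x y (inj₂ c) = inj₂ (x , c)

      place-inj : ∀ x y {u v} → place x y u ≡ place x y v → u ≡ v
      place-inj x y {inj₁ (inj₁ i)} {inj₁ (inj₁ .i)} refl = refl
      place-inj x y {inj₁ (inj₂ c)} {inj₁ (inj₂ .c)} refl = refl
      place-inj x y {inj₁ (inj₁ i)} {inj₁ (inj₂ c)} ()
      place-inj x y {inj₁ (inj₁ i)} {inj₂ c} ()
      place-inj x y {inj₁ (inj₂ c)} {inj₁ (inj₁ i)} ()
      place-inj x y {inj₁ (inj₂ c)} {inj₂ d} ()
      place-inj x y {inj₂ c} {inj₁ (inj₁ i)} ()
      place-inj x y {inj₂ c} {inj₁ (inj₂ d)} ()
      place-inj x y {inj₂ c} {inj₂ .c} refl = refl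

      InBlock : T → T → Point → Set
      InBlock x y p = entry (block x y) (group p) ≡ value p

      place-in : ∀ x y u → InBlock x y (place x y u)
      place-in x y (inj₁ (inj₁ i)) = refl
      place-in x y (inj₁ (inj₂ c)) = proj₂ (proj₂ (find 0≢1 {x} {y} tt))
      place-in x y (inj₂ c) = proj₁ (proj₂ (find 0≢1 {x} {y} tt))

      Fin≤1 : ∀ {n} → n ≤ 1 → (c d : Fin n) → c ≡ d
      Fin≤1 (s≤s z≤n) zero zero = refl

      -- This is where `φ≤1` enters: distinct points of an ingredient outside its hole never share a
      -- group, because the second group contributes at most one of them.
      place-groups : ∀ x y u v → Holey _ _ u v → group (place x y u) ≢ group (place x y v)
      place-groups x y (inj₁ (inj₁ i)) (inj₁ (inj₁ j)) e p = e (cong (inj₁) (sucF-injective (sucF-injective p)))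
      place-groups x y (inj₁ (inj₁ i)) (inj₁ (inj₂ d)) e ()
      place-groups x y (inj₁ (inj₁ i)) (inj₂ d) e ()
      place-groups x y (inj₁ (inj₂ c)) (inj₁ (inj₁ j)) e ()
      place-groups x y (inj₁ (inj₂ c)) (inj₁ (inj₂ d)) e p = e (cong inj₂ (Fin≤1 (φ≤1 y) c d))
      place-groups x y (inj₁ (inj₂ c)) (inj₂ d) e ()
      place-groups x y (inj₂ c) (inj₁ (inj₁ j)) e ()
      place-groups x y (inj₂ c) (inj₁ (inj₂ d)) e ()

      placed : ∀ x y p → InBlock x y p → Σ (Ingredient x y) λ u → place x y u ≡ p
      placed x y (inj₁ (inj₁ (i , t))) refl = inj₁ (inj₁ i) , refl
      placed x y (inj₁ (inj₂ (t , c))) e with trans (sym (proj₂ (proj₂ (find 0≢1 {x} {y} tt)))) e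
      ... | refl = inj₁ (inj₂ c) , refl
      placed x y (inj₂ (t , c)) e with trans (sym (proj₁ (proj₂ (find 0≢1 {x} {y} tt)))) e
      ... | refl = inj₂ c , refl

      holey : ∀ {x y} u v → group (place x y u) ≢ group (place x y v) → Holey _ _ u v
      holey (inj₁ u) (inj₁ v) ne p = ne (cong (group ∘ place _ _ ∘ inj₁) p)
      holey (inj₁ u) (inj₂ d) ne = tt
      holey (inj₂ c) (inj₁ v) ne = tt
      holey (inj₂ c) (inj₂ d) ne = ne refl

      Local : T × T → Point → Point → Set
      Local (x , y) = Image (place x y) (Holey _ _)

      disjoint : ∀ {i j p q} → Local i p q → Local j p q → i ≡ j
      disjoint {x , y} {x′ , y′} (u , v , e , refl , refl) (u′ , v′ , e′ , p , q) =
        cong₂ _,_ (trans (sym (place-in₀ x y)) (trans (same zero) (place-in₀ x′ y′)))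
                  (trans (sym (place-in₁ x y)) (trans (same (suc zero)) (place-in₁ x′ y′)))
        where
        place-in₀ : ∀ x y → entry (block x y) zero ≡ x
        place-in₀ x y = proj₁ (proj₂ (find 0≢1 {x} {y} tt))
        place-in₁ : ∀ x y → entry (block x y) (suc zero) ≡ y
        place-in₁ x y = proj₂ (proj₂ (find 0≢1 {x} {y} tt))
        same : ∀ j → entry (block x y) j ≡ entry (block x′ y′) j
        same = unique (place-groups x y u v e) (block x y) (block x′ y′)
          (trans (place-in x y u) (sym (subst (InBlock x′ y′) p (place-in x′ y′ u′))))
          (trans (place-in x y v) (sym (subst (InBlock x′ y′) q (place-in x′ y′ v′))))

      -- Points of different groups lie on exactly one block of the transversal design, and the
      -- ingredient placed on that block covers the pair.
      across : OA k (λ p q → group p ≢ group q)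
      across = respects
        (λ { ((x , y) , u , v , e , refl , refl) → place-groups x y u v e })
        cover
        (⋃ disjoint (λ { (x , y) → image (place x y) (place-inj x y) (ingredient x y) }))
        where
        cover : ∀ {p q} → group p ≢ group q → Σ (T × T) λ i → Local i p q
        cover {p} {q} ne =
          let β , bp , bq = find ne {value p} {value q} tt
              x = entry β zero
              y = entry β (suc zero)
              same = unique 0≢1 (block x y) β (proj₁ (proj₂ (find 0≢1 {x} {y} tt))) (proj₂ (proj₂ (find 0≢1 {x} {y} tt)))
              u , pu = placed x y p (trans (same (group p)) bp)
              v , pv = placed x y q (trans (same (group q)) bq)
          in (x , y) , u , v , holey u v (λ e → ne (trans (cong group (sym pu)) (trans e (cong group pv)))) , pu , pv

      inT : Fin s → T → Point
      inT i t = inj₁ (inj₁ (i , t))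

      inφ : Σ T (Fin ∘ φ) → Point
      inφ c = inj₁ (inj₂ c)

      Within : Point → Point → Set
      Within p q = (Σ (Fin s) λ i → Image (inT i) _≢_ p q) ⊎ Image inφ _≢_ p q

      -- Each group is filled with an idempotent array, except the hole group, whose inner pairs
      -- have to stay uncovered.
      within : OA k Within
      within = union (λ { (_ , _ , _ , _ , refl , refl) (_ , _ , _ , () , _) })
        (⋃ (λ { (_ , _ , _ , refl , refl) (_ , _ , _ , refl , refl) → refl })
           (λ i → image (inT i) (λ { refl → refl }) fillT))
        (image inφ (λ { refl → refl }) fillφ)

      Within⇒≡ : ∀ {p q} → Within p q → group p ≡ group q
      Within⇒≡ (inj₁ (_ , _ , _ , _ , refl , refl)) = refl
      Within⇒≡ (inj₂ (_ , _ , _ , refl , refl)) = refl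

      glue : ∀ {p q} → Holey _ _ p q → group p ≢ group q ⊎ Within p q
      glue {p} {q} e with group p ≟F group q
      ... | no ne = inj₁ ne
      glue {inj₁ (inj₁ (i , t))} {inj₁ (inj₁ (.i , u))} e | yes refl =
        inj₂ (inj₁ (i , t , u , (λ { refl → e refl }) , refl , refl))
      glue {inj₁ (inj₂ c)} {inj₁ (inj₂ d)} e | yes refl =
        inj₂ (inj₂ (c , d , (λ { refl → e refl }) , refl , refl))
      glue {inj₂ c} {inj₁ (inj₁ (i , t))} e | yes ()
      glue {inj₂ c} {inj₁ (inj₂ d)} e | yes ()

      unglue : ∀ {p q} → group p ≢ group q ⊎ Within p q → Holey (Fin s × T ⊎ Σ T (Fin ∘ φ)) (Σ T (Fin ∘ ω)) p q
      unglue {inj₁ p} {inj₁ q} (inj₁ ne) = λ { refl → ne refl }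
      unglue {inj₁ p} {inj₂ q} (inj₁ ne) = tt
      unglue {inj₂ p} {inj₁ q} (inj₁ ne) = tt
      unglue {inj₂ p} {inj₂ q} (inj₁ ne) = ne refl
      unglue (inj₂ (inj₁ (_ , _ , _ , ne , refl , refl))) = λ { refl → ne refl }
      unglue (inj₂ (inj₂ (_ , _ , ne , refl , refl))) = λ { refl → ne refl }

    wilson : OA k (Holey ((Fin s × T) ⊎ Σ T (Fin ∘ φ)) (Σ T (Fin ∘ ω)))
    wilson = respects unglue glue (union (λ ne w → ne (Within⇒≡ w)) across within)

-- Transversal designs and idempotent arrays of every large order

module TransversalDesigns where

  open OrthogonalArrays
  open AbelianArrays
  open WilsonConstruction
  open import Data.Nat.Base
  open import Data.Nat.Properties
  open import Data.Nat.DivMod using (_/_; _%_; m≡m%n+[m/n]*n; m%n<n; /-monoˡ-≤; m*n/n≡m)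
  open import Data.Nat.Divisibility
  open import Data.Nat.Coprimality using (Coprime; coprime?; coprime-divisor) renaming (sym to coprime-sym)
  open import Data.Nat.Solver using (module +-*-Solver)
  open import Data.Fin.Base using (Fin; zero; suc; inject≤)
  open import Data.Fin.Properties using (+↔⊎; *↔×; inject≤-injective; ¬Fin0) renaming (_≟_ to _≟F_)
  open import Data.Product using (Σ; ∃; _×_; _,_)
  open import Data.Sum using (_⊎_; inj₁; inj₂)
  open import Data.Sum.Function.Propositional using (_⊎-↔_)
  open import Data.Unit using (tt)
  open import Data.Empty using (⊥-elim)
  open import Function.Base using (_∘_)
  open import Function.Bundles using (_↔_; mk↔ₛ′)
  open import Function.Construct.Composition using (_↔-∘_)
  open import Function.Construct.Symmetry using (↔-sym)
  open import Function.Construct.Identity using (↔-id)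
  open import Relation.Nullary using (yes; no)
  open import Relation.Binary.PropositionalEquality

  TD Id : ℕ → ℕ → Set₁
  TD k n = OA k (Full (Fin n))
  Id k n = OA k {Fin n} _≢_

  -- `s` counts only the points outside the hole, so the array has `s + w` points in all.
  H : ℕ → ℕ → ℕ → Set₁
  H k s w = OA k (Holey (Fin s) (Fin w))

  TD-≤ : ∀ {k l n} → l ≤ k → TD k n → TD l n
  TD-≤ l≤k = restrict (λ r → inject≤ r l≤k) (inject≤-injective l≤k l≤k _ _)

  TD-* : ∀ {k m n} → TD k m → TD k n → TD k (m * n)
  TD-* O P = transport-Full (↔-sym *↔×) (product O P)

  empty : ∀ {k} {E : Fin 0 → Fin 0 → Set} → OA k E
  empty = respects (λ {a} → ⊥-elim (¬Fin0 a)) (λ {a} → ⊥-elim (¬Fin0 a)) diagonal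

  Id⇒TD : ∀ {k n} → Id k n → TD k n
  Id⇒TD = ≢⇒Full _≟F_

  TD⇒Id : ∀ {k n} → TD (2 + k) n → Id (1 + k) n
  TD⇒Id {n = zero} O = empty
  TD⇒Id {n = suc n} O = idempotent zero O

  Id⇒H : ∀ {k n} → Id k n → H k n 0
  Id⇒H O = respects
    (λ { (_ , _ , ne , refl , refl) → ne })
    (λ { {inj₁ a} {inj₁ b} ne → a , b , ne , refl , refl })
    (image inj₁ (λ { refl → refl }) O)

  H⇒Id : ∀ {k n} → H k n 0 → Id k n
  H⇒Id {k} {n} O = respects (λ { {a} {b} (inj₁ _ , inj₁ _ , ne , refl , refl) → ne })
    (λ {a} {b} ne → inj₁ a , inj₁ b , ne , refl , refl)
    (image f (λ { {inj₁ _} {inj₁ _} refl → refl }) O)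
    where
    f : Fin n ⊎ Fin 0 → Fin n
    f (inj₁ x) = x

  Id⇒H₁ : ∀ {k n} → Id k (1 + n) → H k n 1
  Id⇒H₁ {k} {n} O = respects into back (image f f-inj O)
    where
    f : Fin (1 + n) → Fin n ⊎ Fin 1
    f zero = inj₂ zero
    f (suc i) = inj₁ i
    f-inj : ∀ {a b} → f a ≡ f b → a ≡ b
    f-inj {zero} {zero} refl = refl
    f-inj {suc a} {suc .a} refl = refl
    into : ∀ {a b} → Image f _≢_ a b → Holey _ _ a b
    into (zero , zero , ne , refl , refl) = ne refl
    into (zero , suc b , ne , refl , refl) = tt
    into (suc a , zero , ne , refl , refl) = tt
    into (suc a , suc b , ne , refl , refl) = ne ∘ cong suc
    back : ∀ {a b} → Holey _ _ a b → Image f _≢_ a b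
    back {inj₁ a} {inj₁ b} ne = suc a , suc b , (λ { refl → ne refl }) , refl , refl
    back {inj₁ a} {inj₂ zero} _ = suc a , zero , (λ ()) , refl , refl
    back {inj₂ zero} {inj₁ b} _ = zero , suc b , (λ ()) , refl , refl
    back {inj₂ zero} {inj₂ zero} ()

  total : ∀ {τ} → (Fin τ → ℕ) → ℕ
  total {zero} f = 0
  total {suc τ} f = f zero + total (f ∘ suc)

  Σ↔total : ∀ {τ} (f : Fin τ → ℕ) → Σ (Fin τ) (Fin ∘ f) ↔ Fin (total f)
  Σ↔total {zero} f = mk↔ₛ′ (λ { (() , _) }) (λ ()) (λ ()) (λ { (() , _) })
  Σ↔total {suc τ} f = ↔-sym +↔⊎ ↔-∘ ((↔-id _ ⊎-↔ Σ↔total (f ∘ suc)) ↔-∘ split)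
    where
    split : Σ (Fin (suc τ)) (Fin ∘ f) ↔ (Fin (f zero) ⊎ Σ (Fin τ) (Fin ∘ f ∘ suc))
    split = mk↔ₛ′
      (λ { (zero , c) → inj₁ c ; (suc i , c) → inj₂ (i , c) })
      (λ { (inj₁ c) → zero , c ; (inj₂ (i , c)) → suc i , c })
      (λ { (inj₁ c) → refl ; (inj₂ (i , c)) → refl })
      (λ { (zero , c) → refl ; (suc i , c) → refl })

  -- `P` records which weights have an ingredient; its universe is arbitrary because it is used with
  -- `IsBit` as well as with predicates in `Set₁` such as `H k p`. Points beyond the first `i + j`
  -- get weight 0, hence `P 0`.
  weighting : ∀ {ℓ} (P : ℕ → Set ℓ) a b → P 0 → P a → P b → ∀ i j {τ} → i + j ≤ τ →
              Σ (Fin τ → ℕ) λ f → (∀ t → P (f t)) × total f ≡ i * a + j * b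
  weighting P a b p₀ pa pb zero zero {zero} _ = (λ _ → 0) , (λ _ → p₀) , refl
  weighting P a b p₀ pa pb zero zero {suc τ} _ =
    let f , pf , e = weighting P a b p₀ pa pb zero zero {τ} z≤n
    in (λ { zero → 0 ; (suc t) → f t }) , (λ { zero → p₀ ; (suc t) → pf t }) , e
  weighting P a b p₀ pa pb zero (suc j) {suc τ} (s≤s le) =
    let f , pf , e = weighting P a b p₀ pa pb zero j le
    in (λ { zero → b ; (suc t) → f t }) , (λ { zero → pb ; (suc t) → pf t }) , cong (b +_) e
  weighting P a b p₀ pa pb (suc i) j {suc τ} (s≤s le) =
    let f , pf , e = weighting P a b p₀ pa pb i j le
    in (λ { zero → a ; (suc t) → f t }) , (λ { zero → pa ; (suc t) → pf t }) ,
       trans (cong (a +_) e) (sym (+-assoc a (i * a) (j * b)))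

  wilsonH : ∀ {k s τ} (φ ω : Fin τ → ℕ) → (∀ t → φ t ≤ 1) → TD (2 + s) τ →
            (∀ x y → H k (s + φ y) (ω x)) → Id k τ → Id k (total φ) →
            H k (s * τ + total φ) (total ω)
  wilsonH φ ω φ≤1 O ingredient fillτ fillφ =
    transport-Holey (↔-sym +↔⊎ ↔-∘ (↔-sym *↔× ⊎-↔ Σ↔total φ)) (Σ↔total ω)
      (wilson O φ ω φ≤1 (λ x y → transport-Holey +↔⊎ (↔-id _) (ingredient x y))
        fillτ (transport-≢ (↔-sym (Σ↔total φ)) fillφ))

  data IsBit : ℕ → Set where
    bit₀ : IsBit 0
    bit₁ : IsBit 1

  bit≤1 : ∀ {n} → IsBit n → n ≤ 1
  bit≤1 bit₀ = z≤n
  bit≤1 bit₁ = ≤-refl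

  -- Weight 0 on the whole hole group removes it. The truncated second group remains, and the blocks
  -- have `s` or `s + 1` points.
  wilsonId : ∀ {k s τ r} → r ≤ τ → TD (2 + s) τ → Id k s → Id k (suc s) → Id k τ → Id k r →
             Id k (s * τ + r)
  wilsonId {k} {s} {τ} {r} r≤τ O I₀ I₁ Iτ Ir =
    let φ , bits , e = weighting IsBit 1 0 bit₀ bit₁ bit₀ r 0 (subst (_≤ τ) (sym (+-identityʳ r)) r≤τ)
        ω , zeros , e′ = weighting (_≡ 0) 0 0 refl refl refl 0 0 z≤n
        φ≡r = trans e (trans (+-identityʳ (r * 1)) (*-identityʳ r))
    in H⇒Id (subst₂ (H k) (cong (s * τ +_) φ≡r) e′
         (wilsonH φ ω (bit≤1 ∘ bits) O
           (λ x y → subst (H k (s + φ y)) (sym (zeros x)) (ing (bits y)))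
           Iτ (subst (Id k) (sym φ≡r) Ir)))
    where
    ing : ∀ {n} → IsBit n → H k (s + n) 0
    ing bit₀ = Id⇒H (subst (Id k) (sym (+-identityʳ s)) I₀)
    ing bit₁ = Id⇒H (subst (Id k) (+-comm 1 s) I₁)

  coprime-*ʳ : ∀ {a b c} → Coprime a b → Coprime a c → Coprime a (b * c)
  coprime-*ʳ p q (d∣a , d∣bc) = q (d∣a , coprime-divisor (λ (x , y) → p (∣-trans x d∣a , y)) d∣bc)

  coprime-^ʳ : ∀ {a b} n → Coprime a b → Coprime a (b ^ n)
  coprime-^ʳ zero p (_ , d∣1) = ∣1⇒≡1 d∣1
  coprime-^ʳ (suc n) p = coprime-*ʳ p (coprime-^ʳ n p)

  ∣m+n∣n⇒∣m : ∀ {d m n} → d ∣ m + n → d ∣ n → d ∣ m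
  ∣m+n∣n⇒∣m {d} {m} {n} p = ∣m+n∣m⇒∣n (subst (d ∣_) (+-comm m n) p)

  coprimePart : ℕ → ℕ → ℕ
  coprimePart n zero = 1
  coprimePart n (suc N) with coprime? (suc N) n
  ... | yes _ = suc N * coprimePart n N
  ... | no _ = coprimePart n N

  coprimePart-coprime : ∀ n N → Coprime n (coprimePart n N)
  coprimePart-coprime n zero (_ , d∣1) = ∣1⇒≡1 d∣1
  coprimePart-coprime n (suc N) with coprime? (suc N) n
  ... | yes c = coprime-*ʳ {n} {suc N} (coprime-sym c) (coprimePart-coprime n N)
  ... | no _ = coprimePart-coprime n N

  ∣coprimePart : ∀ {n N i} → 1 ≤ i → i ≤ N → Coprime i n → i ∣ coprimePart n N
  ∣coprimePart {N = zero} 1≤i i≤0 _ = ⊥-elim (<-irrefl refl (≤-trans 1≤i i≤0))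
  ∣coprimePart {n} {suc N} {i} 1≤i i≤N c with coprime? (suc N) n | m≤n⇒m<n∨m≡n i≤N
  ... | yes _ | inj₁ (s≤s i≤) = ∣-trans (∣coprimePart 1≤i i≤ c) (n∣m*n (suc N))
  ... | yes _ | inj₂ refl = m∣m*n _
  ... | no _ | inj₁ (s≤s i≤) = ∣coprimePart 1≤i i≤ c
  ... | no ¬c | inj₂ refl = ⊥-elim (¬c c)

  1≤coprimePart : ∀ n N → 1 ≤ coprimePart n N
  1≤coprimePart n zero = ≤-refl
  1≤coprimePart n (suc N) with coprime? (suc N) n
  ... | yes _ = *-mono-≤ {1} {suc N} (s≤s z≤n) (1≤coprimePart n N)
  ... | no _ = 1≤coprimePart n N

  coprimePart≤! : ∀ n N → coprimePart n N ≤ N !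
  coprimePart≤! n zero = ≤-refl
  coprimePart≤! n (suc N) with coprime? (suc N) n
  ... | yes _ = *-monoʳ-≤ (suc N) (coprimePart≤! n N)
  ... | no _ = ≤-trans (coprimePart≤! n N) (m≤m+n (N !) (N * N !))

  -- n = s T + u with s + 1 a power of (2 + k)!, T = d ^ _ * c, where c is coprime
  -- to all small numbers and d collects the small numbers coprime to n.  A common
  -- divisor of u and some small number divides n + T; it cannot meet n, hence it
  -- divides d, hence T, hence n.
  module Representation (k : ℕ) where
    Q = (2 + k) !
    M = Q ^ suc Q

    2≤Q : 2 ≤ Q
    2≤Q = *-mono-≤ {2} {2 + k} (s≤s (s≤s z≤n)) (1≤n! (1 + k))

    2≤M : 2 ≤ M
    2≤M = ≤-trans 2≤Q (m≤m*n Q (Q ^ Q) {{m^n≢0 Q Q {{>-nonZero (≤-trans (s≤s z≤n) 2≤Q)}}}})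

    -- Both block sizes are served: `s` is -1 modulo every small number, so `coprimeOA` applies to
    -- it, and `s + 1 = Q ^ (Q + 1)` with `Q = (2 + k) !` has the shape that `powerOA` yields.
    s = pred M

    M≡ : M ≡ suc s
    M≡ = sym (suc-pred M {{>-nonZero (≤-trans (s≤s z≤n) 2≤M)}})

    1≤s : 1 ≤ s
    1≤s = ≤-pred (subst (2 ≤_) M≡ 2≤M)

    small∣M : ∀ {i} → 1 ≤ i → i < 2 + k → i ∣ M
    small∣M 1≤i i< = ∣-trans (∣! 1≤i (<⇒≤ i<)) (m∣m*n (Q ^ Q))

    K = 2 + s + k
    P = K !

    module _ (n j : ℕ) where
      d = coprimePart n (1 + k)
      D = d ^ suc P
      T = D * (1 + j * P)

      1≤D : 1 ≤ D
      1≤D = >-nonZero⁻¹ D {{m^n≢0 d (suc P) {{>-nonZero (1≤coprimePart n (1 + k))}}}}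

      remainder-coprime : ∀ {u} → n ≡ s * T + u → ∀ {i} → 1 ≤ i → i < 2 + k → Coprime u i
      remainder-coprime {u} n≡ {i} 1≤i i< {g} (g∣u , g∣i) = g⊥n (∣-refl , g∣n)
        where
        g∣M : g ∣ M
        g∣M = ∣-trans g∣i (small∣M 1≤i i<)
        g∣n+T : g ∣ T + n
        g∣n+T = subst (g ∣_) eq (∣m∣n⇒∣m+n g∣u (∣m⇒∣m*n T g∣M))
          where
          eq : u + M * T ≡ T + n
          eq = trans (cong (λ z → u + z * T) M≡) (trans (+-comm u _)
            (trans (+-assoc T (s * T) u) (cong (T +_) (sym n≡))))
        1≤g : 1 ≤ g
        1≤g = n≢0⇒n>0 λ { refl → <-irrefl refl (subst (1 ≤_) (0∣⇒≡0 g∣i) 1≤i) }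
        g≤ : g ≤ 1 + k
        g≤ = ≤-trans (∣⇒≤ {{>-nonZero 1≤i}} g∣i) (≤-pred i<)
        g⊥n : Coprime g n
        -- `h` divides `T`, yet it is prime to `D`, since `n` is prime to `d`, and prime to
        -- `1 + j * P`, since `g` and with it `h` divides `P`; so `h` is 1.
        g⊥n {h} (h∣g , h∣n) = coprime-*ʳ {h} {D} {1 + j * P} h⊥D h⊥c (∣-refl , h∣T)
          where
          h∣T : h ∣ T
          h∣T = ∣m+n∣n⇒∣m (∣-trans h∣g g∣n+T) h∣n
          h⊥D : Coprime h D
          h⊥D = coprime-^ʳ {h} {d} (suc P) λ (x , y) → coprimePart-coprime n (1 + k) (∣-trans x h∣n , y)
          h⊥c : Coprime h (1 + j * P)
          h⊥c (x , y) = ∣1⇒≡1 (∣m+n∣n⇒∣m y (∣-trans (∣-trans x (∣-trans h∣g (∣! 1≤g (≤-trans g≤ (s≤s (≤-trans (m≤n+m k s) (n≤1+n _))))))) (n∣m*n j)))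
        g∣T : g ∣ T
        g∣T = ∣-trans (∣coprimePart 1≤g g≤ g⊥n) (∣-trans (m∣m*n (d ^ P)) (m∣m*n _))
        g∣n : g ∣ n
        g∣n = ∣m+n∣m⇒∣n g∣n+T g∣T

      TD-T : TD K T
      TD-T = TD-* (powerOA K d {{>-nonZero (1≤coprimePart n (1 + k))}})
        (coprimeOA (1 + j * P) K λ 1≤i i< (x , y) →
          ∣1⇒≡1 (∣m+n∣n⇒∣m x (∣-trans (∣-trans y (∣! 1≤i (<⇒≤ i<))) (n∣m*n j))))

    TD-s : TD (2 + k) s
    TD-s = coprimeOA s {{>-nonZero 1≤s}} (2 + k) λ 1≤i i< {g} (x , y) →
      ∣1⇒≡1 (∣m+n∣n⇒∣m {g} {1} {s} (subst (g ∣_) M≡ (∣-trans y (small∣M 1≤i i<))) x)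

    TD-u : ∀ u → (∀ {i} → 1 ≤ i → i < 2 + k → Coprime u i) → TD (2 + k) u
    TD-u zero _ = empty
    TD-u (suc u) c = coprimeOA (suc u) (2 + k) c

    -- With `d ≤ Q` this ensures that `n` exceeds `s * D` by at least `s` times `s * D * P`, so the
    -- quotient `j` is at least `s`; then the remainder `u < s * D * P` is at most `D * j * P ≤ T`.
    n₀ = s * Q ^ suc P + s * (s * Q ^ suc P * P)

    Id-large : ∀ n → n₀ ≤ n → Id (1 + k) n
    Id-large n n₀≤n = subst (Id (1 + k)) (sym n≡) (wilsonId u≤T
      (TD-≤ (m≤m+n (2 + s) k) (TD-T n j)) (TD⇒Id TD-s)
      (TD⇒Id (subst (TD (2 + k)) M≡ (powerOA (2 + k) Q {{>-nonZero (≤-trans (s≤s z≤n) 2≤Q)}})))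
      (TD⇒Id (TD-≤ (s≤s (s≤s (m≤n+m k s))) (TD-T n j))) (TD⇒Id (TD-u u (remainder-coprime n j n≡))))
      where
      D′ = D n 0
      D≤ : D′ ≤ Q ^ suc P
      D≤ = ^-monoˡ-≤ (suc P) (≤-trans (coprimePart≤! n (1 + k)) (m≤m+n ((1 + k) !) ((1 + k) * (1 + k) !)))
      step = s * D′ * P
      1≤sD : 1 ≤ s * D′
      1≤sD = *-mono-≤ 1≤s (1≤D n 0)
      instance
        step≢0 : NonZero step
        step≢0 = >-nonZero (*-mono-≤ 1≤sD (1≤n! K))
      n′ = n ∸ s * D′
      sD≤n : s * D′ ≤ n
      sD≤n = ≤-trans (*-monoʳ-≤ s D≤) (≤-trans (m≤m+n _ _) n₀≤n)
      j = n′ / step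
      u = n′ % step
      n≡ : n ≡ s * T n j + u
      n≡ = begin
        n                                   ≡⟨ m+[n∸m]≡n sD≤n ⟨
        s * D′ + n′                         ≡⟨ cong (s * D′ +_) (m≡m%n+[m/n]*n n′ step) ⟩
        s * D′ + (u + j * step)             ≡⟨ cong (s * D′ +_) (+-comm u _) ⟩
        s * D′ + (j * step + u)             ≡⟨ +-assoc (s * D′) (j * step) u ⟨
        s * D′ + j * step + u               ≡⟨ cong (_+ u) (solve 4 (λ a d j p → a :* d :+ j :* (a :* d :* p) := a :* (d :* (con 1 :+ j :* p))) refl s D′ j P) ⟩
        s * T n j + u                       ∎
        where open ≡-Reasoning
              open +-*-Solver
      s≤j : s ≤ j
      s≤j = subst (_≤ j) (m*n/n≡m s step) (/-monoˡ-≤ step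
        (≤-trans (≤-reflexive (sym (m+n∸m≡n (s * D′) (s * step))))
          (∸-monoˡ-≤ (s * D′) (≤-trans (+-mono-≤ (*-monoʳ-≤ s D≤) (*-monoʳ-≤ s (*-monoˡ-≤ P (*-monoʳ-≤ s D≤)))) n₀≤n))))
      u≤T : u ≤ T n j
      u≤T = begin
        u                  ≤⟨ <⇒≤ (m%n<n n′ step) ⟩
        s * D′ * P         ≡⟨ cong (_* P) (*-comm s D′) ⟩
        D′ * s * P         ≡⟨ *-assoc D′ s P ⟩
        D′ * (s * P)       ≤⟨ *-monoʳ-≤ D′ (≤-trans (*-monoˡ-≤ P s≤j) (n≤1+n (j * P))) ⟩
        T n j              ∎
        where open ≤-Reasoning

  abstract
    TD-eventually : ∀ k → ∃ λ n₀ → ∀ n → n₀ ≤ n → TD k n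
    TD-eventually k = Representation.n₀ k , λ n n₀≤n → TD-≤ (n≤1+n k) (Id⇒TD (Representation.Id-large k n n₀≤n))

    Id-eventually : ∀ k → ∃ λ n₀ → ∀ n → n₀ ≤ n → Id (1 + k) n
    Id-eventually k = Representation.n₀ k , Representation.Id-large k

-- The Hales-Jewett theorem by colour focusing

module HalesJewett where

  open AbelianArrays using (Vec↔)
  open import Data.Nat.Base
  open import Data.Nat.Properties using (1+n≰n)
  open import Data.Fin.Base using (Fin; zero; suc; funToFin; finToFun)
  open import Data.Fin.Properties using (any?; injective⇒≤; finToFun-funToFin) renaming (_≟_ to _≟F_)
  open import Data.Maybe.Base as Maybe using (Maybe; just; nothing; fromMaybe)
  open import Data.Vec.Base using (Vec; []; _∷_; _++_; map)
  open import Data.Vec.Properties using (map-++; map-∘; map-cong; map-id)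
  open import Data.Vec.Relation.Unary.Any using (Any; here; there)
  open import Data.Product using (Σ; ∃; _×_; _,_)
  open import Data.Sum using (_⊎_; inj₁; inj₂)
  open import Data.Empty using (⊥-elim)
  open import Function.Base using (_∘_)
  open import Function.Bundles using (Inverse)
  open import Relation.Nullary using (yes; no)
  open import Relation.Binary.PropositionalEquality

  Word : ℕ → ℕ → Set
  Word k N = Vec (Fin k) N

  Template : ℕ → ℕ → Set
  Template k N = Vec (Maybe (Fin k)) N

  fill : ∀ {k N} → Fin k → Template k N → Word k N
  fill x = map (fromMaybe x)

  Active : ∀ {k N} → Template k N → Set
  Active = Any (_≡ nothing)

  MonoLine : ∀ {k N r} → (Word k N → Fin r) → Set
  MonoLine {k} {N} c = Σ (Template k N) λ t → Active t × (∀ x y → c (fill x t) ≡ c (fill y t))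

  HJ : ℕ → Set
  HJ k = ∀ r → ∃ λ N → ∀ (c : Word k N → Fin r) → MonoLine c

  -- A whole colouring of the words of length `N` serves as a single colour, so that `HJ` can be
  -- applied to prefixes coloured by what they induce on suffixes.
  encode : ∀ {k N r} → (Word k N → Fin r) → Fin (r ^ (k ^ N))
  encode {N = N} g = funToFin (g ∘ Inverse.from (Vec↔ N))

  encode-injective : ∀ {k N r} {g h : Word k N → Fin r} → encode g ≡ encode h → ∀ w → g w ≡ h w
  encode-injective {N = N} {g = g} {h} e w = begin
    g w                                    ≡⟨ cong g (strictlyInverseʳ w) ⟨
    g (from (to w))                        ≡⟨ finToFun-funToFin (g ∘ from) (to w) ⟨
    finToFun (funToFin (g ∘ from)) (to w)  ≡⟨ cong (λ i → finToFun i (to w)) e ⟩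
    finToFun (funToFin (h ∘ from)) (to w)  ≡⟨ finToFun-funToFin (h ∘ from) (to w) ⟩
    h (from (to w))                        ≡⟨ cong h (strictlyInverseʳ w) ⟩
    h w                                    ∎
    where open ≡-Reasoning
          open Inverse (Vec↔ N)

  module _ {k : ℕ} where

    constant : ∀ {N} → Word k N → Template k N
    constant = map just

    fill-constant : ∀ {N} x (w : Word k N) → fill x (constant w) ≡ w
    fill-constant x w = trans (sym (map-∘ (fromMaybe x) just w)) (map-id w)

    fill-++ : ∀ {M N} x (s : Template k M) (t : Template k N) → fill x (s ++ t) ≡ fill x s ++ fill x t
    fill-++ x s t = map-++ (fromMaybe x) s t

    active-++ˡ : ∀ {M N} {s : Template k M} (t : Template k N) → Active s → Active (s ++ t)
    active-++ˡ t (here p) = here p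
    active-++ˡ t (there p) = there (active-++ˡ t p)

    active-++ʳ : ∀ {M N} (s : Template k M) {t : Template k N} → Active t → Active (s ++ t)
    active-++ʳ [] p = p
    active-++ʳ (_ ∷ s) p = there (active-++ʳ s p)

  module ColourFocusing (k : ℕ) (hj : HJ (suc k)) where

    lift : ∀ {N} → Template (suc k) N → Template (suc (suc k)) N
    lift = map (Maybe.map suc)

    fill-lift : ∀ {N} x (t : Template (suc k) N) → fill (suc x) (lift t) ≡ map suc (fill x t)
    fill-lift x t = trans (sym (map-∘ (fromMaybe (suc x)) (Maybe.map suc) t))
      (trans (map-cong (λ { (just y) → refl ; nothing → refl }) t) (map-∘ suc (fromMaybe x) t))

    active-lift : ∀ {N} {t : Template (suc k) N} → Active t → Active (lift t)
    active-lift (here refl) = here refl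
    active-lift (there p) = there (active-lift p)

    -- The spokes are lines through one common point, reached at letter `zero`, and each is
    -- monochromatic away from it. `colour zero` belongs to the focus, so injectivity also separates
    -- the focus from the spokes, and `j = r` would need `r + 1` colours.
    record Focused {N r} (j : ℕ) (c : Word (suc (suc k)) N → Fin r) : Set where
      field
        focus : Word (suc (suc k)) N
        spoke : Fin j → Template (suc (suc k)) N
        spoke-active : ∀ i → Active (spoke i)
        spoke-focus : ∀ i → fill zero (spoke i) ≡ focus
        colour : Fin (suc j) → Fin r
        colour-injective : ∀ {i i′} → colour i ≡ colour i′ → i ≡ i′
        focus-colour : c focus ≡ colour zero
        spoke-colour : ∀ i x → c (fill (suc x) (spoke i)) ≡ colour (suc i)

    open Focused

    focusing : ∀ r j → ∃ λ N → ∀ (c : Word (suc (suc k)) N → Fin r) → MonoLine c ⊎ Focused j c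
    focusing r zero = 0 , λ c → inj₂ record
      { focus = [] ; spoke = λ () ; spoke-active = λ () ; spoke-focus = λ ()
      ; colour = λ _ → c [] ; colour-injective = λ { {zero} {zero} _ → refl }
      ; focus-colour = refl ; spoke-colour = λ () }
    focusing r (suc j) with focusing r j
    ... | N , F with hj (r ^ (suc (suc k) ^ N))
    ... | M , G = M + N , step
      where
      step : ∀ (c : Word (suc (suc k)) (M + N) → Fin r) → MonoLine c ⊎ Focused (suc j) c
      -- The prefix is coloured by the colouring that it induces on suffixes; on the line `l`,
      -- restricted to nonzero letters, this is constant.
      step c with G (λ u → encode (λ w → c (map suc u ++ w)))
      ... | l , l-active , l-mono = base (F c′)
        where
        c′ : Word (suc (suc k)) N → Fin r
        c′ w = c (map suc (fill zero l) ++ w)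
        l-colour : ∀ x (t : Word (suc (suc k)) N) → c (fill (suc x) (lift l) ++ t) ≡ c′ t
        l-colour x t = trans (cong (λ u → c (u ++ t)) (fill-lift x l)) (encode-injective (l-mono x zero) t)
        base : MonoLine c′ ⊎ Focused j c′ → MonoLine c ⊎ Focused (suc j) c
        base (inj₁ (t , t-active , t-mono)) = inj₁ (constant (map suc (fill zero l)) ++ t , active-++ʳ _ t-active ,
          λ x y → trans (cong c (eq x)) (trans (t-mono x y) (sym (cong c (eq y)))))
          where
          eq : ∀ x → fill x (constant (map suc (fill zero l)) ++ t) ≡ map suc (fill zero l) ++ fill x t
          eq x = trans (fill-++ x _ t) (cong (_++ fill x t) (fill-constant x _))
        -- Moving along `l` in the prefix extends each old spoke, and moving along `l` with the
        -- suffix held at the old focus gives one more. If the new focus has the colour of a spoke,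
        -- that spoke is a monochromatic line; otherwise `suc j` spokes are in focus.
        base (inj₂ Φ) = result (any? (λ i → c focus′ ≟F colour Φ i))
          where
          focus′ : Word (suc (suc k)) (M + N)
          focus′ = fill zero (lift l) ++ focus Φ
          spoke′ : Fin (suc j) → Template (suc (suc k)) (M + N)
          spoke′ zero = lift l ++ constant (focus Φ)
          spoke′ (suc i) = lift l ++ spoke Φ i
          spoke′-active : ∀ i → Active (spoke′ i)
          spoke′-active zero = active-++ˡ _ (active-lift l-active)
          spoke′-active (suc i) = active-++ˡ _ (active-lift l-active)
          spoke′-focus : ∀ i → fill zero (spoke′ i) ≡ focus′
          spoke′-focus zero = trans (fill-++ zero (lift l) _) (cong (fill zero (lift l) ++_) (fill-constant zero (focus Φ)))
          spoke′-focus (suc i) = trans (fill-++ zero (lift l) _) (cong (fill zero (lift l) ++_) (spoke-focus Φ i))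
          spoke′-colour : ∀ i x → c (fill (suc x) (spoke′ i)) ≡ colour Φ i
          spoke′-colour zero x = trans (cong c (trans (fill-++ (suc x) (lift l) _) (cong (fill (suc x) (lift l) ++_) (fill-constant (suc x) (focus Φ)))))
            (trans (l-colour x (focus Φ)) (focus-colour Φ))
          spoke′-colour (suc i) x = trans (cong c (fill-++ (suc x) (lift l) _)) (trans (l-colour x _) (spoke-colour Φ i x))
          result : _ → MonoLine c ⊎ Focused (suc j) c
          result (yes (i , p)) = inj₁ (spoke′ i , spoke′-active i , λ x y → trans (all x) (sym (all y)))
            where
            all : ∀ x → c (fill x (spoke′ i)) ≡ colour Φ i
            all zero = trans (cong c (spoke′-focus i)) p
            all (suc x) = spoke′-colour i x
          result (no ¬p) = inj₂ record
            { focus = focus′ ; spoke = spoke′ ; spoke-active = spoke′-active ; spoke-focus = spoke′-focus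
            ; colour = λ { zero → c focus′ ; (suc i) → colour Φ i }
            ; colour-injective = λ { {zero} {zero} _ → refl
                                   ; {zero} {suc i} e → ⊥-elim (¬p (i , e))
                                   ; {suc i} {zero} e → ⊥-elim (¬p (i , sym e))
                                   ; {suc i} {suc i′} e → cong suc (colour-injective Φ e) }
            ; focus-colour = refl
            ; spoke-colour = spoke′-colour }

    HJ-suc : HJ (suc (suc k))
    HJ-suc r with focusing r r
    ... | N , F = N , λ c → finish (F c)
      where
      finish : ∀ {c : Word (suc (suc k)) N → Fin r} → MonoLine c ⊎ Focused r c → MonoLine c
      finish (inj₁ line) = line
      finish (inj₂ Φ) = ⊥-elim (1+n≰n (injective⇒≤ (colour-injective Φ)))

  abstract
    hales-jewett : ∀ k → HJ k
    hales-jewett zero r = 1 , λ c → nothing ∷ [] , here refl , λ ()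
    hales-jewett (suc zero) r = 1 , λ c → nothing ∷ [] , here refl , λ { zero zero → refl }
    hales-jewett (suc (suc k)) = ColourFocusing.HJ-suc k (hales-jewett (suc k))

-- Brauer's theorem for cosets and the choice of elements with prescribed differences

module CosetFields where

  open OrthogonalArrays using (finite-≟)
  open AbelianArrays using (Vec↔)
  open HalesJewett
  open import Data.Nat.Base as ℕ using (ℕ; zero; suc; _≤_; _<_; z≤n; s≤s; _⊔_)
  import Data.Nat.Properties as ℕₚ
  open import Data.Fin.Base using (Fin; zero; suc; toℕ; fromℕ<; splitAt; _↑ˡ_; _↑ʳ_; remQuot; combine)
  open import Data.Fin.Properties using (any?; splitAt-↑ˡ; splitAt-↑ʳ; remQuot-combine; toℕ-fromℕ<) renaming (_≟_ to _≟F_)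
  open OrthogonalArrays using (injective⇒surjective)
  open import Data.Vec.Base using ([]; _∷_)
  open import Data.Vec.Relation.Unary.Any using (here; there)
  open import Data.Maybe.Base using (just; nothing)
  open import Data.Product using (Σ; ∃; _×_; _,_; proj₁; proj₂)
  open import Data.Sum using ([_,_]′)
  open import Data.Empty using (⊥; ⊥-elim)
  open import Algebra.Bundles using (CommutativeRing)
  open import Algebra.Structures using (IsCommutativeRing)
  import Algebra.Properties.Ring as RingProperties
  import Algebra.Solver.Ring.NaturalCoefficients.Default as Solver
  open import Level using (0ℓ)
  open import Function.Base using (_∘_; const)
  open import Function.Bundles using (_↔_; Inverse)
  open import Relation.Nullary using (Dec; yes; no)
  open import Relation.Binary.PropositionalEquality hiding ([_])

  -- A finite field whose multiplicative group is the disjoint union of the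
  -- cosets rep j · H, where H = { el i | i < f }.
  record CosetField (e : ℕ) : Set₁ where
    infixl 6 _+_
    infixl 7 _*_
    field
      A : Set
      _+_ _*_ : A → A → A
      -_ : A → A
      0# 1# : A
      isCommutativeRing : IsCommutativeRing _≡_ _+_ _*_ -_ 0# 1#
      1≢0 : 1# ≢ 0#
      order : ℕ
      finite : A ↔ Fin order
      inverse : ∀ {a} → a ≢ 0# → Σ A λ b → a * b ≡ 1#
      f : ℕ
      rep : Fin e → A
      el : Fin f → A
      decompose : ∀ {a} → a ≢ 0# → Σ (Fin e) λ j → Σ (Fin f) λ i → a ≡ rep j * el i
      decompose-unique : ∀ {j j′ i i′} → rep j * el i ≡ rep j′ * el i′ → j ≡ j′ × i ≡ i′
      rep≢0 : ∀ j → rep j ≢ 0#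
      el≢0 : ∀ i → el i ≢ 0#
      el-* : ∀ i i′ → Σ (Fin f) λ l → el l ≡ el i * el i′
      el-inverse : ∀ i → Σ (Fin f) λ l → el i * el l ≡ 1#

    commutativeRing : CommutativeRing 0ℓ 0ℓ
    commutativeRing = record { isCommutativeRing = isCommutativeRing }

    open IsCommutativeRing isCommutativeRing public
      using (+-assoc; +-comm; +-identityˡ; +-identityʳ; *-assoc; *-comm; *-identityˡ; *-identityʳ; zeroʳ; zeroˡ; -‿inverseʳ; -‿inverseˡ)
    open RingProperties (CommutativeRing.ring commutativeRing) public using (+-cancelˡ)
    open Solver (CommutativeRing.commutativeSemiring commutativeRing) public using (solve; _:=_; _:+_; _:*_; con)

    _≟_ : (a b : A) → Dec (a ≡ b)
    _≟_ = finite-≟ finite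

    *-cancelˡ : ∀ {a} → a ≢ 0# → ∀ {b c} → a * b ≡ a * c → b ≡ c
    *-cancelˡ {a} a≢0 {b} {c} p = let a⁻¹ , inv = inverse a≢0 in begin
      b               ≡⟨ sym (*-identityˡ b) ⟩
      1# * b          ≡⟨ cong (_* b) (sym inv) ⟩
      a * a⁻¹ * b     ≡⟨ solve 3 (λ x y z → x :* y :* z := y :* (x :* z)) refl a a⁻¹ b ⟩
      a⁻¹ * (a * b)   ≡⟨ cong (a⁻¹ *_) p ⟩
      a⁻¹ * (a * c)   ≡⟨ solve 3 (λ x y z → y :* (x :* z) := x :* y :* z) refl a a⁻¹ c ⟩
      a * a⁻¹ * c     ≡⟨ cong (_* c) inv ⟩
      1# * c          ≡⟨ *-identityˡ c ⟩
      c               ∎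
      where open ≡-Reasoning

    *-≢0 : ∀ {a b} → a ≢ 0# → b ≢ 0# → a * b ≢ 0#
    *-≢0 {a} a≢0 b≢0 p = b≢0 (*-cancelˡ a≢0 (trans p (sym (zeroʳ a))))

    InH : A → Set
    InH a = Σ (Fin f) λ i → el i ≡ a

    class : A → Fin (suc e)
    class a with a ≟ 0#
    ... | yes _ = zero
    ... | no a≢0 = suc (proj₁ (decompose a≢0))

    class≡0 : ∀ {a} → class a ≡ zero → a ≡ 0#
    class≡0 {a} p with a ≟ 0#
    ... | yes a≡0 = a≡0
    class≡0 {a} () | no _

    class-0 : class 0# ≡ zero
    class-0 with 0# ≟ 0#
    ... | yes _ = refl
    ... | no ¬p = ⊥-elim (¬p refl)

    same-class : ∀ {a d} → d ≢ 0# → class a ≡ class d → Σ A λ h → InH h × a ≡ d * h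
    same-class {a} {d} d≢0 p with a ≟ 0# | d ≟ 0#
    ... | _ | yes d≡0 = ⊥-elim (d≢0 d≡0)
    same-class {a} {d} d≢0 () | yes _ | no _
    ... | no a≢0 | no d≢0′ with decompose a≢0 | decompose d≢0′
    same-class {a} {d} d≢0 refl | no a≢0 | no _ | j , i , refl | .j , i′ , refl =
      let l , inv = el-inverse i′
          m , prod = el-* l i
      in el m , (m , refl) , (begin
        rep j * el i                     ≡⟨ cong (rep j *_) (sym (*-identityˡ (el i))) ⟩
        rep j * (1# * el i)              ≡⟨ cong (λ z → rep j * (z * el i)) (sym inv) ⟩
        rep j * (el i′ * el l * el i)    ≡⟨ solve 4 (λ r x y z → r :* (x :* y :* z) := r :* x :* (y :* z)) refl (rep j) (el i′) (el l) (el i) ⟩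
        rep j * el i′ * (el l * el i)    ≡⟨ cong (rep j * el i′ *_) (sym prod) ⟩
        rep j * el i′ * el m             ∎)
      where open ≡-Reasoning

    nat : ℕ → A
    nat zero = 0#
    nat (suc n) = 1# + nat n

  CharacteristicAbove : ∀ {e} → ℕ → CosetField e → Set
  CharacteristicAbove N F = ∀ {d} → 1 ≤ d → d ≤ N → nat d ≢ 0#
    where open CosetField F

  CharacteristicAbove-≤ : ∀ {e M N} {F : CosetField e} → M ≤ N → CharacteristicAbove N F → CharacteristicAbove M F
  CharacteristicAbove-≤ M≤N char 1≤d d≤M = char 1≤d (ℕₚ.≤-trans d≤M M≤N)

  module Evaluation {e L} (F : CosetField e) (z : Fin L → CosetField.A F) where
    open CosetField F

    eval : ∀ {N} → Word L N → A
    eval [] = 0#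
    eval (x ∷ w) = z x + eval w

    base : ∀ {N} → Template L N → A
    base [] = 0#
    base (just x ∷ t) = z x + base t
    base (nothing ∷ t) = base t

    blanks : ∀ {N} → Template L N → ℕ
    blanks [] = 0
    blanks (just x ∷ t) = blanks t
    blanks (nothing ∷ t) = suc (blanks t)

    blanks≥1 : ∀ {N} {t : Template L N} → Active t → 1 ≤ blanks t
    blanks≥1 (here refl) = s≤s z≤n
    blanks≥1 {t = just _ ∷ _} (there p) = blanks≥1 p
    blanks≥1 {t = nothing ∷ _} (there p) = s≤s z≤n

    blanks≤ : ∀ {N} (t : Template L N) → blanks t ≤ N
    blanks≤ [] = z≤n
    blanks≤ (just _ ∷ t) = ℕₚ.m≤n⇒m≤1+n (blanks≤ t)
    blanks≤ (nothing ∷ t) = s≤s (blanks≤ t)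

    -- Summing letters turns a combinatorial line into a homothetic copy of the letter values, as in
    -- the proof of Gallai's theorem. For an active template the ratio is a number between 1 and the
    -- word length, so large characteristic makes it invertible.
    eval-fill : ∀ {N} x (t : Template L N) → eval (fill x t) ≡ base t + nat (blanks t) * z x
    eval-fill x [] = trans (sym (+-identityʳ 0#)) (cong (0# +_) (sym (zeroˡ (z x))))
    eval-fill x (just y ∷ t) = trans (cong (z y +_) (eval-fill x t)) (sym (+-assoc _ _ _))
    eval-fill x (nothing ∷ t) = trans (cong (z x +_) (eval-fill x t))
      (solve 3 (λ z b n → z :+ (b :+ n :* z) := b :+ (con 1 :+ n) :* z) refl (z x) (base t) (nat (blanks t)))

  -- Brauer's theorem for the partition into cosets of H, by induction on the
  -- number of colours still available on the test set T.
  module Brauer (e k : ℕ) where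

    -- The colour is that of `d` itself, which is Brauer's strengthening of van der Waerden; it
    -- allows division by `d` to land in `H`.
    Solution : (F : CosetField e) → (Fin k → CosetField.A F) → Set
    Solution F Y = Σ A λ a → Σ A λ d → d ≢ 0# × (∀ i → class (a + d * Y i) ≡ class d)
      where open CosetField F

    -- `m` counts the cosets that the dilated test set `u * T` misses; `avoid zero` is the class of
    -- 0, listed so that injectivity keeps the others nonzero. `T` is chosen before `u`, because the
    -- induction dilates by ratios of lines that are not known in advance.
    Avoiding : ℕ → Set₁
    Avoiding m = Σ ℕ λ M → Σ ℕ λ N → ∀ (F : CosetField e) → CharacteristicAbove N F →
      let open CosetField F in
      ∀ (Y : Fin k → A) → Σ (Fin M → A) λ T → ∀ u → u ≢ 0# →
      ∀ (avoid : Fin (suc m) → Fin (suc e)) → (∀ {i j} → avoid i ≡ avoid j → i ≡ j) → avoid zero ≡ zero →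
      (∀ i l → class (u * T i) ≢ avoid (suc l)) → Solution F Y

    -- With all `e` cosets excluded `avoid` runs through every class, and the nonzero element
    -- `u * 1#` has nowhere to lie.
    avoiding-all : Avoiding e
    avoiding-all = 1 , 0 , λ F _ Y → let open CosetField F in
      const 1# , λ u u≢0 avoid inj z p →
        let l , eq = injective⇒surjective {f = avoid} inj (class u) in
        ⊥-elim (absurd F u u≢0 avoid z p l eq)
      where
      absurd : ∀ F → let open CosetField F in ∀ u → u ≢ 0# → (avoid : Fin (suc e) → Fin (suc e)) → avoid zero ≡ zero →
               (∀ (i : Fin 1) l → class (u * 1#) ≢ avoid (suc l)) → ∀ l → avoid l ≡ class u → ⊥
      absurd F u u≢0 avoid z p zero eq = u≢0 (CosetField.class≡0 F (trans (sym eq) z))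
      absurd F u u≢0 avoid z p (suc l) eq = p zero l (trans (cong (CosetField.class F) (CosetField.*-identityʳ F u)) (sym eq))

    step : ∀ {m} → Avoiding (suc m) → Avoiding m
    step {m} (M′ , N′ , IH) = M , N′ ⊔ Nd , main
      where
      -- The letters stand for 0, for 1 and for the products `T′ t * Y i`; the first two keep a
      -- monochromatic line from having the colour of 0.
      L = 2 ℕ.+ M′ ℕ.* k
      Nd = proj₁ (hales-jewett L (suc e))
      words = L ℕ.^ Nd
      -- The test set contains all values of words, so that the colour of a line is not among the
      -- avoided classes, and all `nat n * T′ t` with `n ≤ Nd`, so that `T′` dilated by the ratio of
      -- a line stays inside it.
      M = words ℕ.+ suc Nd ℕ.* M′
      main : ∀ (F : CosetField e) → CharacteristicAbove (N′ ⊔ Nd) F → let open CosetField F in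
        ∀ (Y : Fin k → A) → Σ (Fin M → A) λ T → ∀ u → u ≢ 0# →
        ∀ (avoid : Fin (suc m) → Fin (suc e)) → (∀ {i j} → avoid i ≡ avoid j → i ≡ j) → avoid zero ≡ zero →
        (∀ i l → class (u * T i) ≢ avoid (suc l)) → Solution F Y
      main F char Y = T , conclude
        where
        open CosetField F
        T′ = proj₁ (IH F (CharacteristicAbove-≤ {F = F} (ℕₚ.m≤m⊔n N′ Nd) char) Y)
        continue = proj₂ (IH F (CharacteristicAbove-≤ {F = F} (ℕₚ.m≤m⊔n N′ Nd) char) Y)
        z : Fin L → A
        z zero = 0#
        z (suc zero) = 1#
        z (suc (suc c)) = T′ (proj₁ (remQuot {M′} k c)) * Y (proj₂ (remQuot {M′} k c))
        open Evaluation F z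
        Tʷ : Fin words → A
        Tʷ i = eval (Inverse.from (Vec↔ Nd) i)
        Tᵈ : Fin (suc Nd ℕ.* M′) → A
        Tᵈ i = nat (toℕ (proj₁ (remQuot {suc Nd} M′ i))) * T′ (proj₂ (remQuot {suc Nd} M′ i))
        T : Fin M → A
        T i = [ Tʷ , Tᵈ ]′ (splitAt words i)
        T-word : ∀ w → T (Inverse.to (Vec↔ Nd) w ↑ˡ (suc Nd ℕ.* M′)) ≡ eval w
        T-word w = trans (cong [ Tʷ , Tᵈ ]′ (splitAt-↑ˡ words (Inverse.to (Vec↔ Nd) w) (suc Nd ℕ.* M′)))
          (cong eval (Inverse.strictlyInverseʳ (Vec↔ Nd) w))
        T-multiple : ∀ n (n≤ : n ≤ Nd) t → T (words ↑ʳ combine (fromℕ< (s≤s n≤)) t) ≡ nat n * T′ t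
        T-multiple n n≤ t = trans (cong [ Tʷ , Tᵈ ]′ (splitAt-↑ʳ words (suc Nd ℕ.* M′) _))
          (trans (cong (λ rq → nat (toℕ (proj₁ rq)) * T′ (proj₂ rq)) (remQuot-combine (fromℕ< (s≤s n≤)) t))
            (cong (λ n → nat n * T′ t) (toℕ-fromℕ< (s≤s n≤))))
        conclude : ∀ u → u ≢ 0# →
          ∀ (avoid : Fin (suc m) → Fin (suc e)) → (∀ {i j} → avoid i ≡ avoid j → i ≡ j) → avoid zero ≡ zero →
          (∀ i l → class (u * T i) ≢ avoid (suc l)) → Solution F Y
        conclude u u≢0 avoid inj avoid-0 avoids = finish (proj₂ (hales-jewett L (suc e)) (λ w → class (u * eval w)))
          where
          module Line (t : Template L Nd) (active : Active t)
                      (mono : ∀ x y → class (u * eval (fill x t)) ≡ class (u * eval (fill y t))) where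
            n = blanks t
            γ = class (u * eval (fill zero t))
            n≢0 : nat n ≢ 0#
            n≢0 = char (blanks≥1 active) (ℕₚ.≤-trans (blanks≤ t) (ℕₚ.m≤n⊔m N′ Nd))
            γ≢0 : γ ≢ zero
            γ≢0 p = n≢0 (+-cancelˡ (base t) _ _ (begin
              base t + nat n           ≡⟨ cong (base t +_) (sym (*-identityʳ (nat n))) ⟩
              base t + nat n * 1#      ≡⟨ sym (eval-fill (suc zero) t) ⟩
              eval (fill (suc zero) t) ≡⟨ vanish (trans (mono (suc zero) zero) p) ⟩
              0#                       ≡⟨ sym (vanish p) ⟩
              eval (fill zero t)       ≡⟨ eval-fill zero t ⟩
              base t + nat n * 0#      ≡⟨ cong (base t +_) (zeroʳ (nat n)) ⟩
              base t + 0#              ∎))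
              where
              open ≡-Reasoning
              vanish : ∀ {x} → class (u * eval (fill x t)) ≡ zero → eval (fill x t) ≡ 0#
              vanish q = *-cancelˡ u≢0 (trans (class≡0 q) (sym (zeroʳ u)))
            -- If some `u * (nat n * T′ t′)` has the colour `γ` of the line, it serves as `d`,
            -- because every `a + d * Y i` is a value on the line. Otherwise `γ` is one more class,
            -- missed by the dilate of `T′` by `u * nat n`, and the induction hypothesis takes over.
            decide : Dec (∃ λ i → class (u * (nat n * T′ i)) ≡ γ) → Solution F Y
            decide (yes (t′ , p)) = u * base t , u * (nat n * T′ t′) ,
              (λ q → γ≢0 (trans (sym p) (trans (cong class q) class-0))) ,
              λ i → let c = combine t′ i in trans (cong class (begin
                u * base t + u * (nat n * T′ t′) * Y i
                  ≡⟨ solve 5 (λ u b n t y → u :* b :+ u :* (n :* t) :* y := u :* (b :+ n :* (t :* y))) refl u (base t) (nat n) (T′ t′) (Y i) ⟩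
                u * (base t + nat n * (T′ t′ * Y i))
                  ≡⟨ cong (λ rq → u * (base t + nat n * (T′ (proj₁ rq) * Y (proj₂ rq)))) (sym (remQuot-combine t′ i)) ⟩
                u * (base t + nat n * z (suc (suc c)))
                  ≡⟨ cong (u *_) (sym (eval-fill (suc (suc c)) t)) ⟩
                u * eval (fill (suc (suc c)) t) ∎)) (trans (mono (suc (suc c)) zero) (sym p))
              where open ≡-Reasoning
            decide (no ¬p) = continue (u * nat n) (*-≢0 u≢0 n≢0) avoid′ inj′ refl avoids′
              where
              avoid′ : Fin (suc (suc m)) → Fin (suc e)
              avoid′ zero = zero
              avoid′ (suc zero) = γ
              avoid′ (suc (suc l)) = avoid (suc l)
              γ-avoids : ∀ l → γ ≢ avoid (suc l)
              γ-avoids l q = avoids (Inverse.to (Vec↔ Nd) (fill zero t) ↑ˡ (suc Nd ℕ.* M′)) l (trans (cong (λ x → class (u * x)) (T-word (fill zero t))) q)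
              suc≢0 : ∀ l → avoid (suc l) ≢ zero
              suc≢0 l q with inj (trans q (sym avoid-0))
              ... | ()
              inj′ : ∀ {i j} → avoid′ i ≡ avoid′ j → i ≡ j
              inj′ {zero} {zero} q = refl
              inj′ {zero} {suc zero} q = ⊥-elim (γ≢0 (sym q))
              inj′ {zero} {suc (suc l)} q = ⊥-elim (suc≢0 l (sym q))
              inj′ {suc zero} {zero} q = ⊥-elim (γ≢0 q)
              inj′ {suc zero} {suc zero} q = refl
              inj′ {suc zero} {suc (suc l)} q = ⊥-elim (γ-avoids l q)
              inj′ {suc (suc l)} {zero} q = ⊥-elim (suc≢0 l q)
              inj′ {suc (suc l)} {suc zero} q = ⊥-elim (γ-avoids l (sym q))
              inj′ {suc (suc l)} {suc (suc l′)} q = cong suc (inj q)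
              avoids′ : ∀ i l → class (u * nat n * T′ i) ≢ avoid′ (suc l)
              avoids′ i zero q = ¬p (i , trans (cong class (sym (*-assoc u (nat n) (T′ i)))) q)
              avoids′ i (suc l) q = avoids (words ↑ʳ combine (fromℕ< (s≤s (blanks≤ t))) i) l
                (trans (cong (λ x → class (u * x)) (T-multiple n (blanks≤ t) i))
                  (trans (cong class (sym (*-assoc u (nat n) (T′ i)))) q))
          finish : MonoLine (λ w → class (u * eval w)) → Solution F Y
          finish (t , active , mono) = Line.decide t active mono (any? λ i → class (u * (nat (blanks t) * T′ i)) ≟F class (u * eval (fill zero t)))


    avoiding : ∀ m j → m ℕ.+ j ≡ e → Avoiding m
    avoiding m zero p = subst Avoiding (trans (sym p) (ℕₚ.+-identityʳ m)) avoiding-all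
    avoiding m (suc j) p = step (avoiding (suc m) j (trans (sym (ℕₚ.+-suc m j)) p))

    abstract
      -- Start with `u = 1#` and no coset avoided, then divide the solution by `d`: the class of `d`
      -- becomes `H`.
      translate-into-H : Σ ℕ λ N → ∀ (F : CosetField e) → CharacteristicAbove N F → let open CosetField F in
        ∀ (Y : Fin k → A) → Σ A λ h → ∀ i → InH (h + Y i)
      translate-into-H = let M , N , solve-all = avoiding 0 e refl in N , λ F char Y →
        let open CosetField F
            a , d , d≢0 , same = proj₂ (solve-all F char Y) 1# 1≢0 (λ _ → zero)
              (λ { {zero} {zero} _ → refl }) refl (λ _ ())
            d⁻¹ , inv = inverse d≢0
        in d⁻¹ * a , λ i → let h , h∈H , eq = same-class d≢0 (same i) in
          subst InH (*-cancelˡ d≢0 (trans (sym eq) (trans (cong (_+ d * Y i) (trans (sym (*-identityˡ a)) (cong (_* a) (sym inv))))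
            (solve 4 (λ d r a y → d :* r :* a :+ d :* y := d :* (r :* a :+ y)) refl d d⁻¹ a (Y i))))) h∈H

  module _ {e : ℕ} (F : CosetField e) where
    open CosetField F

    -- The coset of `y r - y s` is governed by the smaller index alone. So the values can be found
    -- from the last index to the first, each by a single translation into `H`.
    Caterpillar : ∀ {k} → (Fin k → A) → (Fin k → A) → Set
    Caterpillar {k} μ y = ∀ {r s : Fin k} → toℕ r < toℕ s → Σ (Fin f) λ i → y r ≡ y s + μ r * el i

  module _ {e : ℕ} (F : CosetField e) where
    open CosetField F

    -- The new value is `μ zero * h`, where `h` translates all the quotients `- y s / μ zero` into
    -- `H`; multiplying back by `μ zero` gives the required differences.
    extend : ∀ {k} {μ : Fin (suc k) → A} → μ zero ≢ 0# → (y : Fin k → A) → Caterpillar F (μ ∘ suc) y →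
             (∀ (Y : Fin k → A) → Σ A λ h → ∀ i → InH (h + Y i)) → Σ (Fin (suc k) → A) (Caterpillar F μ)
    extend {k} {μ} μ≢0 y y-ok translate = y′ , y′-ok
      where
      open ≡-Reasoning
      m = proj₁ (inverse μ≢0)
      translation = translate (λ i → m * - y i)
      h = proj₁ translation
      y′ : Fin (suc k) → A
      y′ zero = μ zero * h
      y′ (suc r) = y r
      y′-ok : Caterpillar F μ y′
      y′-ok {zero} {suc s} _ = proj₁ (proj₂ translation s) , (begin
        μ zero * h                                    ≡⟨ sym (+-identityˡ _) ⟩
        0# + μ zero * h                               ≡⟨ cong (_+ μ zero * h) (sym (-‿inverseʳ (y s))) ⟩
        y s + - y s + μ zero * h                      ≡⟨ cong (λ x → y s + x + μ zero * h) (sym (*-identityˡ (- y s))) ⟩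
        y s + 1# * - y s + μ zero * h                 ≡⟨ cong (λ x → y s + x * - y s + μ zero * h) (sym (proj₂ (inverse μ≢0))) ⟩
        y s + μ zero * m * - y s + μ zero * h         ≡⟨ solve 5 (λ y μ m n h → y :+ μ :* m :* n :+ μ :* h := y :+ μ :* (h :+ m :* n)) refl (y s) (μ zero) m (- y s) h ⟩
        y s + μ zero * (h + m * - y s)                ≡⟨ cong (λ x → y s + μ zero * x) (sym (proj₂ (proj₂ translation s))) ⟩
        y s + μ zero * el (proj₁ (proj₂ translation s)) ∎)
      y′-ok {suc r} {suc s} (s≤s r<s) = y-ok r<s

  abstract
    caterpillar : ∀ e k → Σ ℕ λ N → ∀ (F : CosetField e) → CharacteristicAbove N F → let open CosetField F in
      ∀ (μ : Fin k → A) → (∀ r → μ r ≢ 0#) → Σ (Fin k → A) (Caterpillar F μ)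
    caterpillar e zero = 0 , λ F _ μ _ → (λ ()) , λ { {()} }
    caterpillar e (suc k) =
      let N₁ , build = caterpillar e k
          N₂ , translate = Brauer.translate-into-H e k
      in N₁ ⊔ N₂ , λ F char μ μ≢0 →
        let y , y-ok = build F (CharacteristicAbove-≤ {F = F} (ℕₚ.m≤m⊔n N₁ N₂) char) (μ ∘ suc) (μ≢0 ∘ suc)
        in extend F (μ≢0 zero) y y-ok (translate F (CharacteristicAbove-≤ {F = F} (ℕₚ.m≤n⊔m N₁ N₂) char))

-- Base columns with blanks and their development

module DifferenceMatrices where

  open OrthogonalArrays
  open CosetFields
  open import Data.Nat.Base as ℕ using (ℕ; _<_)
  import Data.Nat.Properties as ℕₚ
  open import Data.Fin.Base using (Fin; toℕ; opposite)
  open import Data.Fin.Properties using (toℕ-injective; toℕ<n; opposite-prop; opposite-involutive) renaming (_≟_ to _≟F_)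
  open import Data.Maybe.Base using (Maybe; just; nothing)
  open import Data.Product using (Σ; ∃; _×_; _,_; proj₁; proj₂)
  open import Data.Sum using (_⊎_; inj₁; inj₂)
  open import Data.Sum.Properties using (inj₁-injective; inj₂-injective)
  open import Data.Unit using (tt)
  open import Data.Empty using (⊥; ⊥-elim)
  open import Function.Base using (_∘_)
  open import Function.Bundles using (_↔_; Inverse)
  open import Relation.Nullary using (yes; no)
  open import Relation.Binary.Definitions using (tri<; tri≈; tri>)
  open import Relation.Binary.PropositionalEquality

  -- Symmetry of `E` reduces everything to `r < s`, the order in which the differences of base
  -- columns are prescribed.
  fromOrdered : ∀ {k} {A : Set} {E : A → A → Set} (Block : Set) (entry : Block → Fin k → A) →
    (∀ {a b} → E a b → E b a) →
    (∀ β {r s} → toℕ r < toℕ s → E (entry β r) (entry β s)) →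
    (∀ {r s} → toℕ r < toℕ s → ∀ {a b} → E a b → Σ Block λ β → entry β r ≡ a × entry β s ≡ b) →
    (∀ {r s} → toℕ r < toℕ s → ∀ β β′ → entry β r ≡ entry β′ r → entry β s ≡ entry β′ s → β ≡ β′) →
    OA k E
  fromOrdered {k} {A} {E} Block entry E-sym sound find unique = record
    { Block = Block ; entry = entry ; sound = sound′ ; find = find′ ; unique = unique′ }
    where
    sound′ : ∀ β {r s} → r ≢ s → E (entry β r) (entry β s)
    sound′ β {r} {s} r≢s with ℕₚ.<-cmp (toℕ r) (toℕ s)
    ... | tri< r<s _ _ = sound β r<s
    ... | tri≈ _ r≡s _ = ⊥-elim (r≢s (toℕ-injective r≡s))
    ... | tri> _ _ s<r = E-sym (sound β s<r)
    find′ : ∀ {r s} → r ≢ s → ∀ {a b} → E a b → Σ Block λ β → entry β r ≡ a × entry β s ≡ b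
    find′ {r} {s} r≢s e with ℕₚ.<-cmp (toℕ r) (toℕ s)
    ... | tri< r<s _ _ = find r<s e
    ... | tri≈ _ r≡s _ = ⊥-elim (r≢s (toℕ-injective r≡s))
    ... | tri> _ _ s<r = let β , p , q = find s<r (E-sym e) in β , q , p
    unique′ : ∀ {r s} → r ≢ s → ∀ β β′ → entry β r ≡ entry β′ r → entry β s ≡ entry β′ s →
              ∀ j → entry β j ≡ entry β′ j
    unique′ {r} {s} r≢s β β′ p q j with ℕₚ.<-cmp (toℕ r) (toℕ s)
    ... | tri< r<s _ _ = cong (λ γ → entry γ j) (unique r<s β β′ p q)
    ... | tri≈ _ r≡s _ = ⊥-elim (r≢s (toℕ-injective r≡s))
    ... | tri> _ _ s<r = cong (λ γ → entry γ j) (unique s<r β β′ q p)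

  -- Base columns c with at most one blank each.  Scaling by H and translating
  -- yields the blocks; for each two rows the differences of the columns
  -- without a blank there represent every coset of H once.
  record BaseColumns {e : ℕ} (F : CosetField e) (k v : ℕ) : Set₁ where
    open CosetField F
    field
      Column : Set
      value : Column → Fin k → A
      blank : Column → Fin k → Maybe (Fin v)
      owner : Fin k → Fin v → Column
      owner-blank : ∀ r t → blank (owner r t) r ≡ just t
      owner-plain : ∀ {r s} t → r ≢ s → blank (owner r t) s ≡ nothing
      owner-unique : ∀ {c r t} → blank c r ≡ just t → c ≡ owner r t
      coset : Column → Fin k → Fin k → Fin e
      difference : ∀ c {r s} → toℕ r < toℕ s → blank c r ≡ nothing → blank c s ≡ nothing →
                   Σ (Fin f) λ i → value c r ≡ value c s + rep (coset c r s) * el i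
      pick : ∀ {r s} → toℕ r < toℕ s → ∀ j →
             Σ Column λ c → blank c r ≡ nothing × blank c s ≡ nothing × coset c r s ≡ j
      coset-injective : ∀ {c c′ r s} → toℕ r < toℕ s → blank c r ≡ nothing → blank c s ≡ nothing →
                        blank c′ r ≡ nothing → blank c′ s ≡ nothing → coset c r s ≡ coset c′ r s → c ≡ c′

  module Development {e k v} {F : CosetField e} (B : BaseColumns F k v) where
    open CosetField F
    open BaseColumns B

    private
      Point : Set
      Point = A ⊎ (Fin v × Fin f)

      Block : Set
      Block = Column × Fin f × A

      -- A blank is an ideal point: translations fix it, while scaling by `el i` moves it to
      -- `(t , i)`. So each of the `v` blanks yields `f` points of the hole.
      point : Fin f → A → Maybe (Fin v) → Point
      point i x nothing = inj₁ x
      point i x (just t) = inj₂ (t , i)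

      entry : Block → Fin k → Point
      entry (c , i , g) r = point i (el i * value c r + g) (blank c r)

      entry-plain : ∀ c i g r → blank c r ≡ nothing → entry (c , i , g) r ≡ inj₁ (el i * value c r + g)
      entry-plain c i g r p = cong (point i _) p

      entry-blank : ∀ c i g r {t} → blank c r ≡ just t → entry (c , i , g) r ≡ inj₂ (t , i)
      entry-blank c i g r p = cong (point i _) p

      view : (m : Maybe (Fin v)) → m ≡ nothing ⊎ ∃ λ t → m ≡ just t
      view nothing = inj₁ refl
      view (just t) = inj₂ (t , refl)

      <⇒≢ : ∀ {r s : Fin k} → toℕ r < toℕ s → r ≢ s
      <⇒≢ r<s refl = ℕₚ.<-irrefl refl r<s

      one-blank : ∀ c {r s t u} → r ≢ s → blank c r ≡ just t → blank c s ≡ just u → ⊥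
      one-blank c {r} {s} {t} r≢s p q with trans (sym q) (trans (cong (λ c → blank c s) (owner-unique p)) (owner-plain t r≢s))
      ... | ()

      el-injective : ∀ (j : Fin e) {i i′} → el i ≡ el i′ → i ≡ i′
      el-injective j p = proj₂ (decompose-unique {j} {j} (cong (rep j *_) p))

      Holey-sym : ∀ {a b} → Holey A (Fin v × Fin f) a b → Holey A (Fin v × Fin f) b a
      Holey-sym {inj₁ a} {inj₁ b} ne = ne ∘ sym
      Holey-sym {inj₁ a} {inj₂ b} _ = tt
      Holey-sym {inj₂ a} {inj₁ b} _ = tt

      sound : ∀ β {r s} → toℕ r < toℕ s → Holey A (Fin v × Fin f) (entry β r) (entry β s)
      sound (c , i , g) {r} {s} r<s with view (blank c r) | view (blank c s)
      ... | inj₂ (t , p) | inj₂ (u , q) = ⊥-elim (one-blank c (<⇒≢ r<s) p q)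
      ... | inj₂ (t , p) | inj₁ q = subst₂ (Holey _ _) (sym (entry-blank c i g r p)) (sym (entry-plain c i g s q)) tt
      ... | inj₁ p | inj₂ (u , q) = subst₂ (Holey _ _) (sym (entry-plain c i g r p)) (sym (entry-blank c i g s q)) tt
      ... | inj₁ p | inj₁ q = subst₂ (Holey _ _) (sym (entry-plain c i g r p)) (sym (entry-plain c i g s q)) λ eq →
        *-≢0 (el≢0 i) (*-≢0 (rep≢0 (coset c r s)) (el≢0 (proj₁ (difference c r<s p q))))
          (+-cancelˡ (el i * value c s + g) _ _ (begin
            el i * value c s + g + el i * z   ≡⟨ solve 4 (λ h w g z → h :* w :+ g :+ h :* z := h :* (w :+ z) :+ g) refl (el i) (value c s) g z ⟩
            el i * (value c s + z) + g        ≡⟨ cong (λ x → el i * x + g) (sym (proj₂ (difference c r<s p q))) ⟩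
            el i * value c r + g              ≡⟨ eq ⟩
            el i * value c s + g              ≡⟨ sym (+-identityʳ _) ⟩
            el i * value c s + g + 0#         ∎))
        where
        open ≡-Reasoning
        z = rep (coset c r s) * el (proj₁ (difference c r<s p q))

      minus-plus : ∀ a b → a ≡ b + (a + - b)
      minus-plus a b = trans (sym (+-identityʳ a)) (trans (cong (a +_) (sym (-‿inverseʳ b)))
        (solve 3 (λ a b n → a :+ (b :+ n) := b :+ (a :+ n)) refl a b (- b)))

      minus≢0 : ∀ {a b} → a ≢ b → a + - b ≢ 0#
      minus≢0 {a} {b} a≢b p = a≢b (trans (minus-plus a b) (trans (cong (b +_) p) (+-identityʳ b)))

      translate-to : ∀ c i r a → blank c r ≡ nothing → Σ A λ g → entry (c , i , g) r ≡ inj₁ a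
      translate-to c i r a p = a + - (el i * value c r) ,
        trans (entry-plain c i _ r p) (cong inj₁ (sym (minus-plus a _)))

      find : ∀ {r s} → toℕ r < toℕ s → ∀ {a b} → Holey A (Fin v × Fin f) a b →
             Σ Block λ β → entry β r ≡ a × entry β s ≡ b
      find {r} {s} r<s {inj₁ a} {inj₂ (t , i)} _ =
        let g , p = translate-to (owner s t) i r a (owner-plain t (<⇒≢ r<s ∘ sym))
        in (owner s t , i , g) , p , entry-blank (owner s t) i g s (owner-blank s t)
      find {r} {s} r<s {inj₂ (t , i)} {inj₁ b} _ =
        let g , p = translate-to (owner r t) i s b (owner-plain t (<⇒≢ r<s))
        in (owner r t , i , g) , entry-blank (owner r t) i g r (owner-blank r t) , p
      -- `a - b` selects the coset and thereby the column. The scale is the ratio of the `H`-parts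
      -- of `a - b` and of the column's own difference, and the translation is then forced by row
      -- `s`.
      find {r} {s} r<s {inj₁ a} {inj₁ b} a≢b with decompose (minus≢0 a≢b)
      ... | j , l , a-b with pick r<s j
      ... | c , p , q , refl with difference c r<s p q
      ... | l′ , dif with el-inverse l′
      ... | m , inv with el-* m l
      ... | i , el-i = (c , i , b + - (el i * value c s)) ,
          trans (entry-plain c i _ r p) (cong inj₁ at-r) ,
          trans (entry-plain c i _ s q) (cong inj₁ (sym (minus-plus b _)))
        where
        open ≡-Reasoning
        w = value c s
        ρ = rep (coset c r s)
        scaled : el i * el l′ ≡ el l
        scaled = begin
          el i * el l′          ≡⟨ cong (_* el l′) el-i ⟩
          el m * el l * el l′   ≡⟨ solve 3 (λ x y z → x :* y :* z := z :* x :* y) refl (el m) (el l) (el l′) ⟩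
          el l′ * el m * el l   ≡⟨ cong (_* el l) inv ⟩
          1# * el l             ≡⟨ *-identityˡ (el l) ⟩
          el l                  ∎
        at-r : el i * value c r + (b + - (el i * w)) ≡ a
        at-r = begin
          el i * value c r + (b + - (el i * w))
            ≡⟨ cong (λ x → el i * x + (b + - (el i * w))) dif ⟩
          el i * (w + ρ * el l′) + (b + - (el i * w))
            ≡⟨ solve 6 (λ h w ρ l b n → h :* (w :+ ρ :* l) :+ (b :+ n) := h :* w :+ (b :+ n) :+ ρ :* (h :* l)) refl (el i) w ρ (el l′) b (- (el i * w)) ⟩
          el i * w + (b + - (el i * w)) + ρ * (el i * el l′)
            ≡⟨ cong₂ (λ x y → x + ρ * y) (sym (minus-plus b (el i * w))) scaled ⟩
          b + ρ * el l
            ≡⟨ cong (b +_) (sym a-b) ⟩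
          b + (a + - b)
            ≡⟨ sym (minus-plus a b) ⟩
          a ∎

      unique-g : ∀ c i r {g g′} → blank c r ≡ nothing → entry (c , i , g) r ≡ entry (c , i , g′) r → g ≡ g′
      unique-g c i r {g} {g′} p e = +-cancelˡ (el i * value c r) g g′
        (inj₁-injective (trans (sym (entry-plain c i g r p)) (trans e (entry-plain c i g′ r p))))

      -- Subtracting the rows removes the translations. The coset of the result determines the
      -- column, and cancelling the common difference determines the scale.
      plain-plain : ∀ {c c′ i i′ g g′ r s} → toℕ r < toℕ s →
        blank c r ≡ nothing → blank c s ≡ nothing → blank c′ r ≡ nothing → blank c′ s ≡ nothing →
        entry (c , i , g) r ≡ entry (c′ , i′ , g′) r → entry (c , i , g) s ≡ entry (c′ , i′ , g′) s →
        _≡_ {A = Block} (c , i , g) (c′ , i′ , g′)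
      plain-plain {c} {c′} {i} {i′} {g} {g′} {r} {s} r<s p q p′ q′ er es = conclude same-column
        where
        open ≡-Reasoning
        l = proj₁ (difference c r<s p q)
        l′ = proj₁ (difference c′ r<s p′ q′)
        z = rep (coset c r s) * el l
        z′ = rep (coset c′ r s) * el l′
        w = value c s
        w′ = value c′ s
        at-r : el i * value c r + g ≡ el i′ * value c′ r + g′
        at-r = inj₁-injective (trans (sym (entry-plain c i g r p)) (trans er (entry-plain c′ i′ g′ r p′)))
        at-s : el i * w + g ≡ el i′ * w′ + g′
        at-s = inj₁-injective (trans (sym (entry-plain c i g s q)) (trans es (entry-plain c′ i′ g′ s q′)))
        same-difference : el i * z ≡ el i′ * z′
        same-difference = +-cancelˡ (el i * w + g) _ _ (begin
          el i * w + g + el i * z      ≡⟨ solve 4 (λ h w g z → h :* w :+ g :+ h :* z := h :* (w :+ z) :+ g) refl (el i) w g z ⟩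
          el i * (w + z) + g           ≡⟨ cong (λ x → el i * x + g) (sym (proj₂ (difference c r<s p q))) ⟩
          el i * value c r + g         ≡⟨ at-r ⟩
          el i′ * value c′ r + g′      ≡⟨ cong (λ x → el i′ * x + g′) (proj₂ (difference c′ r<s p′ q′)) ⟩
          el i′ * (w′ + z′) + g′       ≡⟨ solve 4 (λ h w g z → h :* (w :+ z) :+ g := h :* w :+ g :+ h :* z) refl (el i′) w′ g′ z′ ⟩
          el i′ * w′ + g′ + el i′ * z′ ≡⟨ cong (_+ el i′ * z′) (sym at-s) ⟩
          el i * w + g + el i′ * z′    ∎)
        same-column : c ≡ c′
        same-column = coset-injective r<s p q p′ q′ (proj₁ (decompose-unique {i = proj₁ (el-* i l)} {i′ = proj₁ (el-* i′ l′)} (begin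
          rep (coset c r s) * el (proj₁ (el-* i l))      ≡⟨ cong (rep (coset c r s) *_) (proj₂ (el-* i l)) ⟩
          rep (coset c r s) * (el i * el l)              ≡⟨ solve 3 (λ x y z → x :* (y :* z) := y :* (x :* z)) refl (rep (coset c r s)) (el i) (el l) ⟩
          el i * z                                       ≡⟨ same-difference ⟩
          el i′ * z′                                     ≡⟨ solve 3 (λ x y z → y :* (x :* z) := x :* (y :* z)) refl (rep (coset c′ r s)) (el i′) (el l′) ⟩
          rep (coset c′ r s) * (el i′ * el l′)           ≡⟨ cong (rep (coset c′ r s) *_) (sym (proj₂ (el-* i′ l′))) ⟩
          rep (coset c′ r s) * el (proj₁ (el-* i′ l′))   ∎)))
        conclude : c ≡ c′ → _≡_ {A = Block} (c , i , g) (c′ , i′ , g′)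
        conclude refl = with-scale (el-injective (coset c r s) (*-cancelˡ z≢0 (trans (*-comm z (el i)) (trans same-difference
          (trans (cong (el i′ *_) (sym z≡z′)) (*-comm (el i′) z))))))
          where
          z≢0 : z ≢ 0#
          z≢0 = *-≢0 (rep≢0 (coset c r s)) (el≢0 l)
          z≡z′ : z ≡ z′
          z≡z′ = +-cancelˡ w z z′ (trans (sym (proj₂ (difference c r<s p q))) (proj₂ (difference c r<s p′ q′)))
          with-scale : i ≡ i′ → _≡_ {A = Block} (c , i , g) (c , i′ , g′)
          with-scale refl = cong (λ g → c , i , g) (unique-g c i r p er)

      owned : ∀ {c c′ i i′ g g′ r s t t′} → r ≢ s → blank c r ≡ just t → blank c′ r ≡ just t′ →
        entry (c , i , g) r ≡ entry (c′ , i′ , g′) r → entry (c , i , g) s ≡ entry (c′ , i′ , g′) s →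
        _≡_ {A = Block} (c , i , g) (c′ , i′ , g′)
      owned {c} {c′} {i} {i′} {g} {g′} {r} {s} {t} r≢s p p′ er es
        with owner-unique p | owner-unique p′ | inj₂-injective (trans (sym (entry-blank c i g r p)) (trans er (entry-blank c′ i′ g′ r p′)))
      ... | refl | refl | refl = cong (λ g → c , i , g) (unique-g c i s (owner-plain t r≢s) es)

      clash : ∀ {c c′ i i′ g g′ r t} {X : Set} → blank c r ≡ just t → blank c′ r ≡ nothing →
              entry (c , i , g) r ≡ entry (c′ , i′ , g′) r → X
      clash {c} {c′} {i} {i′} {g} {g′} {r} p q e with trans (sym (entry-blank c i g r p)) (trans e (entry-plain c′ i′ g′ r q))
      ... | ()

      unique : ∀ {r s} → toℕ r < toℕ s → ∀ β β′ → entry β r ≡ entry β′ r → entry β s ≡ entry β′ s → β ≡ β′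
      unique {r} {s} r<s (c , i , g) (c′ , i′ , g′) er es
        with view (blank c r) | view (blank c′ r) | view (blank c s) | view (blank c′ s)
      ... | inj₁ p | inj₁ p′ | inj₁ q | inj₁ q′ = plain-plain r<s p q p′ q′ er es
      ... | inj₂ (_ , p) | inj₂ (_ , p′) | _ | _ = owned (<⇒≢ r<s) p p′ er es
      ... | inj₂ (_ , p) | inj₁ p′ | _ | _ = clash p p′ er
      ... | inj₁ p | inj₂ (_ , p′) | _ | _ = clash p′ p (sym er)
      ... | inj₁ p | inj₁ p′ | inj₂ (_ , q) | inj₂ (_ , q′) = owned (<⇒≢ r<s ∘ sym) q q′ es er
      ... | inj₁ p | inj₁ p′ | inj₂ (_ , q) | inj₁ q′ = clash q q′ es
      ... | inj₁ p | inj₁ p′ | inj₁ q | inj₂ (_ , q′) = clash q′ q (sym es)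

    development : OA k (Holey A (Fin v × Fin f))
    development = fromOrdered Block entry (λ {a} {b} → Holey-sym {a} {b}) sound
      (λ r<s {a} {b} → find r<s {a} {b}) unique

  -- The columns are X scaled by every coset representative, v of them with a
  -- blank in each row.  For rows r < s the cosets missing on account of blanks in
  -- r and in s are restored by the columns Y t and Z t respectively.
  module Columns {e k v o : ℕ} (label : ((Fin k × Fin v) ⊎ Fin o) ↔ Fin e) (F : CosetField e) where
    open CosetField F
    open Inverse label using (to; from; strictlyInverseˡ)

    Label : Set
    Label = (Fin k × Fin v) ⊎ Fin o

    build : (x : Fin k → A) → Caterpillar F (λ _ → 1#) x →
            (y : Fin v → Fin k → A) → (∀ t → Caterpillar F (λ r → rep (to (inj₁ (r , t)))) (y t)) →
            (z : Fin v → Fin k → A) → (∀ t {r s : Fin k} → toℕ r < toℕ s → Σ (Fin f) λ i → z t r ≡ z t s + rep (to (inj₁ (s , t))) * el i) →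
            BaseColumns F k v
    build x x-ok y y-ok z z-ok = record
      { Column = Column ; value = value ; blank = blank
      ; owner = λ r t → inj₁ (inj₁ (r , t))
      ; owner-blank = owner-blank ; owner-plain = owner-plain ; owner-unique = owner-unique
      ; coset = λ c r s → to (cosetLabel c r s)
      ; difference = difference
      ; pick = λ {r} {s} r<s j → let c , p , q , e = pick r<s (from j) in c , p , q , trans (cong to e) (strictlyInverseˡ j)
      ; coset-injective = λ r<s p q p′ q′ e → coset-injective _ _ r<s p q p′ q′ (to-injective label e) }
      where
      Column : Set
      Column = Label ⊎ (Fin v ⊎ Fin v)
      value : Column → Fin k → A
      value (inj₁ l) r = rep (to l) * x r
      value (inj₂ (inj₁ t)) r = y t r
      value (inj₂ (inj₂ t)) r = z t r
      blank : Column → Fin k → Maybe (Fin v)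
      blank (inj₁ (inj₁ (q , t))) r with q ≟F r
      ... | yes _ = just t
      ... | no _ = nothing
      blank (inj₁ (inj₂ _)) r = nothing
      blank (inj₂ _) r = nothing
      owner-blank : ∀ r t → blank (inj₁ (inj₁ (r , t))) r ≡ just t
      owner-blank r t with r ≟F r
      ... | yes _ = refl
      ... | no ¬p = ⊥-elim (¬p refl)
      owner-plain : ∀ {r s} t → r ≢ s → blank (inj₁ (inj₁ (r , t))) s ≡ nothing
      owner-plain {r} {s} t r≢s with r ≟F s
      ... | yes p = ⊥-elim (r≢s p)
      ... | no _ = refl
      owner-unique : ∀ {c r t} → blank c r ≡ just t → c ≡ inj₁ (inj₁ (r , t))
      owner-unique {inj₁ (inj₁ (q , t))} {r} p with q ≟F r
      owner-unique {inj₁ (inj₁ (q , t))} {r} refl | yes refl = refl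
      owner-unique {inj₁ (inj₁ (q , t))} {r} () | no _
      plain⇒≢ : ∀ {q t r} → blank (inj₁ (inj₁ (q , t))) r ≡ nothing → q ≢ r
      plain⇒≢ {q} {t} {r} p refl with q ≟F q
      plain⇒≢ {q} {t} {r} () refl | yes _
      ... | no ¬e = ¬e refl
      cosetLabel : Column → Fin k → Fin k → Label
      cosetLabel (inj₁ l) r s = l
      cosetLabel (inj₂ (inj₁ t)) r s = inj₁ (r , t)
      cosetLabel (inj₂ (inj₂ t)) r s = inj₁ (s , t)
      difference : ∀ c {r s} → toℕ r < toℕ s → blank c r ≡ nothing → blank c s ≡ nothing →
                   Σ (Fin f) λ i → value c r ≡ value c s + rep (to (cosetLabel c r s)) * el i
      difference (inj₁ l) {r} {s} r<s _ _ = let i , e = x-ok r<s in i ,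
        trans (cong (rep (to l) *_) e)
          (solve 3 (λ ρ x h → ρ :* (x :+ con 1 :* h) := ρ :* x :+ ρ :* h) refl (rep (to l)) (x s) (el i))
      difference (inj₂ (inj₁ t)) r<s _ _ = y-ok t r<s
      difference (inj₂ (inj₂ t)) r<s _ _ = z-ok t r<s
      pick : ∀ {r s} → toℕ r < toℕ s → ∀ l →
             Σ Column λ c → blank c r ≡ nothing × blank c s ≡ nothing × cosetLabel c r s ≡ l
      pick {r} {s} r<s (inj₂ l) = inj₁ (inj₂ l) , refl , refl , refl
      pick {r} {s} r<s (inj₁ (q , t)) with q ≟F r | q ≟F s
      ... | yes refl | _ = inj₂ (inj₁ t) , refl , refl , refl
      ... | no _ | yes refl = inj₂ (inj₂ t) , refl , refl , refl
      ... | no q≢r | no q≢s = inj₁ (inj₁ (q , t)) , owner-plain t q≢r , owner-plain t q≢s , refl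
      coset-injective : ∀ c c′ {r s} → toℕ r < toℕ s → blank c r ≡ nothing → blank c s ≡ nothing →
                        blank c′ r ≡ nothing → blank c′ s ≡ nothing → cosetLabel c r s ≡ cosetLabel c′ r s → c ≡ c′
      coset-injective (inj₁ l) (inj₁ .l) r<s p q p′ q′ refl = refl
      coset-injective (inj₁ .(inj₁ (_ , t))) (inj₂ (inj₁ t)) r<s p q p′ q′ refl = ⊥-elim (plain⇒≢ p refl)
      coset-injective (inj₁ .(inj₁ (_ , t))) (inj₂ (inj₂ t)) r<s p q p′ q′ refl = ⊥-elim (plain⇒≢ q refl)
      coset-injective (inj₂ (inj₁ t)) (inj₁ .(inj₁ (_ , t))) r<s p q p′ q′ refl = ⊥-elim (plain⇒≢ p′ refl)
      coset-injective (inj₂ (inj₂ t)) (inj₁ .(inj₁ (_ , t))) r<s p q p′ q′ refl = ⊥-elim (plain⇒≢ q′ refl)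
      coset-injective (inj₂ (inj₁ t)) (inj₂ (inj₁ .t)) r<s p q p′ q′ refl = refl
      coset-injective (inj₂ (inj₂ t)) (inj₂ (inj₂ .t)) r<s p q p′ q′ refl = refl
      coset-injective (inj₂ (inj₁ t)) (inj₂ (inj₂ u)) r<s p q p′ q′ e = ⊥-elim (ℕₚ.<-irrefl (cong toℕ (cong proj₁ (inj₁-injective e))) r<s)
      coset-injective (inj₂ (inj₂ t)) (inj₂ (inj₁ u)) r<s p q p′ q′ e = ⊥-elim (ℕₚ.<-irrefl (cong toℕ (cong proj₁ (inj₁-injective (sym e)))) r<s)

    opposite-< : ∀ {r s : Fin k} → toℕ r < toℕ s → toℕ (opposite s) < toℕ (opposite r)
    opposite-< {r} {s} r<s = subst₂ _<_ (sym (opposite-prop s)) (sym (opposite-prop r))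
      (ℕₚ.∸-monoʳ-< (ℕ.s≤s r<s) (toℕ<n s))

    -- In the columns `Z t` the coset has to follow the larger index. Reading a caterpillar
    -- backwards exchanges smaller and larger, and the sign change restores the direction of the
    -- difference.
    reverse : ∀ {μ y : Fin k → A} → Caterpillar F (μ ∘ opposite) y → ∀ {r s : Fin k} → toℕ r < toℕ s →
              Σ (Fin f) λ i → - y (opposite r) ≡ - y (opposite s) + μ s * el i
    reverse {μ} {y} y-ok {r} {s} r<s with y-ok (opposite-< r<s)
    ... | i , p = i , (begin
      - b                                   ≡⟨ sym (+-identityʳ (- b)) ⟩
      - b + 0#                              ≡⟨ cong (- b +_) (sym (-‿inverseʳ a)) ⟩
      - b + (a + - a)                       ≡⟨ cong (λ w → - b + (w + - a)) p ⟩
      - b + (b + μ (opposite (opposite s)) * el i + - a)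
                                            ≡⟨ cong (λ q → - b + (b + μ q * el i + - a)) (opposite-involutive s) ⟩
      - b + (b + μ s * el i + - a)          ≡⟨ solve 4 (λ n b m a → n :+ (b :+ m :+ a) := (n :+ b) :+ (a :+ m)) refl (- b) b (μ s * el i) (- a) ⟩
      - b + b + (- a + μ s * el i)          ≡⟨ cong (_+ (- a + μ s * el i)) (-‿inverseˡ b) ⟩
      0# + (- a + μ s * el i)               ≡⟨ +-identityˡ _ ⟩
      - a + μ s * el i                      ∎)
      where
      open ≡-Reasoning
      a = y (opposite s)
      b = y (opposite r)

  abstract
    holeyOA : ∀ {e k v o} → ((Fin k × Fin v) ⊎ Fin o) ↔ Fin e →
      Σ ℕ λ N → ∀ (F : CosetField e) → CharacteristicAbove N F → let open CosetField F in OA k (Holey A (Fin v × Fin f))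
    holeyOA {e} {k} label = let N , build = caterpillar e k in N , λ F char →
      let open CosetField F
          open Inverse label using (to)
          module C = Columns label F
          x , x-ok = build F char (λ _ → 1#) (λ _ → 1≢0)
          ys = λ t → build F char (λ r → rep (to (inj₁ (r , t)))) (λ _ → rep≢0 _)
          zs = λ t → build F char (λ r → rep (to (inj₁ (opposite r , t)))) (λ _ → rep≢0 _)
      in Development.development (C.build x x-ok (λ t → proj₁ (ys t)) (λ t → proj₂ (ys t))
           (λ t r → - proj₁ (zs t) (opposite r)) (λ t → C.reverse {μ = λ r → rep (to (inj₁ (r , t)))} (proj₂ (zs t))))

-- The index of the group of `E`-th powers in a finite field

module PowerCosets where

  open OrthogonalArrays
  open CosetFields
  open import Data.Bool.Base using (Bool; true; false)
  open import Data.Nat.Base as ℕ using (ℕ; zero; suc; _≤_; _<_; z≤n; s≤s)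
  import Data.Nat.Properties as ℕₚ
  open import Data.Nat.Solver using (module +-*-Solver)
  open import Data.Fin.Base using (Fin; zero; suc; toℕ; fromℕ<; remQuot; combine)
  open import Data.Fin.Properties using (any?; injective⇒≤; toℕ-fromℕ<; toℕ-injective; toℕ<n; combine-injective; combine-remQuot) renaming (_≟_ to _≟F_; suc-injective to sucF-injective)
  open import Data.Maybe.Base as Maybe using (Maybe; just; nothing)
  open import Data.Maybe.Properties using (just-injective)
  open import Data.Product using (Σ; _×_; _,_; proj₁; proj₂)
  open import Data.Sum using (_⊎_; inj₁; inj₂)
  open import Data.Empty using (⊥-elim)
  open import Algebra.Bundles using (CommutativeRing)
  open import Algebra.Structures using (IsCommutativeRing)
  import Algebra.Properties.Ring as RingProperties
  import Algebra.Properties.CommutativeSemiring.Exp as Exp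
  import Algebra.Solver.Ring.NaturalCoefficients.Default as Solver
  open import Level using (0ℓ)
  open import Function.Base using (_∘_)
  open import Function.Construct.Identity using (↔-id)
  open import Relation.Nullary using (¬_; Dec; yes; no; does)
  open import Relation.Nullary.Decidable using (_×-dec_; ¬?; dec-true; dec-false)
  open import Relation.Unary using (Decidable)
  open import Relation.Binary.Definitions using (tri<; tri≈; tri>)
  open import Relation.Binary.PropositionalEquality

  record Enumeration {n : ℕ} (P : Fin n → Set) : Set where
    field
      size : ℕ
      at : Fin size → Fin n
      at-injective : ∀ {i j} → at i ≡ at j → i ≡ j
      at-satisfies : ∀ i → P (at i)
      index : ∀ {x} → P x → Σ (Fin size) λ i → at i ≡ x

  enumerate : ∀ {n} {P : Fin n → Set} → Decidable P → Enumeration P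
  enumerate {zero} P? = record { size = 0 ; at = λ () ; at-injective = λ { {()} } ; at-satisfies = λ () ; index = λ { {()} } }
  enumerate {suc n} {P} P? with P? zero | enumerate {n} (P? ∘ suc)
  ... | yes p | R = record
    { size = suc (size R)
    ; at = λ { zero → zero ; (suc i) → suc (at R i) }
    ; at-injective = λ { {zero} {zero} _ → refl ; {suc i} {suc j} e → cong suc (at-injective R (sucF-injective e)) }
    ; at-satisfies = λ { zero → p ; (suc i) → at-satisfies R i }
    ; index = λ { {zero} _ → zero , refl ; {suc x} q → let i , e = index R q in suc i , cong suc e } }
    where open Enumeration
  ... | no ¬p | R = record
    { size = size R
    ; at = λ i → suc (at R i)
    ; at-injective = λ e → at-injective R (sucF-injective e)
    ; at-satisfies = at-satisfies R
    ; index = λ { {zero} q → ⊥-elim (¬p q) ; {suc x} q → let i , e = index R q in i , cong suc e } }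
    where open Enumeration

  first : ∀ {n} → (Fin n → Bool) → Maybe (Fin n)
  first {zero} b = nothing
  first {suc n} b with b zero
  ... | true = just zero
  ... | false = Maybe.map suc (first (b ∘ suc))

  first-cong : ∀ {n} {b c : Fin n → Bool} → (∀ i → b i ≡ c i) → first b ≡ first c
  first-cong {zero} e = refl
  first-cong {suc n} {b} {c} e with b zero | c zero | e zero
  ... | true | .true | refl = refl
  ... | false | .false | refl = cong (Maybe.map suc) (first-cong (e ∘ suc))

  first-just : ∀ {n} (b : Fin n → Bool) {i} → b i ≡ true → Σ (Fin n) λ j → first b ≡ just j × b j ≡ true
  first-just {suc n} b {i} e with b zero in eq
  ... | true = zero , refl , eq
  first-just {suc n} b {zero} e | false with trans (sym e) eq
  ... | ()
  first-just {suc n} b {suc i} e | false = let j , p , q = first-just (b ∘ suc) e in suc j , cong (Maybe.map suc) p , q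

  -- Each class is represented by its first member. Equivalent elements have the same membership
  -- test, so the search gives one answer for both.
  module Canonical {n : ℕ} (_∼_ : Fin n → Fin n → Set) (_∼?_ : ∀ a b → Dec (a ∼ b))
                   (∼-refl : ∀ {a} → a ∼ a) (∼-sym : ∀ {a b} → a ∼ b → b ∼ a)
                   (∼-trans : ∀ {a b c} → a ∼ b → b ∼ c → a ∼ c) where
    private
      hits : Fin n → Fin n → Bool
      hits a b = does (b ∼? a)
      found : ∀ a → Σ (Fin n) λ j → first (hits a) ≡ just j × hits a j ≡ true
      found a = first-just (hits a) {a} (dec-true (a ∼? a) ∼-refl)

    canonical : Fin n → Fin n
    canonical a = proj₁ (found a)

    canonical-∼ : ∀ a → canonical a ∼ a
    canonical-∼ a with canonical a ∼? a | proj₂ (proj₂ (found a))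
    ... | yes p | _ = p
    ... | no _ | ()

    canonical-cong : ∀ {a b} → a ∼ b → canonical a ≡ canonical b
    canonical-cong {a} {b} a∼b = just-injective (trans (sym (proj₁ (proj₂ (found a))))
      (trans (first-cong same) (proj₁ (proj₂ (found b)))))
      where
      same : ∀ c → hits a c ≡ hits b c
      same c with c ∼? a
      ... | yes p = sym (dec-true (c ∼? b) (∼-trans p a∼b))
      ... | no ¬p = sym (dec-false (c ∼? b) (λ q → ¬p (∼-trans q (∼-sym a∼b))))

  data Parity : ℕ → Set where
    even : ∀ m → Parity (2 ℕ.* m)
    odd : ∀ m → Parity (suc (2 ℕ.* m))

  parity : ∀ n → Parity n
  parity zero = even 0
  parity (suc n) with parity n
  ... | even m = odd m
  ... | odd m = subst Parity (ℕₚ.*-suc 2 m) (even (suc m))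

  module _ {q : ℕ} {_⊞_ _⊠_ : Fin q → Fin q → Fin q} {⊟_ : Fin q → Fin q} {0# 1# : Fin q}
           (isCommutativeRing : IsCommutativeRing _≡_ _⊞_ _⊠_ ⊟_ 0# 1#)
           (1≢0 : 1# ≢ 0#) (*-≡0 : ∀ {a b} → a ≢ 0# → a ⊠ b ≡ 0# → b ≡ 0#) where
    private
      infixl 6 _+_
      infixl 7 _·_
      infix 8 -_
      _+_ = _⊞_
      _·_ = _⊠_
      -_ = ⊟_
      A = Fin q
      R : CommutativeRing 0ℓ 0ℓ
      R = record { isCommutativeRing = isCommutativeRing }
      open CommutativeRing R using (commutativeSemiring)
      open IsCommutativeRing isCommutativeRing using (*-identityˡ; *-identityʳ; *-comm; *-assoc; zeroˡ; distribˡ; +-comm; -‿inverseʳ; +-identityʳ)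
      open RingProperties (CommutativeRing.ring R) using (-‿distribʳ-*; +-cancelˡ; +-cancelʳ)
      open Exp commutativeSemiring using (_^_; ^-homo-*; ^-assocʳ; ^-distrib-*)
      open Solver commutativeSemiring using (solve; _:=_; _:+_; _:*_; con)

      *-cancelˡ : ∀ {a} → a ≢ 0# → ∀ {b c} → a · b ≡ a · c → b ≡ c
      *-cancelˡ {a} a≢0 {b} {c} e = +-cancelʳ (- c) b c (trans (*-≡0 a≢0 (begin
        a · (b + - c)         ≡⟨ distribˡ a b (- c) ⟩
        a · b + a · - c       ≡⟨ cong₂ _+_ e (sym (-‿distribʳ-* a c)) ⟩
        a · c + - (a · c)     ≡⟨ -‿inverseʳ (a · c) ⟩
        0#                    ∎)) (sym (-‿inverseʳ c)))
        where open ≡-Reasoning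

      *-≢0 : ∀ {a b} → a ≢ 0# → b ≢ 0# → a · b ≢ 0#
      *-≢0 a≢0 b≢0 e = b≢0 (*-≡0 a≢0 e)

      factor≢0 : ∀ {a b} → a · b ≡ 1# → a ≢ 0#
      factor≢0 {b = b} e refl = 1≢0 (trans (sym e) (zeroˡ b))

      inverse : ∀ {a} → a ≢ 0# → Σ A λ b → a · b ≡ 1#
      inverse a≢0 = injective⇒surjective (*-cancelˡ a≢0) 1#

      1^ : ∀ n → 1# ^ n ≡ 1#
      1^ zero = refl
      1^ (suc n) = trans (*-identityˡ _) (1^ n)

      ^≢0 : ∀ {a} n → a ≢ 0# → a ^ n ≢ 0#
      ^≢0 zero a≢0 = 1≢0
      ^≢0 (suc n) a≢0 = *-≢0 a≢0 (^≢0 n a≢0)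

      ^-^-comm : ∀ a m n → (a ^ m) ^ n ≡ (a ^ n) ^ m
      ^-^-comm a m n = trans (^-assocʳ a m n) (trans (cong (a ^_) (ℕₚ.*-comm m n)) (sym (^-assocʳ a n m)))

      -- Used for the cosets of `H` and again for the fibres of the `E`-th power map; the two counts
      -- of the nonzero elements are then compared.
      card : ∀ {m n} (g : Fin m → Fin n → A) → (∀ i j → g i j ≢ 0#) →
             (∀ {a} → a ≢ 0# → Σ (Fin m) λ i → Σ (Fin n) λ j → a ≡ g i j) →
             (∀ {i j i′ j′} → g i j ≡ g i′ j′ → i ≡ i′ × j ≡ j′) → q ≡ suc (m ℕ.* n)
      card {m} {n} g g≢0 onto uniq = ℕₚ.≤-antisym (injective⇒≤ {f = there} (λ {a} {b} → there-inj a b)) (injective⇒≤ {f = back} (λ {a} {b} → back-inj a b))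
        where
        there : Fin q → Fin (suc (m ℕ.* n))
        there a with a ≟F 0#
        ... | yes _ = zero
        ... | no a≢0 = suc (combine (proj₁ (onto a≢0)) (proj₁ (proj₂ (onto a≢0))))
        there-inj : ∀ a b → there a ≡ there b → a ≡ b
        there-inj a b e with a ≟F 0# | b ≟F 0#
        ... | yes p | yes q = trans p (sym q)
        ... | no p | no q with combine-injective (proj₁ (onto p)) _ (proj₁ (onto q)) _ (sucF-injective e)
        ...   | r , s = trans (proj₂ (proj₂ (onto p))) (trans (cong₂ g r s) (sym (proj₂ (proj₂ (onto q)))))
        back : Fin (suc (m ℕ.* n)) → Fin q
        back zero = 0#
        back (suc c) = g (proj₁ (remQuot {m} n c)) (proj₂ (remQuot {m} n c))
        back-inj : ∀ c d → back c ≡ back d → c ≡ d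
        back-inj zero zero _ = refl
        back-inj zero (suc d) e = ⊥-elim (g≢0 _ _ (sym e))
        back-inj (suc c) zero e = ⊥-elim (g≢0 _ _ e)
        back-inj (suc c) (suc d) e with uniq e
        ... | r , s = cong suc (trans (sym (combine-remQuot {m} n c)) (trans (cong₂ combine r s) (combine-remQuot {m} n d)))

    module RootsOfUnity (ν : A) (1+ν : 1# + ν ≡ 0#) (1≢ν : 1# ≢ ν) where

      ν² : ν · ν ≡ 1#
      ν² = +-cancelˡ ν _ _ (begin
        ν + ν · ν        ≡⟨ solve 1 (λ n → n :+ n :* n := (con 1 :+ n) :* n) refl ν ⟩
        (1# + ν) · ν     ≡⟨ cong (_· ν) 1+ν ⟩
        0# · ν           ≡⟨ zeroˡ ν ⟩
        0#               ≡⟨ sym 1+ν ⟩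
        1# + ν           ≡⟨ +-comm 1# ν ⟩
        ν + 1#           ∎)
        where open ≡-Reasoning

      ν^even : ∀ m → ν ^ (2 ℕ.* m) ≡ 1#
      ν^even m = trans (sym (^-assocʳ ν 2 m)) (trans (cong (_^ m) (trans (cong (ν ·_) (*-identityʳ ν)) ν²)) (1^ m))

      -- `ν` stands for -1: the product of `z - 1` and `z + 1` vanishes, and there are no zero
      -- divisors.
      square-root : ∀ {z} → z ^ 2 ≡ 1# → z ≡ 1# ⊎ z ≡ ν
      square-root {z} z² with (ν + z) ≟F 0#
      ... | yes p = inj₁ (+-cancelˡ ν _ _ (trans p (trans (sym 1+ν) (+-comm 1# ν))))
      ... | no ne = inj₂ (+-cancelˡ 1# _ _ (trans (*-≡0 ne (begin
        (ν + z) · (1# + z)              ≡⟨ solve 2 (λ n z → (n :+ z) :* (con 1 :+ z) := (con 1 :+ n) :* z :+ (n :+ z :* (z :* con 1))) refl ν z ⟩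
        (1# + ν) · z + (ν + z ^ 2)      ≡⟨ cong₂ (λ x y → x · z + (ν + y)) 1+ν z² ⟩
        0# · z + (ν + 1#)               ≡⟨ cong₂ _+_ (zeroˡ z) (trans (+-comm ν 1#) 1+ν) ⟩
        0# + 0#                         ≡⟨ +-identityʳ 0# ⟩
        0#                              ∎)) (sym 1+ν)))
        where open ≡-Reasoning

      -- ξ has order 2 ^ (s + 1); the dichotomy z ^ 2 ^ s = ± 1 decides the parity of
      -- the exponent.
      root-power : ∀ s ξ → ξ ^ (2 ℕ.^ s) ≡ ν → ∀ z → z ^ (2 ℕ.^ suc s) ≡ 1# →
                   Σ ℕ λ j → j < 2 ℕ.^ suc s × z ≡ ξ ^ j
      root-power zero ξ ξ≡ z z≡ with square-root {z} z≡
      ... | inj₁ p = 0 , s≤s z≤n , p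
      ... | inj₂ p = 1 , s≤s (s≤s z≤n) , trans p (sym ξ≡)
      root-power (suc s) ξ ξ≡ z z≡ with square-root {z ^ (2 ℕ.^ suc s)}
        (trans (^-assocʳ z (2 ℕ.^ suc s) 2) (trans (cong (z ^_) (ℕₚ.*-comm (2 ℕ.^ suc s) 2)) z≡))
      ... | inj₁ p = let j , j< , e = root-power s (ξ ^ 2) (trans (^-assocʳ ξ 2 (2 ℕ.^ s)) ξ≡) z p
                     in 2 ℕ.* j , ℕₚ.*-monoʳ-< 2 j< , trans e (^-assocʳ ξ 2 j)
      ... | inj₂ p = let j , j< , e = root-power s (ξ ^ 2) (trans (^-assocʳ ξ 2 (2 ℕ.^ s)) ξ≡) (z · η) zη
                     in suc (2 ℕ.* j) , bound j< , (begin
                          z                     ≡⟨ sym (*-identityˡ z) ⟩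
                          1# · z                ≡⟨ cong (_· z) (sym ξη) ⟩
                          ξ · η · z             ≡⟨ solve 3 (λ x n z → x :* n :* z := x :* (z :* n)) refl ξ η z ⟩
                          ξ · (z · η)           ≡⟨ cong (ξ ·_) (trans e (^-assocʳ ξ 2 j)) ⟩
                          ξ · ξ ^ (2 ℕ.* j)     ∎)
        where
        open ≡-Reasoning
        2ˢ = 2 ℕ.^ suc s
        ξ≢0 : ξ ≢ 0#
        ξ≢0 refl = factor≢0 ν² (trans (sym ξ≡) (zero^ 2ˢ (ℕₚ.m^n>0 2 (suc s))))
          where
          zero^ : ∀ n → 1 ≤ n → 0# ^ n ≡ 0#
          zero^ (suc n) _ = zeroˡ (0# ^ n)
        η = proj₁ (inverse ξ≢0)
        ξη : ξ · η ≡ 1#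
        ξη = proj₂ (inverse ξ≢0)
        zη : (z · η) ^ 2ˢ ≡ 1#
        zη = begin
          (z · η) ^ 2ˢ       ≡⟨ ^-distrib-* z η 2ˢ ⟩
          z ^ 2ˢ · η ^ 2ˢ    ≡⟨ cong (_· η ^ 2ˢ) (trans p (sym ξ≡)) ⟩
          ξ ^ 2ˢ · η ^ 2ˢ    ≡⟨ sym (^-distrib-* ξ η 2ˢ) ⟩
          (ξ · η) ^ 2ˢ       ≡⟨ cong (_^ 2ˢ) ξη ⟩
          1# ^ 2ˢ            ≡⟨ 1^ 2ˢ ⟩
          1#                 ∎
        bound : ∀ {j} → j < 2ˢ → suc (2 ℕ.* j) < 2 ℕ.* 2ˢ
        bound {j} j< = subst (ℕ._≤ 2 ℕ.* 2ˢ) (ℕₚ.*-suc 2 j) (ℕₚ.*-monoʳ-≤ 2 j<)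

      -- An odd exponent would, after raising to the power `2 ^ s`, give `1# ≡ ν`; an even one is
      -- halved by passing from `ξ` to `ξ ^ 2`.
      ^≢1 : ∀ s ξ → ξ ^ (2 ℕ.^ s) ≡ ν → ∀ d → 1 ≤ d → d < 2 ℕ.^ suc s → ξ ^ d ≢ 1#
      ^≢1 s ξ ξ≡ d 1≤d d< e with parity d
      ... | odd m = 1≢ν (begin
        1#                            ≡⟨ sym (1^ (2 ℕ.^ s)) ⟩
        1# ^ (2 ℕ.^ s)                ≡⟨ cong (_^ (2 ℕ.^ s)) (sym e) ⟩
        (ξ ^ suc (2 ℕ.* m)) ^ (2 ℕ.^ s) ≡⟨ ^-^-comm ξ (suc (2 ℕ.* m)) (2 ℕ.^ s) ⟩
        (ξ ^ (2 ℕ.^ s)) ^ suc (2 ℕ.* m) ≡⟨ cong (_^ suc (2 ℕ.* m)) ξ≡ ⟩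
        ν · ν ^ (2 ℕ.* m)             ≡⟨ cong (ν ·_) (ν^even m) ⟩
        ν · 1#                        ≡⟨ *-identityʳ ν ⟩
        ν                             ∎)
        where open ≡-Reasoning
      ^≢1 zero ξ ξ≡ .(2 ℕ.* zero) () d< e | even zero
      ^≢1 zero ξ ξ≡ .(2 ℕ.* suc m) 1≤d d< e | even (suc m) =
        ⊥-elim (ℕₚ.<⇒≱ d< (ℕₚ.*-monoʳ-≤ 2 {1} {suc m} (s≤s z≤n)))
      ^≢1 (suc s) ξ ξ≡ .(2 ℕ.* m) 1≤d d< e | even m =
        ^≢1 s (ξ ^ 2) (trans (^-assocʳ ξ 2 (2 ℕ.^ s)) ξ≡) m (positive m 1≤d) (ℕₚ.*-cancelˡ-< 2 m _ d<) (trans (^-assocʳ ξ 2 m) e)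
        where
        positive : ∀ m → 1 ≤ 2 ℕ.* m → 1 ≤ m
        positive (suc m) _ = s≤s z≤n

      module Cosets (s : ℕ) (ξ : A) (ξ≡ : ξ ^ (2 ℕ.^ s) ≡ ν) where
        E : ℕ
        E = 2 ℕ.^ suc s

        ξ≢0 : ξ ≢ 0#
        ξ≢0 refl = factor≢0 ν² (trans (sym ξ≡) (zero^ (2 ℕ.^ s) (ℕₚ.m^n>0 2 s)))
          where
          zero^ : ∀ n → 1 ≤ n → 0# ^ n ≡ 0#
          zero^ (suc n) _ = zeroˡ (0# ^ n)

        ξ^E : ξ ^ E ≡ 1#
        ξ^E = trans (cong (ξ ^_) (ℕₚ.*-comm 2 (2 ℕ.^ s))) (trans (sym (^-assocʳ ξ (2 ℕ.^ s) 2))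
          (trans (cong (_^ 2) ξ≡) (trans (cong (ν ·_) (*-identityʳ ν)) ν²)))

        separated : ∀ {i j} → i < j → j < E → ξ ^ i ≢ ξ ^ j
        separated {i} {j} i<j j< e = ^≢1 s ξ ξ≡ (j ℕ.∸ i) (ℕₚ.m<n⇒0<n∸m i<j) (ℕₚ.≤-<-trans (ℕₚ.m∸n≤m j i) j<)
          (*-cancelˡ (^≢0 i ξ≢0) (begin
            ξ ^ i · ξ ^ (j ℕ.∸ i)   ≡⟨ sym (^-homo-* ξ i (j ℕ.∸ i)) ⟩
            ξ ^ (i ℕ.+ (j ℕ.∸ i))   ≡⟨ cong (ξ ^_) (ℕₚ.m+[n∸m]≡n (ℕₚ.<⇒≤ i<j)) ⟩
            ξ ^ j                   ≡⟨ sym e ⟩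
            ξ ^ i                   ≡⟨ sym (*-identityʳ (ξ ^ i)) ⟩
            ξ ^ i · 1#              ∎))
          where open ≡-Reasoning

        ξ^-injective : ∀ {i j} → i < E → j < E → ξ ^ i ≡ ξ ^ j → i ≡ j
        ξ^-injective {i} {j} i< j< e with ℕₚ.<-cmp i j
        ... | tri≈ _ p _ = p
        ... | tri< i<j _ _ = ⊥-elim (separated i<j j< e)
        ... | tri> _ _ j<i = ⊥-elim (separated j<i i< (sym e))

        IsPower : A → Set
        IsPower a = Σ A λ y → y ≢ 0# × y ^ E ≡ a

        isPower? : Decidable IsPower
        isPower? a = any? λ y → ¬? (y ≟F 0#) ×-dec ((y ^ E) ≟F a)

        power-1 : IsPower 1#
        power-1 = 1# , 1≢0 , 1^ E

        power-* : ∀ {a b} → IsPower a → IsPower b → IsPower (a · b)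
        power-* (y , y≢0 , refl) (z , z≢0 , refl) = y · z , *-≢0 y≢0 z≢0 , ^-distrib-* y z E

        power-inverse : ∀ {a} → IsPower a → Σ A λ b → IsPower b × a · b ≡ 1#
        power-inverse (y , y≢0 , refl) = let z , yz = inverse y≢0 in
          z ^ E , (z , factor≢0 (trans (*-comm z y) yz) , refl) ,
          trans (sym (^-distrib-* y z E)) (trans (cong (_^ E) yz) (1^ E))

        open Enumeration
        powers : Enumeration IsPower
        powers = enumerate isPower?

        _∼_ : A → A → Set
        a ∼ b = Σ A λ h → IsPower h × a ≡ b · h

        ∼-refl : ∀ {a} → a ∼ a
        ∼-refl {a} = 1# , power-1 , sym (*-identityʳ a)

        ∼-sym : ∀ {a b} → a ∼ b → b ∼ a
        ∼-sym {b = b} (h , p , refl) = let g , p′ , hg = power-inverse p in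
          g , p′ , trans (sym (*-identityʳ b)) (trans (cong (b ·_) (sym hg)) (sym (*-assoc b h g)))

        ∼-trans : ∀ {a b c} → a ∼ b → b ∼ c → a ∼ c
        ∼-trans {c = c} (h , p , refl) (h′ , p′ , refl) = h′ · h , power-* p′ p , *-assoc c h′ h

        open Canonical _∼_ (λ a b → any? λ h → isPower? h ×-dec (a ≟F (b · h))) ∼-refl ∼-sym ∼-trans

        IsRep : A → Set
        IsRep a = a ≢ 0# × canonical a ≡ a

        reps : Enumeration IsRep
        reps = enumerate λ a → ¬? (a ≟F 0#) ×-dec (canonical a ≟F a)

        e f : ℕ
        e = size reps
        f = size powers

        power≢0 : ∀ {a} → IsPower a → a ≢ 0#
        power≢0 (y , y≢0 , refl) = ^≢0 E y≢0

        decompose : ∀ {a} → a ≢ 0# → Σ (Fin e) λ j → Σ (Fin f) λ i → a ≡ at reps j · at powers i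
        decompose {a} a≢0 =
          let h , p , eq = ∼-sym (canonical-∼ a)
              c≢0 = λ c≡0 → a≢0 (trans eq (trans (cong (_· h) c≡0) (zeroˡ h)))
              j , pj = index reps {canonical a} (c≢0 , canonical-cong (canonical-∼ a))
              i , pi = index powers p
          in j , i , trans eq (sym (cong₂ _·_ pj pi))

        decompose-unique : ∀ {j j′ i i′} → at reps j · at powers i ≡ at reps j′ · at powers i′ → j ≡ j′ × i ≡ i′
        decompose-unique {j} {j′} {i} {i′} eq = conclude (at-injective reps (begin
          at reps j              ≡⟨ sym (proj₂ (at-satisfies reps j)) ⟩
          canonical (at reps j)  ≡⟨ canonical-cong related ⟩
          canonical (at reps j′) ≡⟨ proj₂ (at-satisfies reps j′) ⟩
          at reps j′             ∎)) eq
          where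
          open ≡-Reasoning
          related : at reps j ∼ at reps j′
          related = ∼-trans (∼-sym (at powers i , at-satisfies powers i , refl))
            (at powers i′ , at-satisfies powers i′ , eq)
          conclude : ∀ {j′} → j ≡ j′ → at reps j · at powers i ≡ at reps j′ · at powers i′ → j ≡ j′ × i ≡ i′
          conclude refl eq = refl , at-injective powers (*-cancelˡ (proj₁ (at-satisfies reps j)) eq)

        root : Fin f → A
        root i = proj₁ (at-satisfies powers i)

        root≢0 : ∀ i → root i ≢ 0#
        root≢0 i = proj₁ (proj₂ (at-satisfies powers i))

        root^E : ∀ i j → (root i · ξ ^ j) ^ E ≡ at powers i
        root^E i j = begin
          (root i · ξ ^ j) ^ E        ≡⟨ ^-distrib-* (root i) (ξ ^ j) E ⟩
          root i ^ E · (ξ ^ j) ^ E    ≡⟨ cong₂ _·_ (proj₂ (proj₂ (at-satisfies powers i))) (trans (^-^-comm ξ j E) (trans (cong (_^ j) ξ^E) (1^ j))) ⟩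
          at powers i · 1#            ≡⟨ *-identityʳ _ ⟩
          at powers i                 ∎
          where open ≡-Reasoning

        -- Every nonzero element is the chosen `E`-th root of its `E`-th power times a unique power
        -- of `ξ`, so all fibres of the `E`-th power map have `E` elements.
        q≡1+fE : q ≡ suc (f ℕ.* E)
        q≡1+fE = card (λ i j → root i · ξ ^ toℕ j) (λ i j → *-≢0 (root≢0 i) (^≢0 (toℕ j) ξ≢0)) onto uniq
          where
          onto : ∀ {a} → a ≢ 0# → Σ (Fin f) λ i → Σ (Fin E) λ j → a ≡ root i · ξ ^ toℕ j
          onto {a} a≢0 =
            let i , pi = index powers (a , a≢0 , refl)
                y , inv = inverse (root≢0 i)
                z^E = begin
                  (a · y) ^ E           ≡⟨ ^-distrib-* a y E ⟩
                  a ^ E · y ^ E         ≡⟨ cong (_· y ^ E) (trans (sym pi) (sym (proj₂ (proj₂ (at-satisfies powers i))))) ⟩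
                  root i ^ E · y ^ E    ≡⟨ sym (^-distrib-* (root i) y E) ⟩
                  (root i · y) ^ E      ≡⟨ cong (_^ E) inv ⟩
                  1# ^ E                ≡⟨ 1^ E ⟩
                  1#                    ∎
                j , j< , eq = root-power s ξ ξ≡ (a · y) z^E
            in i , fromℕ< j< , (begin
                  a                            ≡⟨ sym (*-identityʳ a) ⟩
                  a · 1#                       ≡⟨ cong (a ·_) (sym inv) ⟩
                  a · (root i · y)             ≡⟨ solve 3 (λ a r y → a :* (r :* y) := r :* (a :* y)) refl a (root i) y ⟩
                  root i · (a · y)             ≡⟨ cong (root i ·_) eq ⟩
                  root i · ξ ^ j               ≡⟨ cong (λ j → root i · ξ ^ j) (sym (toℕ-fromℕ< j<)) ⟩
                  root i · ξ ^ toℕ (fromℕ< j<) ∎)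
            where open ≡-Reasoning
          uniq : ∀ {i j i′ j′} → root i · ξ ^ toℕ j ≡ root i′ · ξ ^ toℕ j′ → i ≡ i′ × j ≡ j′
          uniq {i} {j} {i′} {j′} eq = conclude (at-injective powers
            (trans (sym (root^E i (toℕ j))) (trans (cong (_^ E) eq) (root^E i′ (toℕ j′))))) eq
            where
            conclude : ∀ {i′} → i ≡ i′ → root i · ξ ^ toℕ j ≡ root i′ · ξ ^ toℕ j′ → i ≡ i′ × j ≡ j′
            conclude refl eq = refl , toℕ-injective (ξ^-injective (toℕ<n j) (toℕ<n j′) (*-cancelˡ (root≢0 i) eq))

        q≡1+ef : q ≡ suc (e ℕ.* f)
        q≡1+ef = card (λ j i → at reps j · at powers i)
          (λ j i → *-≢0 (proj₁ (at-satisfies reps j)) (power≢0 (at-satisfies powers i))) decompose decompose-unique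

        -- Both `e * f` and `f * E` equal `q - 1`, and `f` is positive because 1 is a power.
        e≡E : e ≡ E
        e≡E = cancel (index powers power-1) (ℕₚ.suc-injective (trans (sym q≡1+ef) (trans q≡1+fE (cong suc (ℕₚ.*-comm f E)))))
          where
          cancel : ∀ {f a b} {P : Fin f → Set} → Σ (Fin f) P → a ℕ.* f ≡ b ℕ.* f → a ≡ b
          cancel {suc f} {a} {b} _ p = ℕₚ.*-cancelʳ-≡ a b (suc f) p

        cosetField : CosetField e
        cosetField = record
          { A = A ; _+_ = _⊞_ ; _*_ = _⊠_ ; -_ = ⊟_ ; 0# = 0# ; 1# = 1#
          ; isCommutativeRing = isCommutativeRing
          ; 1≢0 = 1≢0 ; order = q ; finite = ↔-id A ; inverse = inverse
          ; f = f ; rep = at reps ; el = at powers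
          ; decompose = decompose ; decompose-unique = decompose-unique
          ; rep≢0 = λ j → proj₁ (at-satisfies reps j)
          ; el≢0 = λ i → power≢0 (at-satisfies powers i)
          ; el-* = λ i i′ → index powers (power-* (at-satisfies powers i) (at-satisfies powers i′))
          ; el-inverse = λ i → let b , p , inv = power-inverse (at-satisfies powers i)
                                   l , pl = index powers p
                               in l , trans (cong (at powers i ·_) pl) inv }

-- Large primes that are 1 modulo a given power of two

module PrimeFields where

  open ModularArithmetic
  open CosetFields
  open PowerCosets
  open AbelianArrays using (∣!)
  open import Data.Nat.Base
  open import Data.Nat.Properties
  open import Data.Nat.Divisibility
  open import Data.Nat.Primality
  open import Data.Nat.Primality.Factorisation using (factorise; module PrimeFactorisation)
  open import Data.Nat.Coprimality using (Coprime; prime⇒coprime)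
  open import Data.List.Base using ([]; _∷_)
  open import Data.Nat.ListAction using (product)
  open import Data.List.Relation.Unary.All using (_∷_)
  open import Data.Fin.Base using (toℕ)
  open import Data.Fin.Properties using (toℕ<n)
  open import Data.Product using (Σ; _×_; _,_; proj₁; proj₂)
  open import Data.Empty using (⊥-elim)
  open import Algebra.Bundles using (CommutativeRing)
  open import Algebra.Structures using (IsCommutativeRing)
  import Algebra.Properties.Ring as RingProperties
  import Algebra.Properties.CommutativeSemiring.Exp as Exp
  open import Relation.Binary.PropositionalEquality

  abstract
    prime-factor : ∀ n → 2 ≤ n → Σ ℕ λ p → Prime p × p ∣ n
    prime-factor n@(suc _) 2≤n with PrimeFactorisation.factors (factorise n) | PrimeFactorisation.isFactorisation (factorise n) | PrimeFactorisation.factorsPrime (factorise n)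
    ... | [] | n≡1 | _ = ⊥-elim (<-irrefl (sym n≡1) 2≤n)
    ... | p ∷ ps | n≡ | pp ∷ _ = p , pp , subst (p ∣_) (sym n≡) (m∣m*n (product ps))

  record PrimeCosetField (s N : ℕ) : Set₁ where
    field
      p : ℕ
      p-prime : Prime p
      N<p : N < p
      field′ : CosetField (2 ^ suc s)
      order≡p : CosetField.order field′ ≡ p
      p≡ : p ≡ suc (2 ^ suc s * CosetField.f field′)
      characteristic : CharacteristicAbove N field′

  module PrimeField (s N x p : ℕ) (p-prime : Prime p) (p∣x^+1 : p ∣ suc (x ^ (2 ^ s))) (large : 2 + N < p) where
    private
      instance
        p≢0 : NonZero p
        p≢0 = prime⇒nonZero p-prime

      2≤p : 2 ≤ p
      2≤p = nonTrivial⇒n>1 p {{prime⇒nonTrivial p-prime}}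

      open IsCommutativeRing (ℤ/-isCommutativeRing p) using (-‿inverseʳ)
      open Exp (CommutativeRing.commutativeSemiring (ℤ/ p)) using () renaming (_^_ to _^′_)
      open RingProperties (CommutativeRing.ring (ℤ/ p)) using (+-cancelˡ)

      residue≢0 : ∀ {d} → 1 ≤ d → d < p → residue p d ≢ residue p 0
      residue≢0 {d} 1≤d d<p e = <⇒≱ d<p (∣⇒≤ {{>-nonZero 1≤d}} (residue≡0⇒∣ p e))

      no-zero-divisors : ∀ {a b} → a ≢ residue p 0 → _⊗_ p a b ≡ residue p 0 → b ≡ residue p 0
      no-zero-divisors {a} {b} a≢0 e = coprime-⊗-≡0 p {toℕ a} {b}
        (prime⇒coprime′ (n≢0⇒n>0 λ z → a≢0 (trans (sym (residue-toℕ p a)) (cong (residue p) z))))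
        (trans (cong (λ c → _⊗_ p c b) (residue-toℕ p a)) e)
        where
        prime⇒coprime′ : 0 < toℕ a → Coprime p (toℕ a)
        prime⇒coprime′ q = prime⇒coprime p-prime {{>-nonZero q}} (toℕ<n a)

      residue-^ : ∀ a k → residue p a ^′ k ≡ residue p (a ^ k)
      residue-^ a zero = refl
      residue-^ a (suc k) = trans (cong (_⊗_ p (residue p a)) (residue-^ a k)) (residue-* p a (a ^ k))

      1≢0 : residue p 1 ≢ residue p 0
      1≢0 = residue≢0 ≤-refl 2≤p

      ν = ⊖_ p (residue p 1)

      -- The 2 in `2 + N < p` excludes `p = 2`, where 1 and -1 coincide.
      1≢ν : residue p 1 ≢ ν
      1≢ν e = residue≢0 {2} (s≤s z≤n) (<-≤-trans (s≤s (s≤s (s≤s z≤n))) large)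
        (trans (sym (residue-+ p 1 1)) (trans (cong (_⊕_ p (residue p 1)) e) (-‿inverseʳ (residue p 1))))

      ξ≡ : residue p x ^′ (2 ^ s) ≡ ν
      ξ≡ = +-cancelˡ (residue p 1) _ _ (trans (cong (_⊕_ p (residue p 1)) (residue-^ x (2 ^ s)))
        (trans (residue-+ p 1 (x ^ (2 ^ s))) (trans (∣⇒residue≡0 p p∣x^+1) (sym (-‿inverseʳ (residue p 1))))))

      module C = RootsOfUnity.Cosets (ℤ/-isCommutativeRing p) 1≢0 no-zero-divisors ν (-‿inverseʳ (residue p 1)) 1≢ν s (residue p x) ξ≡

      nat≡residue : ∀ d → CosetField.nat C.cosetField d ≡ residue p d
      nat≡residue zero = refl
      nat≡residue (suc d) = trans (cong (_⊕_ p (residue p 1)) (nat≡residue d)) (residue-+ p 1 d)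

      char : CharacteristicAbove N C.cosetField
      char {d} 1≤d d≤N e = residue≢0 1≤d (≤-<-trans (≤-trans d≤N (m≤n+m N 2)) large) (trans (sym (nat≡residue d)) e)

      Goal : ℕ → Set₁
      Goal e = Σ (CosetField e) λ F → CosetField.order F ≡ p × p ≡ suc (e * CosetField.f F) × CharacteristicAbove N F

      goal : Goal (2 ^ suc s)
      goal = subst Goal C.e≡E (C.cosetField , refl , C.q≡1+ef , char)

    primeCosetField : PrimeCosetField s N
    primeCosetField = record
      { p = p ; p-prime = p-prime ; N<p = ≤-<-trans (m≤n+m N 2) large
      ; field′ = proj₁ goal ; order≡p = proj₁ (proj₂ goal) ; p≡ = proj₁ (proj₂ (proj₂ goal))
      ; characteristic = proj₂ (proj₂ (proj₂ goal)) }

  module _ (s N x : ℕ) (1≤x : 1 ≤ x) (small∣x : ∀ {d} → 1 ≤ d → d ≤ 2 + N → d ∣ x) where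
    private
      factor : Σ ℕ λ p → Prime p × p ∣ suc (x ^ (2 ^ s))
      factor = prime-factor (suc (x ^ (2 ^ s))) (s≤s (>-nonZero⁻¹ _ {{m^n≢0 x (2 ^ s) {{>-nonZero 1≤x}}}}))

      p = proj₁ factor

      2≤p : 2 ≤ p
      2≤p = nonTrivial⇒n>1 p {{prime⇒nonTrivial (proj₁ (proj₂ factor))}}

      divides-power : ∀ {k} → p ∣ x → 1 ≤ k → p ∣ x ^ k
      divides-power {suc k} q _ = ∣m⇒∣m*n (x ^ k) q

      large : 2 + N < p
      large = ≰⇒> λ p≤ → <-irrefl (sym (∣1⇒≡1 (∣m+n∣m⇒∣n (subst (p ∣_) (+-comm 1 (x ^ (2 ^ s))) (proj₂ (proj₂ factor)))
        (divides-power (small∣x (≤-trans (s≤s z≤n) 2≤p) p≤) (m^n>0 2 s))))) 2≤p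

    -- As in Euclid's argument: a prime up to `2 + N` divides `x`, so it cannot also divide
    -- `x ^ (2 ^ s) + 1`.
    euclid : PrimeCosetField s N
    euclid = PrimeField.primeCosetField s N x p (proj₁ (proj₂ factor)) (proj₂ (proj₂ factor)) large

  abstract
    primeCosetField : ∀ s N → PrimeCosetField s N
    primeCosetField s N = euclid s N ((2 + N) !) (1≤n! (2 + N)) ∣!

-- From holes over prime fields to holes of every large size

module LargeHoles where

  open OrthogonalArrays
  open TransversalDesigns
  open CosetFields
  open DifferenceMatrices
  open PrimeFields
  open import Data.Nat.Base
  open import Data.Nat.Properties
  open import Data.Nat.DivMod
  open import Data.Nat.Primality
  open import Data.Nat.Coprimality using (prime⇒coprime; coprime-Bézout)
  open import Data.Nat.GCD using (module Bézout)
  open import Data.Nat.Solver using (module +-*-Solver)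
  open import Data.Fin.Base using (Fin)
  open import Data.Fin.Properties using (+↔⊎; *↔×)
  open import Data.Product using (Σ; ∃; _×_; _,_; proj₁; proj₂)
  open import Data.Sum using (_⊎_)
  open import Data.Sum.Function.Propositional using (_⊎-↔_)
  open import Function.Bundles using (_↔_)
  open import Function.Construct.Composition using (_↔-∘_)
  open import Function.Construct.Symmetry using (↔-sym)
  open import Function.Construct.Identity using (↔-id)
  open import Relation.Binary.PropositionalEquality

  n<2^n : ∀ n → n < 2 ^ n
  n<2^n zero = s≤s z≤n
  n<2^n (suc n) = begin-strict
    suc n          ≡⟨ +-comm 1 n ⟩
    n + 1          <⟨ +-mono-<-≤ (n<2^n n) (m^n>0 2 n) ⟩
    2 ^ n + 2 ^ n  ≡⟨ cong (2 ^ n +_) (+-identityʳ (2 ^ n)) ⟨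
    2 ^ suc n      ∎
    where open ≤-Reasoning

  module _ (k : ℕ) .{{_ : NonZero k}} where
    private
      -- This exponent makes `e` at least `k * k`. Then `v` is at least `k`, which exceeds the
      -- remainder `o`, and `e ≤ (1 + k) * v` follows.
      s = k * k
      e = 2 ^ suc s
      v = e / k
      o = e % k

      e≡ : k * v + o ≡ e
      e≡ = trans (+-comm (k * v) o) (trans (cong (o +_) (*-comm k v)) (sym (m≡m%n+[m/n]*n e k)))

      label : ((Fin k × Fin v) ⊎ Fin o) ↔ Fin e
      label = subst (λ n → ((Fin k × Fin v) ⊎ Fin o) ↔ Fin n) e≡ (↔-sym +↔⊎ ↔-∘ (↔-sym *↔× ⊎-↔ ↔-id _))

      k≤v : k ≤ v
      k≤v = subst (_≤ v) (m*n/n≡m k k) (/-monoˡ-≤ k (≤-trans (<⇒≤ (n<2^n s)) (^-monoʳ-≤ 2 (n≤1+n s))))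

      e≤ : e ≤ (1 + k) * v
      e≤ = begin
        e           ≡⟨ e≡ ⟨
        k * v + o   ≤⟨ +-monoʳ-≤ (k * v) (≤-trans (<⇒≤ (m%n<n e k)) k≤v) ⟩
        k * v + v   ≡⟨ +-comm (k * v) v ⟩
        (1 + k) * v ∎
        where open ≤-Reasoning

    PrimeHole : ℕ → Set₁
    PrimeHole B = Σ ℕ λ p → Σ ℕ λ w → Prime p × B < p × 1 ≤ w × H k p w × p ≤ (2 + k) * w

    private
      -- As e ≥ k², the ratio p / w is close to e / ⌊ e / k ⌋ ≤ k + 1.
      primeHole′ : ∀ B → PrimeHole B
      primeHole′ B = p , w , p-prime , ≤-<-trans (m≤n⊔m (1 ⊔ N) B) N<p , 1≤w , hole , bound
        where
        N = proj₁ (holeyOA label)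
        -- `N` serves the construction and `B` the caller, while `1 < p` excludes `f = 0` in
        -- `p = 1 + e * f`.
        open PrimeCosetField (primeCosetField s ((1 ⊔ N) ⊔ B))
        f = CosetField.f field′
        w = v * f
        hole : H k p w
        hole = transport-Holey (subst (λ q → CosetField.A field′ ↔ Fin q) order≡p (CosetField.finite field′)) (↔-sym *↔×)
          (proj₂ (holeyOA label) field′ (CharacteristicAbove-≤ {F = field′} (≤-trans (m≤n⊔m 1 N) (m≤m⊔n (1 ⊔ N) B)) characteristic))
        1≤f : 1 ≤ f
        1≤f = n≢0⇒n>0 λ f≡0 → <⇒≱ (≤-<-trans (≤-trans (m≤m⊔n 1 N) (m≤m⊔n (1 ⊔ N) B)) N<p)
          (≤-reflexive (trans p≡ (cong suc (trans (cong (e *_) f≡0) (*-zeroʳ e)))))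
        1≤w : 1 ≤ w
        1≤w = *-mono-≤ (≤-trans (>-nonZero⁻¹ k) k≤v) 1≤f
        bound : p ≤ (2 + k) * w
        bound = begin
          p                      ≡⟨ p≡ ⟩
          1 + e * f              ≤⟨ +-mono-≤ 1≤w (*-monoˡ-≤ f e≤) ⟩
          w + (1 + k) * v * f    ≡⟨ cong (w +_) (*-assoc (1 + k) v f) ⟩
          (2 + k) * w            ∎
          where open ≤-Reasoning

    abstract
      primeHole : ∀ B → PrimeHole B
      primeHole = primeHole′

  -- Wilson's construction with an empty second group: `i` points of the hole group get weight `w`
  -- and the others weight 0.
  inflate : ∀ {k p T w i} → H k p w → Id k p → TD (2 + p) T → Id k T → i ≤ T → H k (p * T) (i * w)
  inflate {k} {p} {T} {w} {i} hole ideal O IT i≤T =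
    let φ , zeros , eφ = weighting (_≡ 0) 0 0 refl refl refl 0 0 {T} z≤n
        ω , ings , eω = weighting (H k p) w 0 (Id⇒H ideal) hole (Id⇒H ideal) i 0 (subst (_≤ T) (sym (+-identityʳ i)) i≤T)
    in subst₂ (H k) (trans (cong (p * T +_) eφ) (+-identityʳ (p * T))) (trans eω (+-identityʳ (i * w)))
         (wilsonH φ ω (λ t → subst (_≤ 1) (sym (zeros t)) z≤n) O
           (λ x y → subst (λ q → H k q (ω x)) (trans (sym (+-identityʳ p)) (cong (p +_) (sym (zeros y)))) (ings x))
           IT (subst (Id k) (sym eφ) empty))

  -- Adding multiples of `q` and of `p` to the Bézout coefficients makes both multipliers as large
  -- as desired.
  shift-Bézout : ∀ p q x y l → 1 + y * p ≡ x * q → 1 + p * (y + l * q) ≡ q * (x + l * p)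
  shift-Bézout p q x y l eq = begin
    1 + p * (y + l * q)     ≡⟨ solve 4 (λ p q y l → con 1 :+ p :* (y :+ l :* q) := (con 1 :+ y :* p) :+ l :* p :* q) refl p q y l ⟩
    1 + y * p + l * p * q   ≡⟨ cong (_+ l * p * q) eq ⟩
    x * q + l * p * q       ≡⟨ solve 4 (λ p q x l → x :* q :+ l :* p :* q := q :* (x :+ l :* p)) refl p q x l ⟩
    q * (x + l * p)         ∎
    where open ≡-Reasoning
          open +-*-Solver

  -- The common `W` is the point: a block of the truncated design meets its other groups in `S` or
  -- `S + 1` points, and the weight of its hole point must suit both cases.
  record ConsecutiveHoles (k B : ℕ) : Set₁ where
    field
      S W : ℕ
      B≤S : B ≤ S
      1≤W : 1 ≤ W
      hole : H k S W
      hole⁺ : H k (1 + S) W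
      dense : S ≤ (3 + k) * W

  module _ (k′ B : ℕ) where
    private
      k = suc k′
      n₀ = proj₁ (Id-eventually k′)

      large-enough : ℕ → ℕ → ℕ
      large-enough p p′ = proj₁ (TD-eventually (2 + p)) ⊔ proj₁ (TD-eventually (2 + p′)) ⊔ n₀

      consecutive : ∀ {p p′ w w′ T T′} → 1 ≤ w → 1 ≤ w′ → 1 ≤ p → n₀ ≤ p → n₀ ≤ p′ →
        H k p w → H k p′ w′ → p ≤ (2 + k) * w → p′ ≤ (2 + k) * w′ → 1 + p * T ≡ p′ * T′ →
        large-enough p p′ ≤ T → large-enough p p′ ≤ T′ → B + (2 + k) * ((2 + k) * (w * w′)) ≤ T →
        ConsecutiveHoles k B
      consecutive {p} {p′} {w} {w′} {T} {T′} 1≤w 1≤w′ 1≤p p≥ p′≥ h h′ p≤ p′≤ pT T≥ T′≥ T-large = record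
        { S = S ; W = W ; B≤S = ≤-trans (m≤m+n B _) (≤-trans T-large T≤S)
        ; 1≤W = *-mono-≤ (*-mono-≤ (≤-trans (s≤s z≤n) c≥) 1≤w′) 1≤w
        ; hole = inflate h (Id-large p p≥) (TD-large p T (≤-trans (m≤m⊔n _ _) (≤-trans (m≤m⊔n _ n₀) T≥))) (Id-large T (≤-trans (m≤n⊔m _ n₀) T≥)) cw′≤T
        ; hole⁺ = subst₂ (H k) (sym pT) W≡′
            (inflate h′ (Id-large p′ p′≥) (TD-large p′ T′ (≤-trans (m≤n⊔m _ _) (≤-trans (m≤m⊔n _ n₀) T′≥))) (Id-large T′ (≤-trans (m≤n⊔m _ n₀) T′≥)) cw≤T′)
        ; dense = dense }
        where
        open ≤-Reasoning
        Id-large : ∀ n → n₀ ≤ n → Id k n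
        Id-large = proj₂ (Id-eventually k′)
        TD-large : ∀ q T → proj₁ (TD-eventually (2 + q)) ≤ T → TD (2 + q) T
        TD-large q = proj₂ (TD-eventually (2 + q))
        S = p * T
        T≤S : T ≤ S
        T≤S = m≤n*m T p {{>-nonZero 1≤p}}
        -- `W = c * w′ * w` is a multiple of both holes, reached with `c * w′` points of weight `w`
        -- over `T` and with `c * w` points of weight `w′` over `T′`. Both counts fit because
        -- `c * unit ≤ S` while `p ≤ (2 + k) * w` and `p′ ≤ (2 + k) * w′`.
        unit = (2 + k) * (w * w′)
        instance
          unit≢0 : NonZero unit
          unit≢0 = >-nonZero (*-mono-≤ {1} {2 + k} (s≤s z≤n) (*-mono-≤ 1≤w 1≤w′))
        c = S / unit
        W = c * w′ * w
        W≡′ : c * w * w′ ≡ W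
        W≡′ = trans (*-assoc c w w′) (trans (cong (c *_) (*-comm w w′)) (sym (*-assoc c w′ w)))
        c-unit≤S : c * unit ≤ S
        c-unit≤S = m/n*n≤m S unit
        -- `T` was taken this large so that the rounding loss, at most `unit`, is covered by one
        -- further `W` in `dense`.
        c≥ : 2 + k ≤ c
        c≥ = subst (_≤ c) (m*n/n≡m (2 + k) unit) (/-monoˡ-≤ unit (≤-trans (m≤n+m _ B) (≤-trans T-large T≤S)))
        cw′≤T : c * w′ ≤ T
        cw′≤T = *-cancelˡ-≤ ((2 + k) * w) {{>-nonZero (*-mono-≤ {1} {2 + k} (s≤s z≤n) 1≤w)}} (begin
          (2 + k) * w * (c * w′)   ≡⟨ solve 4 (λ a w c v → a :* w :* (c :* v) := c :* (a :* (w :* v))) refl (2 + k) w c w′ ⟩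
          c * unit                 ≤⟨ c-unit≤S ⟩
          p * T                    ≤⟨ *-monoˡ-≤ T p≤ ⟩
          (2 + k) * w * T          ∎)
          where open +-*-Solver
        cw≤T′ : c * w ≤ T′
        cw≤T′ = *-cancelˡ-≤ ((2 + k) * w′) {{>-nonZero (*-mono-≤ {1} {2 + k} (s≤s z≤n) 1≤w′)}} (begin
          (2 + k) * w′ * (c * w)   ≡⟨ solve 4 (λ a w c v → a :* v :* (c :* w) := c :* (a :* (w :* v))) refl (2 + k) w c w′ ⟩
          c * unit                 ≤⟨ c-unit≤S ⟩
          S                        ≤⟨ n≤1+n S ⟩
          1 + S                    ≡⟨ pT ⟩
          p′ * T′                  ≤⟨ *-monoˡ-≤ T′ p′≤ ⟩
          (2 + k) * w′ * T′        ∎)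
          where open +-*-Solver
        dense : S ≤ (3 + k) * W
        dense = begin
          S                            ≡⟨ m≡m%n+[m/n]*n S unit ⟩
          S % unit + c * unit          ≤⟨ +-monoˡ-≤ (c * unit) (<⇒≤ (m%n<n S unit)) ⟩
          unit + c * unit              ≤⟨ +-monoˡ-≤ (c * unit) (*-monoˡ-≤ (w * w′) c≥) ⟩
          c * (w * w′) + c * unit      ≡⟨ solve 4 (λ a w c v → c :* (w :* v) :+ c :* (a :* (w :* v)) := (con 1 :+ a) :* (c :* v :* w)) refl (2 + k) w c w′ ⟩
          (3 + k) * W                  ∎
          where open +-*-Solver

      combine : ∀ {p p′ w w′} → Bézout.Identity 1 p′ p → 1 ≤ w → 1 ≤ w′ → 1 ≤ p → 1 ≤ p′ → n₀ ≤ p → n₀ ≤ p′ →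
        H k p w → H k p′ w′ → p ≤ (2 + k) * w → p′ ≤ (2 + k) * w′ → ConsecutiveHoles k B
      combine {p} {p′} {w} {w′} (Bézout.+- x y eq) 1≤w 1≤w′ 1≤p 1≤p′ n₀≤p n₀≤p′ h h′ p≤ p′≤ =
        consecutive 1≤w 1≤w′ 1≤p n₀≤p n₀≤p′ h h′ p≤ p′≤ (shift-Bézout p p′ x y L eq)
          (≤-trans (m≤m⊔n L₁ L₂) T≥) (≤-trans (m≤m⊔n L₁ L₂) T′≥) (≤-trans (m≤n⊔m L₁ L₂) T≥)
        where
        L₁ = large-enough p p′
        L₂ = B + (2 + k) * ((2 + k) * (w * w′))
        L = L₁ ⊔ L₂
        T≥ : L ≤ y + L * p′
        T≥ = ≤-trans (m≤m*n L p′ {{>-nonZero 1≤p′}}) (m≤n+m (L * p′) y)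
        T′≥ : L ≤ x + L * p
        T′≥ = ≤-trans (m≤m*n L p {{>-nonZero 1≤p}}) (m≤n+m (L * p) x)
      combine {p} {p′} {w} {w′} (Bézout.-+ x y eq) 1≤w 1≤w′ 1≤p 1≤p′ n₀≤p n₀≤p′ h h′ p≤ p′≤ =
        consecutive 1≤w′ 1≤w 1≤p′ n₀≤p′ n₀≤p h′ h p′≤ p≤ (shift-Bézout p′ p y x L eq)
          (≤-trans (m≤m⊔n L₁ L₂) T≥) (≤-trans (m≤m⊔n L₁ L₂) T′≥) (≤-trans (m≤n⊔m L₁ L₂) T≥)
        where
        L₁ = large-enough p′ p
        L₂ = B + (2 + k) * ((2 + k) * (w′ * w))
        L = L₁ ⊔ L₂
        T≥ : L ≤ x + L * p
        T≥ = ≤-trans (m≤m*n L p {{>-nonZero 1≤p}}) (m≤n+m (L * p) x)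
        T′≥ : L ≤ y + L * p′
        T′≥ = ≤-trans (m≤m*n L p′ {{>-nonZero 1≤p′}}) (m≤n+m (L * p′) y)

    abstract
      consecutiveHoles : ConsecutiveHoles k B
      consecutiveHoles =
        let p , w , p-prime , p> , 1≤w , h , p≤ = primeHole k n₀
            -- The second prime exceeds the first, hence is coprime to it.
            p′ , w′ , p′-prime , p′> , 1≤w′ , h′ , p′≤ = primeHole k (n₀ ⊔ p)
            n₀≤p = <⇒≤ p>
            n₀≤p′ = <⇒≤ (≤-<-trans (m≤m⊔n n₀ p) p′>)
            1≤p = <⇒≤ (nonTrivial⇒n>1 p {{prime⇒nonTrivial p-prime}})
            1≤p′ = <⇒≤ (nonTrivial⇒n>1 p′ {{prime⇒nonTrivial p′-prime}})
        in combine (coprime-Bézout (prime⇒coprime p′-prime {{>-nonZero 1≤p}} (≤-<-trans (m≤n⊔m n₀ p) p′>)))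
             1≤w 1≤w′ 1≤p 1≤p′ n₀≤p n₀≤p′ h h′ p≤ p′≤

  module _ (k′ : ℕ) where
    private
      k = suc k′
      r₀ = proj₁ (Id-eventually k′)
      open ConsecutiveHoles (consecutiveHoles k′ (1 ⊔ r₀))
      T₀ = proj₁ (TD-eventually (2 + S)) ⊔ r₀ ⊔ (r₀ + S)
      -- The first two terms absorb the rounding of `m` by `W` and the remainder `r` in `m+W²≤WT`;
      -- the last one forces `T₀ ≤ T`.
      m₀ = (3 + k) * (W * W) + (S + r₀) + (r₀ + S * T₀)

      1≤S : 1 ≤ S
      1≤S = ≤-trans (m≤m⊔n 1 r₀) B≤S

      r₀≤S : r₀ ≤ S
      r₀≤S = ≤-trans (m≤n⊔m 1 r₀) B≤S

      instance
        S≢0 : NonZero S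
        S≢0 = >-nonZero 1≤S
        W≢0 : NonZero W
        W≢0 = >-nonZero 1≤W

      Id-large : ∀ n → r₀ ≤ n → Id k n
      Id-large = proj₂ (Id-eventually k′)

      ingredient : ℕ → Set₁
      ingredient ω = ∀ {b} → IsBit b → H k (S + b) ω

      ingredient₀ : ingredient 0
      ingredient₀ bit₀ = Id⇒H (Id-large _ (≤-trans r₀≤S (m≤m+n S 0)))
      ingredient₀ bit₁ = Id⇒H (Id-large _ (≤-trans r₀≤S (m≤m+n S 1)))

      ingredient₁ : ingredient 1
      ingredient₁ bit₀ = Id⇒H₁ (Id-large _ (≤-trans r₀≤S (≤-trans (m≤m+n S 0) (n≤1+n _))))
      ingredient₁ bit₁ = Id⇒H₁ (Id-large _ (≤-trans r₀≤S (≤-trans (m≤m+n S 1) (n≤1+n _))))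

      ingredientᵂ : ingredient W
      ingredientᵂ bit₀ = subst (λ s → H k s W) (sym (+-identityʳ S)) hole
      ingredientᵂ bit₁ = subst (λ s → H k s W) (+-comm 1 S) hole⁺

    largeHole : ∃ λ m₀ → ∀ N m → m₀ ≤ m → (4 + k) * m ≤ N → H k N m
    largeHole = m₀ , main
      where
      main : ∀ N m → m₀ ≤ m → (4 + k) * m ≤ N → H k N m
      main N m m₀≤m bound =
        let φ , bits , eφ = weighting IsBit 1 0 bit₀ bit₁ bit₀ r 0 (subst (_≤ T) (sym (+-identityʳ r)) r≤T)
            ω , ings , eω = weighting ingredient W 1 ingredient₀ ingredientᵂ ingredient₁ i j i+j≤T
            φ≡r = trans eφ (trans (+-identityʳ (r * 1)) (*-identityʳ r))
        in subst₂ (H k) (trans (cong (S * T +_) φ≡r) (sym N≡)) (trans eω (sym m≡))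
             (wilsonH φ ω (λ t → bit≤1 (bits t))
               (proj₂ (TD-eventually (2 + S)) T (≤-trans (m≤m⊔n _ r₀) (≤-trans (m≤m⊔n _ (r₀ + S)) T₀≤T)))
               (λ x y → ings x (bits y))
               (Id-large T (≤-trans (m≤n⊔m _ r₀) (≤-trans (m≤m⊔n _ (r₀ + S)) T₀≤T)))
               (subst (Id k) (sym φ≡r) (Id-large r (m≤m+n r₀ _))))
        where
        open ≤-Reasoning
        m≤N : m ≤ N
        m≤N = ≤-trans (m≤m+n m _) bound
        r₀+ST₀≤N : r₀ + S * T₀ ≤ N
        r₀+ST₀≤N = ≤-trans (m≤n+m (r₀ + S * T₀) ((3 + k) * (W * W) + (S + r₀))) (≤-trans m₀≤m m≤N)
        N′ = N ∸ r₀
        N′≡ : r₀ + N′ ≡ N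
        N′≡ = m+[n∸m]≡n (≤-trans (m≤m+n r₀ _) r₀+ST₀≤N)
        T = N′ / S
        -- `r₀` is set aside before the division, so that the truncated group has at least `r₀`
        -- points and an idempotent array exists on it.
        r = r₀ + N′ % S
        N≡ : N ≡ S * T + r
        N≡ = begin-equality
          N                        ≡⟨ N′≡ ⟨
          r₀ + N′                  ≡⟨ cong (r₀ +_) (m≡m%n+[m/n]*n N′ S) ⟩
          r₀ + (N′ % S + T * S)    ≡⟨ solve 4 (λ a b t s → a :+ (b :+ t :* s) := s :* t :+ (a :+ b)) refl r₀ (N′ % S) T S ⟩
          S * T + r                ∎
          where open +-*-Solver
        T₀≤T : T₀ ≤ T
        T₀≤T = subst (_≤ T) (m*n/n≡m T₀ S) (/-monoˡ-≤ S (+-cancelˡ-≤ r₀ _ _ (begin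
          r₀ + T₀ * S   ≡⟨ cong (r₀ +_) (*-comm T₀ S) ⟩
          r₀ + S * T₀   ≤⟨ r₀+ST₀≤N ⟩
          N             ≡⟨ N′≡ ⟨
          r₀ + N′       ∎)))
        r≤ : r ≤ r₀ + S
        r≤ = +-monoʳ-≤ r₀ (<⇒≤ (m%n<n N′ S))
        r≤T : r ≤ T
        r≤T = ≤-trans r≤ (≤-trans (m≤n⊔m _ (r₀ + S)) T₀≤T)
        -- The hole consists of `i` points of weight `W` and `j` points of weight 1; by `dense` the
        -- `T` points of the group are enough for them.
        i = m / W
        j = m % W
        m≡ : m ≡ i * W + j * 1
        m≡ = trans (m≡m%n+[m/n]*n m W) (trans (+-comm j (i * W)) (cong (i * W +_) (sym (*-identityʳ j))))
        m+W²≤WT : m + W * W ≤ W * T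
        m+W²≤WT = *-cancelˡ-≤ (3 + k) (+-cancelʳ-≤ (S + r₀) _ _ (begin
          (3 + k) * (m + W * W) + (S + r₀)           ≡⟨ solve 4 (λ a m w c → a :* (m :+ w) :+ c := a :* m :+ (a :* w :+ c)) refl (3 + k) m (W * W) (S + r₀) ⟩
          (3 + k) * m + ((3 + k) * (W * W) + (S + r₀)) ≤⟨ +-monoʳ-≤ ((3 + k) * m) (≤-trans (m≤m+n _ _) m₀≤m) ⟩
          (3 + k) * m + m                            ≡⟨ +-comm ((3 + k) * m) m ⟩
          (4 + k) * m                                ≤⟨ bound ⟩
          N                                          ≡⟨ N≡ ⟩
          S * T + r                                  ≤⟨ +-mono-≤ (*-monoˡ-≤ T dense) (≤-trans r≤ (≤-reflexive (+-comm r₀ S))) ⟩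
          (3 + k) * W * T + (S + r₀)                 ≡⟨ cong (_+ (S + r₀)) (*-assoc (3 + k) W T) ⟩
          (3 + k) * (W * T) + (S + r₀)               ∎))
          where open +-*-Solver
        i+j≤T : i + j ≤ T
        i+j≤T = *-cancelˡ-≤ W (begin
          W * (i + j)      ≡⟨ *-distribˡ-+ W i j ⟩
          W * i + W * j    ≤⟨ +-mono-≤ (≤-trans (≤-reflexive (*-comm W i)) (m/n*n≤m m W)) (*-monoʳ-≤ W (<⇒≤ (m%n<n m W))) ⟩
          m + W * W        ≤⟨ m+W²≤WT ⟩
          W * T            ∎)

-- From arrays with a hole to orthogonal incomplete latin squares

module IncompleteLatinSquares where

  open import Defs
  open OrthogonalArrays
  open TransversalDesigns using (H)
  open import Data.Nat.Base using (ℕ; zero; suc; _+_)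
  open import Data.Fin.Base using (Fin; zero; suc; splitAt; _↑ˡ_; _↑ʳ_; join)
  open import Data.Fin.Properties using (join-splitAt; splitAt-join; suc-injective; _≟_)
  open import Data.Fin.Subset using (Subset; _∈_; _∉_; ∣_∣; outside) renaming (⊤ to full)
  open import Data.Fin.Subset.Properties using (_∈?_; ∣⊤∣≡n; ∈⊤)
  open import Data.Vec.Base as Vec using (_∷_)
  open import Data.Maybe.Base using (Maybe; just; nothing)
  open import Data.Maybe.Properties using (just-injective)
  open import Data.Product using (Σ; _×_; _,_; proj₁)
  open import Data.Sum using (_⊎_; inj₁; inj₂)
  open import Data.Unit using (tt)
  open import Data.Empty using (⊥; ⊥-elim)
  open import Relation.Nullary using (¬_; Dec; yes; no)
  open import Relation.Nullary.Decidable using (_×-dec_)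
  open import Relation.Binary.PropositionalEquality

  NotBoth : ∀ {n} → Subset n → Fin n → Fin n → Set
  NotBoth M a b = ¬ (a ∈ M × b ∈ M)

  module _ {t n : ℕ} (M : Subset n) (O : OA (2 + t) (NotBoth M)) where
    open OA O

    private
      first≢second : _≢_ {A = Fin (2 + t)} zero (suc zero)
      first≢second ()

      column : Fin t → Fin (2 + t)
      column l = suc (suc l)

      cell : ∀ {i j} → Dec (i ∈ M × j ∈ M) → Fin t → Maybe (Fin n)
      cell (yes _) l = nothing
      cell (no e) l = just (entry (proj₁ (find first≢second e)) (column l))

    -- The first two columns of the array index the cells, and column `2 + l` supplies the symbols
    -- of square `l`.
    square : Fin t → Array n
    square l i j = cell ((i ∈? M) ×-dec (j ∈? M)) l

    private
      Cell : Fin t → Fin n → Fin n → Fin n → Set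
      Cell l i j s = Σ Block λ β → entry β zero ≡ i × entry β (suc zero) ≡ j × entry β (column l) ≡ s

      from-square : ∀ l {i j s} → square l i j ≡ just s → Cell l i j s
      from-square l {i} {j} e with (i ∈? M) ×-dec (j ∈? M)
      from-square l {i} {j} () | yes _
      ... | no ne = let β , p , q = find first≢second ne in β , p , q , just-injective e

      to-square : ∀ l β → square l (entry β zero) (entry β (suc zero)) ≡ just (entry β (column l))
      to-square l β with (entry β zero ∈? M) ×-dec (entry β (suc zero) ∈? M)
      ... | yes both = ⊥-elim (sound β first≢second both)
      ... | no ne = let β′ , p , q = find first≢second ne in cong just (unique first≢second β′ β p q (column l))

      to-square′ : ∀ l {i j s} → Cell l i j s → square l i j ≡ just s
      to-square′ l (β , refl , refl , refl) = to-square l β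

    square-isIncompleteLatin : ∀ l → IsIncompleteLatinSquare M (square l)
    square-isIncompleteLatin l = record
      { hole-empty = empty-hole
      ; filled = full-elsewhere
      ; row-latin = λ i j k s p q → row (from-square l p) (from-square l q)
      ; col-latin = λ i j k s p q → col (from-square l p) (from-square l q)
      ; row-hole = λ i j s i∈M p s∈M → row-M i∈M s∈M (from-square l p)
      ; col-hole = λ i j s j∈M p s∈M → col-M j∈M s∈M (from-square l p) }
      where
      0≢ : zero ≢ column l
      0≢ ()
      1≢ : suc zero ≢ column l
      1≢ ()
      empty-hole : ∀ i j → i ∈ M → j ∈ M → square l i j ≡ nothing
      empty-hole i j i∈M j∈M with (i ∈? M) ×-dec (j ∈? M)
      ... | yes _ = refl
      ... | no ne = ⊥-elim (ne (i∈M , j∈M))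
      full-elsewhere : ∀ i j → ¬ (i ∈ M × j ∈ M) → Σ (Fin n) λ s → square l i j ≡ just s
      full-elsewhere i j ne = let β , p , q = find first≢second ne in entry β (column l) , to-square′ l (β , p , q , refl)
      row : ∀ {i j k s} → Cell l i j s → Cell l i k s → j ≡ k
      row (β , refl , refl , refl) (β′ , p , refl , q) = unique 0≢ β β′ (sym p) (sym q) (suc zero)
      col : ∀ {i j k s} → Cell l i k s → Cell l j k s → i ≡ j
      col (β , refl , refl , refl) (β′ , refl , p , q) = unique 1≢ β β′ (sym p) (sym q) zero
      row-M : ∀ {i j s} → i ∈ M → s ∈ M → Cell l i j s → ⊥
      row-M i∈M s∈M (β , refl , refl , refl) = sound β 0≢ (i∈M , s∈M)
      col-M : ∀ {i j s} → j ∈ M → s ∈ M → Cell l i j s → ⊥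
      col-M j∈M s∈M (β , refl , refl , refl) = sound β 1≢ (j∈M , s∈M)

    -- The block through `a` and `b` in the two symbol columns gives the cell. For uniqueness, the
    -- blocks `γ` and `δ` read off the two squares at one cell agree because the cell determines the
    -- entries, so `γ` shows both symbols.
    square-orthogonal : ∀ l l′ → l ≢ l′ → Orthogonal M (square l) (square l′)
    square-orthogonal l l′ l≢l′ a b ne =
      let β , p , q = find columns≢ ne in
      (entry β zero , entry β (suc zero)) ,
      (to-square′ l (β , refl , refl , p) , to-square′ l′ (β , refl , refl , q)) ,
      λ i′ j′ e e′ → same p q (from-square l e) (from-square l′ e′)
      where
      columns≢ : column l ≢ column l′
      columns≢ e = l≢l′ (suc-injective (suc-injective e))
      same : ∀ {β i′ j′} → entry β (column l) ≡ a → entry β (column l′) ≡ b → Cell l i′ j′ a → Cell l′ i′ j′ b →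
             i′ ≡ entry β zero × j′ ≡ entry β (suc zero)
      same {β} p q (γ , refl , refl , r) (δ , u , v , s) = agree zero , agree (suc zero)
        where
        γδ : entry γ (column l′) ≡ b
        γδ = trans (sym (unique first≢second δ γ u v (column l′))) s
        agree : ∀ j → entry γ j ≡ entry β j
        agree = unique columns≢ γ β (trans r (sym p)) (trans γδ (sym q))

  lastHole : ∀ N m → Subset (N + m)
  lastHole zero m = full
  lastHole (suc N) m = outside ∷ lastHole N m

  ∣lastHole∣ : ∀ N m → ∣ lastHole N m ∣ ≡ m
  ∣lastHole∣ zero m = ∣⊤∣≡n m
  ∣lastHole∣ (suc N) m = ∣lastHole∣ N m

  ↑ʳ∈lastHole : ∀ N {m} (w : Fin m) → (N ↑ʳ w) ∈ lastHole N m
  ↑ʳ∈lastHole zero w = ∈⊤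
  ↑ʳ∈lastHole (suc N) w = Vec.there (↑ʳ∈lastHole N w)

  ↑ˡ∉lastHole : ∀ {N} m (a : Fin N) → (a ↑ˡ m) ∉ lastHole N m
  ↑ˡ∉lastHole m zero ()
  ↑ˡ∉lastHole m (suc a) (Vec.there p) = ↑ˡ∉lastHole m a p

  -- `Holey` leaves out the pairs `(a , a)` with `a` outside the hole. Constant blocks supply them,
  -- and then exactly the pairs inside the hole are missing.
  H⇒IMOLS : ∀ {t N m} → H (2 + t) N m → IMOLS t (N + m) m
  H⇒IMOLS {t} {N} {m} O = M , ∣lastHole∣ N m , square M array , square-isIncompleteLatin M array , square-orthogonal M array
    where
    M = lastHole N m
    Point = Fin N ⊎ Fin m
    place : Point → Fin (N + m)
    place = join N m
    place-injective : ∀ {x y} → place x ≡ place y → x ≡ y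
    place-injective {x} {y} e = trans (sym (splitAt-join N m x)) (trans (cong (splitAt N) e) (splitAt-join N m y))
    with-diagonal : OA (2 + t) (λ x y → Holey (Fin N) (Fin m) x y ⊎ Image inj₁ _≡_ x y)
    with-diagonal = union (λ { e (_ , _ , refl , refl , refl) → e refl }) O (image inj₁ (λ { refl → refl }) diagonal)
    array : OA (2 + t) (NotBoth M)
    array = respects
      (λ { (x , y , e , refl , refl) → covered x y e })
      (λ {a} {b} ne → splitAt N a , splitAt N b ,
        cover (splitAt N a) (splitAt N b) (subst₂ (NotBoth M) (sym (join-splitAt N m a)) (sym (join-splitAt N m b)) ne) ,
        join-splitAt N m a , join-splitAt N m b)
      (image place place-injective with-diagonal)
      where
      covered : ∀ x y → Holey (Fin N) (Fin m) x y ⊎ Image inj₁ _≡_ x y → NotBoth M (place x) (place y)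
      covered (inj₁ a) y e (p , _) = ↑ˡ∉lastHole m a p
      covered (inj₂ w) (inj₁ b) e (_ , q) = ↑ˡ∉lastHole m b q
      covered (inj₂ w) (inj₂ u) (inj₁ ())
      covered (inj₂ w) (inj₂ u) (inj₂ (_ , _ , _ , () , _))
      cover : ∀ x y → NotBoth M (place x) (place y) → Holey (Fin N) (Fin m) x y ⊎ Image inj₁ _≡_ x y
      cover (inj₁ a) (inj₁ b) ne with a ≟ b
      ... | yes refl = inj₂ (a , a , refl , refl , refl)
      ... | no a≢b = inj₁ a≢b
      cover (inj₁ a) (inj₂ u) ne = inj₁ tt
      cover (inj₂ w) (inj₁ b) ne = inj₁ tt
      cover (inj₂ w) (inj₂ u) ne = ⊥-elim (ne (↑ʳ∈lastHole N w , ↑ʳ∈lastHole N u))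

-- From the rational inequality to bounds on natural numbers

module Bounds where

  open import Defs
  open LargeHoles
  open IncompleteLatinSquares
  open import Data.Nat.Base
  open import Data.Nat.Properties
  open import Data.Nat.Solver using (module +-*-Solver)
  open import Data.Integer.Base as ℤ using (ℤ; +_)
  import Data.Integer.Properties as ℤₚ
  open import Data.Rational.Base as ℚ using (ℚ; mkℚ; 0ℚ; 1ℚ; toℚᵘ)
  import Data.Rational.Properties as ℚₚ
  open import Data.Rational.Unnormalised.Base as ℚᵘ using (ℚᵘ; mkℚᵘ)
  import Data.Rational.Unnormalised.Properties as ℚᵘₚ
  open import Data.Product using (∃; _,_)
  open import Relation.Binary.PropositionalEquality

  toℚᵘ-ℕtoℚ : ∀ n → toℚᵘ (ℕtoℚ n) ℚᵘ.≃ mkℚᵘ (+ n) 0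
  toℚᵘ-ℕtoℚ n = ℚₚ.toℚᵘ-fromℚᵘ (mkℚᵘ (+ n) 0)

  -- Of ε only ε ≥ 1 / d is used, d being its denominator.
  clear-denominator : ∀ ε → 0ℚ ℚ.< ε → ∀ x y n →
    (1ℚ ℚ.+ ε) ℚ.* (ℕtoℚ x ℚ.* ℕtoℚ y) ℚ.< ℕtoℚ n →
    suc (ℚ.denominatorℕ ε) * (x * y) ≤ ℚ.denominatorℕ ε * n
  clear-denominator ε@(mkℚ (+ zero) d-1 _) (ℚ.*<* (ℤ.+<+ ()))
  clear-denominator ε@(mkℚ (+ suc a) d-1 c) 0<ε x y n h = from-ℤ h′
    where
    d = suc d-1
    open ℚᵘₚ using (<-respʳ-≃; <-respˡ-≃; *-cong; ≃-trans)
    eq : toℚᵘ ((1ℚ ℚ.+ ε) ℚ.* (ℕtoℚ x ℚ.* ℕtoℚ y)) ℚᵘ.≃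
         (mkℚᵘ (+ 1) 0 ℚᵘ.+ mkℚᵘ (+ suc a) d-1) ℚᵘ.* (mkℚᵘ (+ x) 0 ℚᵘ.* mkℚᵘ (+ y) 0)
    eq = ≃-trans (ℚₚ.toℚᵘ-homo-* (1ℚ ℚ.+ ε) (ℕtoℚ x ℚ.* ℕtoℚ y))
      (*-cong (ℚₚ.toℚᵘ-homo-+ 1ℚ ε)
        (≃-trans (ℚₚ.toℚᵘ-homo-* (ℕtoℚ x) (ℕtoℚ y)) (*-cong (toℚᵘ-ℕtoℚ x) (toℚᵘ-ℕtoℚ y))))
    h′ : (mkℚᵘ (+ 1) 0 ℚᵘ.+ mkℚᵘ (+ suc a) d-1) ℚᵘ.* (mkℚᵘ (+ x) 0 ℚᵘ.* mkℚᵘ (+ y) 0) ℚᵘ.< mkℚᵘ (+ n) 0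
    h′ = <-respʳ-≃ (toℚᵘ-ℕtoℚ n) (<-respˡ-≃ eq (ℚₚ.toℚᵘ-mono-< h))
    P : ℚᵘ
    P = (mkℚᵘ (+ 1) 0 ℚᵘ.+ mkℚᵘ (+ suc a) d-1) ℚᵘ.* (mkℚᵘ (+ x) 0 ℚᵘ.* mkℚᵘ (+ y) 0)
    numerator : ℚᵘ.↥ P ℤ.* + 1 ≡ + ((d + suc a) * (x * y))
    numerator = trans (ℤₚ.*-identityʳ (ℚᵘ.↥ P)) (trans (cong₂ ℤ._*_
      (cong₂ ℤ._+_ (ℤₚ.*-identityˡ (+ d)) (ℤₚ.*-identityʳ (+ suc a))) (sym (ℤₚ.pos-* x y)))
      (sym (ℤₚ.pos-* (d + suc a) (x * y))))
    denominator : + n ℤ.* ℚᵘ.↧ P ≡ + (n * d)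
    denominator = trans (cong (λ k → + n ℤ.* + k) (trans (*-identityʳ (1 * d)) (*-identityˡ d))) (sym (ℤₚ.pos-* n d))
    from-ℤ : P ℚᵘ.< mkℚᵘ (+ n) 0 → suc d * (x * y) ≤ d * n
    from-ℤ (ℚᵘ.*<* q) = begin
      suc d * (x * y)         ≤⟨ *-monoˡ-≤ (x * y) (≤-trans (≤-reflexive (+-comm 1 d)) (+-monoʳ-≤ d (s≤s z≤n))) ⟩
      (d + suc a) * (x * y)   ≤⟨ <⇒≤ (ℤₚ.drop‿+<+ (subst₂ ℤ._<_ numerator denominator q)) ⟩
      n * d                   ≡⟨ *-comm n d ⟩
      d * n                   ∎
      where open ≤-Reasoning

  -- `7 + t` is `suc t` plus 6. The factor `suc d` leaves a surplus `suc t * m` over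
  -- `d * (suc t * m)`, and `6 * d ≤ suc t` lets it pay for `6 * m` in each of `d` copies.
  large-quotient : ∀ d t m n .{{_ : NonZero d}} → 6 * d ≤ suc t → suc d * (suc t * m) ≤ d * n → (7 + t) * m ≤ n
  large-quotient d t m n 6d≤ h = *-cancelˡ-≤ d (begin
    d * ((7 + t) * m)                    ≡⟨ solve 3 (λ d t m → d :* ((con 7 :+ t) :* m) := con 6 :* d :* m :+ d :* ((con 1 :+ t) :* m)) refl d t m ⟩
    6 * d * m + d * (suc t * m)          ≤⟨ +-monoˡ-≤ _ (*-monoˡ-≤ m 6d≤) ⟩
    suc t * m + d * (suc t * m)          ≤⟨ h ⟩
    d * n                                ∎)
    where open ≤-Reasoning
          open +-*-Solver

  -- The arrays have `k = 2 + t` columns and `n ∸ m` points outside the hole, so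
  -- `(4 + k) * m ≤ n ∸ m` becomes `(7 + t) * m ≤ n`.
  IMOLS-large : ∀ t → ∃ λ n₀ → ∀ n m → n₀ ≤ m → (7 + t) * m ≤ n → IMOLS t n m
  IMOLS-large t = let m₀ , H-large = largeHole (suc t) in m₀ , λ n m m₀≤m bound →
    subst (λ n → IMOLS t n m) (m∸n+n≡m (≤-trans (m≤m+n m _) bound))
      (H⇒IMOLS (H-large (n ∸ m) m m₀≤m (subst (_≤ n ∸ m) (m+n∸m≡n m ((6 + t) * m)) (∸-monoˡ-≤ m bound))))

open import Defs
open import Data.Nat using (ℕ; suc; _≤_) renaming (_<_ to _<ℕ_)
open import Data.Rational using (ℚ; 0ℚ; 1ℚ; _+_; _*_; _<_)
open import Data.Product using (∃; ∃-syntax)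
open import Data.Product using (_,_; proj₁; proj₂)
open import Data.Nat.Properties using (<⇒≤; m≤n⇒m≤1+n)
import Data.Nat.Base as ℕ
open Bounds using (clear-denominator; large-quotient; IMOLS-large)

theorem6p3 : ∀ (ε : ℚ) → 0ℚ < ε →
    ∃[ t₀ ] ∀ (t : ℕ) → t₀ <ℕ t →
    ∃[ n₀ ] ∀ (n m : ℕ) → n₀ ≤ n → n₀ ≤ m →
    (1ℚ + ε) * (ℕtoℚ (suc t) * ℕtoℚ m) < ℕtoℚ n →
    IMOLS t n m
theorem6p3 ε 0<ε = 6 ℕ.* ℚ.denominatorℕ ε , λ t t₀<t →
  proj₁ (IMOLS-large t) , λ n m _ n₀≤m large →
    proj₂ (IMOLS-large t) n m n₀≤m
      (large-quotient (ℚ.denominatorℕ ε) t m n (m≤n⇒m≤1+n (<⇒≤ t₀<t)) (clear-denominator ε 0<ε (suc t) m n large))
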